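{- Let $\lambda=(s,2)$ with $s\ge2$. Then, as operators on $\mathbf F$, \[ s_\lambda(\mathbf u)=\sum_T u_{\mathrm{reading}(T)}, \] where the sum is over all $n$-commuting tableaux $T$ of shape $(s,2)$.
   Context: Fix an integer $n\ge 1$. Partitions are drawn in English notation; the box in row $r$ and column $c$ lies on diagonal $c-r$. An $n$-ribbon is a connected skew shape with $n$ boxes containing no $2\times 2$ square; its head is its top-right box, and its spin is its number of rows minus $1$. Let $K=\mathbb{C}(q)$ and let $\mathbf F$ be the $K$-vector space with basis the set of all partitions. For $i\in\mathbb{Z}$, $u_i\in\mathrm{End}_K(\mathbf F)$ is defined by $u_i(\lambda)=q^{\mathrm{spin}(\mu/\lambda)}\mu$ if there is a partition $\mu$ with $\mu/\lambda$ an $n$-ribbon with head on diagonal $i$, else $0$. Let $h_k(\mathbf u)=\sum_{i_1<\cdots<i_k}u_{i_k}\cdots u_{i_1}$, $h_0(\mathbf u)=1$, $h_k(\mathbf u)=0$ for $k<0$; these operators pairwise commute, and $s_\lambda(\mathbf u)=\det\big(h_{\lambda_i-i+j}(\mathbf u)\big)_{i,j=1}^{\ell(\lambda)}$. A filling $T$ of the shape $(s,2)$ by integers, with $T(x,y)$ the entry in row $x$ and column $y$ (indices starting at 1), is $n$-commuting if: (1) rows are strictly increasing: $T(x,y)<T(x,y+1)$; (2) $T(1,2)\le T(2,2)$; (3) either $T(1,1)>T(2,1)$ and $T(2,2)-T(2,1)\le n$, or $T(1,1)<T(2,1)$ and either $T(1,2)\le T(2,1)$, or both $T(1,2)>T(2,1)$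 and $T(2,2)-T(1,1)>n$. The reading word $\mathrm{reading}(T)$ reads the first row from right to left and then the second row from right to left; for a word $w=w_1\cdots w_k$ put $u_w=u_{w_1}\cdots u_{w_k}$. Infinite sums of operators here are well defined since only finitely many terms act nontrivially on a given partition. -}

module Defs where

open import Data.Bool using (Bool; true; false; _∧_; _∨_; not; if_then_else_)
open import Data.Nat as ℕ using (ℕ; zero; suc; _+_; _∸_)
open import Data.Integer as ℤ using (ℤ; +_; -[1+_])
open import Data.List using (List; []; _∷_; map; concatMap; filterᵇ; length; foldr; _++_; reverse; upTo; applyUpTo; deduplicate; splitAt)
open import Data.Nat.ListAction using (sum)
open import Data.Bool.ListAction using (all; any)
open import Data.List.Properties using (≡-dec)
open import Data.List.Relation.Unary.All using (All)
open import Data.List.Relation.Unary.Linked using (Linked)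
open import Data.Maybe using (Maybe; just; nothing)
open import Data.Product using (_×_; _,_; proj₁; proj₂)
open import Data.Vec using (Vec) renaming ([] to []ᵥ; _∷_ to _∷ᵥ_; toList to toListᵥ)
open import Relation.Nullary.Decidable using (⌊_⌋)

infix 4 _≤ᵇ_ _==_ _≤ℤ_ _<ℤ_

_≤ᵇ_ : ℕ → ℕ → Bool
a ≤ᵇ b = ⌊ a ℕ.≤? b ⌋

_==_ : ℕ → ℕ → Bool
a == b = ⌊ a ℕ.≟ b ⌋

_≤ℤ_ : ℤ → ℤ → Bool
a ≤ℤ b = ⌊ a ℤ.≤? b ⌋

_<ℤ_ : ℤ → ℤ → Bool
a <ℤ b = ⌊ a ℤ.<? b ⌋

-- Partitions: lists of positive parts, weakly decreasing.
-- Rows and columns are indexed from 0 internally; the diagonal c - r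
-- is the same as with 1-based indices.

IsPartition : List ℕ → Set
IsPartition la = All (λ k → 1 ℕ.≤ k) la × Linked ℕ._≥_ la

size : List ℕ → ℕ
size = sum

rowLen : List ℕ → ℕ → ℕ
rowLen [] r = 0
rowLen (a ∷ la) zero = a
rowLen (a ∷ la) (suc r) = rowLen la r

-- partitions of r with all parts ≤ b (fuel f ≥ r suffices)
partitionsBounded : ℕ → ℕ → ℕ → List (List ℕ)
partitionsBounded f zero b = [] ∷ []
partitionsBounded zero (suc r) b = []
partitionsBounded (suc f) (suc r) b =
  concatMap (λ k → map (k ∷_) (partitionsBounded f (suc r ∸ k) k))
            (filterᵇ (λ k → k ≤ᵇ b) (applyUpTo suc (suc r)))

partitionsOf : ℕ → List (List ℕ)
partitionsOf N = partitionsBounded N N N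

Cell : Set
Cell = ℕ × ℕ   -- (row , column)

cellEq : Cell → Cell → Bool
cellEq (a , b) (c , d) = (a == c) ∧ (b == d)

memᵇ : Cell → List Cell → Bool
memᵇ x xs = any (cellEq x) xs

containedᵇ : List ℕ → List ℕ → Bool
containedᵇ la mu = all (λ r → rowLen la r ≤ᵇ rowLen mu r) (upTo (length la))

skewCells : List ℕ → List ℕ → List Cell
skewCells la mu =
  concatMap (λ r → map (λ j → (r , rowLen la r + j))
                       (upTo (rowLen mu r ∸ rowLen la r)))
            (upTo (length mu))

adjᵇ : Cell → Cell → Bool
adjᵇ (r , c) (r' , c') =
  ((r == r') ∧ ((suc c == c') ∨ (suc c' == c))) ∨
  ((c == c') ∧ ((suc r == r') ∨ (suc r' == r)))

grow : List Cell → List Cell → List Cell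
grow S R = filterᵇ (λ x → memᵇ x R ∨ any (adjᵇ x) R) S

iterate : {A : Set} → ℕ → (A → A) → A → A
iterate zero g a = a
iterate (suc k) g a = iterate k g (g a)

-- S is connected (as a set of cells under edge adjacency);
-- |S| rounds of search from the first cell reach every cell of its component
connectedᵇ : List Cell → Bool
connectedᵇ [] = true
connectedᵇ (x ∷ xs) =
  all (λ y → memᵇ y reached) (x ∷ xs)
  where reached = iterate (length (x ∷ xs)) (grow (x ∷ xs)) (x ∷ [])

no2x2ᵇ : List Cell → Bool
no2x2ᵇ S = not (any (λ { (r , c) →
  memᵇ (suc r , c) S ∧ memᵇ (r , suc c) S ∧ memᵇ (suc r , suc c) S }) S)

isRibbonᵇ : ℕ → List ℕ → List ℕ → Bool
isRibbonᵇ n la mu =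
  containedᵇ la mu ∧ (length S == n) ∧ connectedᵇ S ∧ no2x2ᵇ S
  where S = skewCells la mu

occupiedRows : ℕ → List Cell → List ℕ
occupiedRows R S = filterᵇ (λ r → any (λ x → proj₁ x == r) S) (upTo R)

spin : List ℕ → List ℕ → ℕ
spin la mu = length (occupiedRows (length mu) (skewCells la mu)) ∸ 1

headCell : List ℕ → List ℕ → Cell
headCell la mu with occupiedRows (length mu) (skewCells la mu)
... | [] = (0 , 0)
... | r ∷ _ = (r , rowLen mu r ∸ 1)

diagonal : Cell → ℤ
diagonal (r , c) = + c ℤ.- + r

steps : ℕ → List ℕ → List (ℤ × ℕ × List ℕ)
steps n la =
  concatMap (λ mu → if isRibbonᵇ n la mu
                     then (diagonal (headCell la mu) , spin la mu , mu) ∷ []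
                     else [])
            (partitionsOf (size la + n))

-- The Fock space F.  Elements reached from basis vectors are finite
-- Z[q]-combinations of partitions; a formal sum is a list of terms
-- (c , e , p) meaning c q^e p.  Operators are given on basis vectors.

Term : Set
Term = ℤ × ℕ × List ℕ

FSum : Set
FSum = List Term

Op : Set
Op = List ℕ → FSum

scale : ℤ → ℕ → FSum → FSum
scale c e = map (λ { (c' , e' , p) → (c ℤ.* c' , e + e' , p) })

applyOp : Op → FSum → FSum
applyOp A = concatMap (λ { (c , e , p) → scale c e (A p) })

idOp : Op
idOp p = (+ 1 , 0 , p) ∷ []

_∘Op_ : Op → Op → Op
(A ∘Op B) p = applyOp A (B p)

_−Op_ : Op → Op → Op
(A −Op B) p = A p ++ scale (-[1+ 0 ]) 0 (B p)

coeff : FSum → List ℕ → ℕ → ℤ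
coeff v mu e =
  foldr ℤ._+_ (+ 0)
    (map (λ { (c , e' , p) → if ⌊ ≡-dec ℕ._≟_ p mu ⌋ ∧ (e' == e) then c else + 0 }) v)

u : ℕ → ℤ → Op
u n i la = map (λ { (_ , sp , mu) → (+ 1 , sp , mu) })
               (filterᵇ (λ t → ⌊ proj₁ t ℤ.≟ i ⌋) (steps n la))

uWord : ℕ → List ℤ → Op
uWord n [] = idOp
uWord n (i ∷ w) = u n i ∘Op uWord n w

runs : ℕ → ℕ → List ℕ → List (List ℤ)
runs n zero la = [] ∷ []
runs n (suc k) la = concatMap (λ { (i , _ , mu) → map (i ∷_) (runs n k mu) }) (steps n la)

-- the words w of length k with u_w la possibly nonzero (every other word
-- of length k gives u_w la = 0), without repetition
candidates : ℕ → ℕ → List ℕ → List (List ℤ)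
candidates n k la = deduplicate (≡-dec ℤ._≟_) (map reverse (runs n k la))

-- Σ_{w ∈ ℤ^k, P w} u_w, evaluated on the basis vector la
sumWords : ℕ → ℕ → (List ℤ → Bool) → Op
sumWords n k P la = concatMap (λ w → if P w then uWord n w la else []) (candidates n k la)

strictlyDecreasingᵇ : List ℤ → Bool
strictlyDecreasingᵇ [] = true
strictlyDecreasingᵇ (a ∷ []) = true
strictlyDecreasingᵇ (a ∷ b ∷ w) = (b <ℤ a) ∧ strictlyDecreasingᵇ (b ∷ w)

-- h_k(u) = Σ_{i1 < ⋯ < ik} u_{ik} ⋯ u_{i1}
-- (the word (ik , … , i1) is strictly decreasing); h_0 = 1
h : ℕ → ℕ → Op
h n k = sumWords n k strictlyDecreasingᵇ

-- s_{(s,2)}(u) = det [[h_s , h_{s+1}] , [h_1 , h_2]] = h_s h_2 - h_{s+1} h_1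
schur2 : ℕ → ℕ → Op
schur2 n s = (h n s ∘Op h n 2) −Op (h n (suc s) ∘Op h n 1)

record Filling (s : ℕ) : Set where
  constructor filling
  field
    row1 : Vec ℤ s
    row2 : Vec ℤ 2
open Filling public

strictlyIncreasingᵇ : List ℤ → Bool
strictlyIncreasingᵇ [] = true
strictlyIncreasingᵇ (a ∷ []) = true
strictlyIncreasingᵇ (a ∷ b ∷ w) = (a <ℤ b) ∧ strictlyIncreasingᵇ (b ∷ w)

reading : {s : ℕ} → Filling s → List ℤ
reading T = reverse (toListᵥ (row1 T)) ++ reverse (toListᵥ (row2 T))

-- n-commuting condition (only meaningful for s ≥ 2)
nCommutingᵇ : ℕ → {s : ℕ} → Filling s → Bool
nCommutingᵇ n (filling (a ∷ᵥ b ∷ᵥ rest) (c ∷ᵥ d ∷ᵥ []ᵥ)) =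
  strictlyIncreasingᵇ (a ∷ b ∷ toListᵥ rest) ∧ (c <ℤ d)
  ∧ (b ≤ℤ d)
  ∧ ( ((c <ℤ a) ∧ ((d ℤ.- c) ≤ℤ (+ n)))
    ∨ ((a <ℤ c) ∧ ((b ≤ℤ c) ∨ ((c <ℤ b) ∧ ((+ n) <ℤ (d ℤ.- a))))))
nCommutingᵇ n _ = false

toVec? : (m : ℕ) → List ℤ → Maybe (Vec ℤ m)
toVec? zero [] = just []ᵥ
toVec? zero (_ ∷ _) = nothing
toVec? (suc m) [] = nothing
toVec? (suc m) (x ∷ xs) with toVec? m xs
... | just v = just (x ∷ᵥ v)
... | nothing = nothing

fillingsWithReading : (s : ℕ) → List ℤ → List (Filling s)
fillingsWithReading s w with toVec? s (reverse (proj₁ (splitAt s w)))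
                          | toVec? 2 (reverse (proj₂ (splitAt s w)))
... | just r1 | just r2 = filling r1 r2 ∷ []
... | _ | _ = []

-- Σ_{T n-commuting of shape (s,2)} u_{reading(T)}, evaluated on la.
-- Only T with reading(T) among the candidate words can contribute.
commutingSum : ℕ → (s : ℕ) → Op
commutingSum n s la =
  concatMap (λ w → concatMap (λ T → if nCommutingᵇ n T then uWord n (reading T) la else [])
                             (fillingsWithReading s w))
            (candidates n (s + 2) la)

{-# OPTIONS --safe #-}

-- Encode a partition by its beads λ_r - r.  Adding an n-ribbon with head on diagonal i moves a
-- bead from i + 1 - n to the free position i + 1, and its spin is the number of beads jumped over.
-- With N λ k the number of beads beyond k, this adds 1 to N on the window i - n < k ≤ i and changes
-- nothing else; the relations u_x u_x = 0, u_x u_y u_x = 0, u_z u_x = u_x u_z for x + n < z and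
-- u_z u_x = q² u_x u_z for x < z < x + n can be read off from N.
-- Expand both sides into words whose letters lie in a finite set containing all those that occur
-- with nonzero effect.  A word of length s + 2 is v b a d c, and the coefficients of s_λ(u) and of
-- the tableau sum share the factor saying that v b is decreasing, so it suffices to treat the sum
-- over a, d, c for fixed v and b.  There the terms are grouped by the letters x < y < z: if
-- x + n < z they cancel because u_x u_z = u_z u_x, and otherwise because u_y commutes with both
-- u_x u_z and u_z u_x, the powers of q cancelling.
module Submission where

open import Defs
open import Data.Bool using (Bool; true; false; _∧_; if_then_else_; _∨_; not; T; T?)
open import Data.Empty using (⊥; ⊥-elim)
open import Data.Nat as ℕ using (ℕ; _≤_; zero; suc; z≤n; s≤s)
import Data.Nat.Properties as ℕP
open import Data.Integer as ℤ using (ℤ; +_; -[1+_]; +≤+; +<+; ∣_∣)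
import Data.Integer.Properties as ℤP
open import Data.List using (List; []; _∷_; length; map; concatMap; upTo; applyUpTo; filterᵇ; _++_; concat; reverse; deduplicate; filter; splitAt)
open import Data.List.Relation.Unary.All as All using (All; []; _∷_)
open import Data.List.Relation.Unary.Linked as Linked using (Linked; []; [-]; _∷_)
open import Data.Product using (_×_; _,_; proj₁; proj₂; ∃-syntax)
open import Data.Sum using (_⊎_; inj₁; inj₂; [_,_]′)
open import Function using (_∘_; id; Equivalence; mk⇔)
open import Relation.Nullary using (¬_; Dec; yes; no; contradiction; ¬?)
open import Relation.Nullary.Decidable using (⌊_⌋; toWitness; fromWitness; _×-dec_)
open import Relation.Binary.PropositionalEquality using (_≡_; _≢_; refl; sym; trans; cong; cong₂; subst; subst₂; module ≡-Reasoning)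
open import Data.Bool.Properties using (T-∧; T-∨; T-≡; ∧-assoc; ∧-comm; ∧-identityʳ)
open import Data.Bool.ListAction using (any)
open import Data.Unit using (tt)
open import Data.Integer.Solver using (module +-*-Solver)
open import Data.List.Properties using (length-map; length-applyUpTo; filter-none; filter-accept; filter-reject; map-++; length-++; filter-++; ++-identityʳ; ∷-injectiveʳ; ≡-dec; map-injective; concatMap-++; ++-assoc; reverse-++; unfold-reverse; reverse-involutive; length-reverse; map-concatMap; ∷-injectiveˡ)
open import Data.List.Membership.Propositional using (_∈_; find; lose)
open import Data.List.Membership.Propositional.Properties using (∈-concatMap⁺; ∈-concatMap⁻; ∈-upTo⁺; ∈-upTo⁻; ∈-map⁺; ∈-map⁻; ∈-filter⁺; ∈-filter⁻; ∈-applyUpTo⁺; ∈-deduplicate⁺; ∈-deduplicate⁻; ∈-concat⁺′)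
open import Data.List.Membership.Propositional.Properties.WithK using (unique∧set⇒bag)
open import Data.List.Relation.Binary.BagAndSetEquality using (∼bag⇒↭)
open import Data.List.Relation.Binary.Permutation.Propositional using (_↭_)
open import Data.List.Relation.Binary.Permutation.Propositional.Properties using (↭-length)
import Data.List.Relation.Unary.All.Properties as AllP
import Data.List.Relation.Unary.AllPairs.Properties as AllPairsP
open import Data.List.Relation.Unary.Any as Any using (Any; here; there)
import Data.List.Relation.Unary.Any.Properties as AnyP
open import Data.List.Relation.Unary.Unique.Propositional using (Unique)
import Data.List.Relation.Unary.Unique.Propositional.Properties as UniqueP
import Algebra.Bundles
import Algebra.Properties.Group
open import Data.List.Relation.Unary.AllPairs as AllPairs using ([]; _∷_)
open import Data.List.Extrema ℤP.≤-totalOrder using (argmax; argmin; argmax-all; argmin-all; f[xs]≤f[argmax]; f[argmin]≤f[xs]; f[⊥]≤f[argmax]; f[argmin]≤f[⊤])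
import Algebra.Properties.CommutativeSemigroup
open import Data.Nat.ListAction using (sum)
import Data.Nat.Solver as ℕSolver
open import Relation.Binary.Definitions using (tri<; tri≈; tri>)
import Data.List.Relation.Binary.Permutation.Propositional as Perm
import Data.List.Relation.Unary.Unique.DecPropositional.Properties as DecUnique
open import Data.Vec using (toList) renaming ([] to []ᵥ; _∷_ to _∷ᵥ_)
open import Data.Maybe using (just)

open Equivalence using (to; from)
open Algebra.Properties.Group (Algebra.Bundles.AbelianGroup.group ℤP.+-0-abelianGroup) using (∙-cancelˡ)
open Algebra.Properties.CommutativeSemigroup ℤP.+-commutativeSemigroup using () renaming (interchange to +-interchange)

-- With `N`, adding ribbons becomes adding functions: the partition reached by two ribbons depends
-- only on the sum of two indicators. The order matters only for the spins and for whether each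
-- single move exists. The spin is `N` at the low end of the window minus `N` at its high end. If x
-- < z < x + n, the window of x covers the low end of that of z and raises the spin of z by one,
-- while the window of z covers the high end of that of x and lowers the spin of x by one. This is
-- the exponent 2. At z = x + n neither relation holds: the ribbon of x puts a bead exactly where
-- the ribbon of z picks one up. The cancellation avoids this pair: for x < y < z and z at most x +
-- n both inner distances are less than n, so moving u_y past the other two letters uses no relation
-- between x and z. A second obstacle lies in the encoding: every sum runs over words enumerated
-- from the vector acted on, so the two factors of a product have different ranges. A fixed alphabet
-- is needed before sums can be interchanged.

private variable
  la mu nu : List ℕ
  b : ℕ → ℤ
  n r m j c r′ c′ : ℕ
  i k x y z : ℤ
  A B : Set
  S R : List Cell
  s t : Cell

-- Beads and the bead count `N`

Decreasing : (ℕ → ℤ) → Set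
Decreasing b = ∀ r → b (suc r) ℤ.< b r

decreasing-≤ : Decreasing b → r ℕ.≤ m → b m ℤ.≤ b r
decreasing-≤ {b} d r≤m = go (ℕP.≤⇒≤′ r≤m)
  where
  go : ∀ {r m} → r ℕ.≤′ m → b m ℤ.≤ b r
  go ℕ.≤′-refl = ℤP.≤-refl
  go (ℕ.≤′-step p) = ℤP.≤-trans (ℤP.<⇒≤ (d _)) (go p)

count : ℕ → (ℕ → ℤ) → ℤ → ℕ
count zero b k = 0
count (suc f) b k with k ℤ.<? b 0
... | yes _ = suc (count f (b ∘ suc) k)
... | no _ = 0

-- Once the bead in row `f` is at most `k`, so are all later ones, and `f` rounds of the search miss
-- nothing.
count⁺ : ∀ f → Decreasing b → b f ℤ.≤ k → k ℤ.< b r → r ℕ.< count f b k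
count⁺ zero d bf≤k k<br =
  contradiction (ℤP.<-≤-trans k<br (ℤP.≤-trans (decreasing-≤ d z≤n) bf≤k)) (ℤP.<-irrefl refl)
count⁺ {b} {k} {r} (suc f) d bf≤k k<br with k ℤ.<? b 0
count⁺ {r = zero} (suc f) d bf≤k k<br | yes _ = s≤s z≤n
count⁺ {r = suc r} (suc f) d bf≤k k<br | yes _ = s≤s (count⁺ f (d ∘ suc) bf≤k k<br)
... | no k≮b0 = contradiction (ℤP.<-≤-trans k<br (decreasing-≤ d z≤n)) k≮b0

count⁻ : ∀ f → r ℕ.< count f b k → k ℤ.< b r
count⁻ {b = b} {k} (suc f) r<c with k ℤ.<? b 0
count⁻ {r = zero} (suc f) r<c | yes k<b0 = k<b0
count⁻ {r = suc r} (suc f) (s≤s r<c) | yes _ = count⁻ f r<c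

-- The beads la r are the positions of the Maya diagram of la.
beads : List ℕ → ℕ → ℤ
beads la r = + rowLen la r ℤ.- + r

-- N la k is both the number of beads beyond k and, up to a constant independent
-- of la, the number of boxes of la on diagonal k.
N : List ℕ → ℤ → ℕ
N la k = count (length la ℕ.+ ∣ k ∣) (beads la) k

rowLen-antitone : Linked ℕ._≥_ la → ∀ r → rowLen la (suc r) ℕ.≤ rowLen la r
rowLen-antitone [] r = z≤n
rowLen-antitone [-] zero = z≤n
rowLen-antitone [-] (suc r) = z≤n
rowLen-antitone (p ∷ l) zero = p
rowLen-antitone (p ∷ l) (suc r) = rowLen-antitone l r

beads-decreasing : IsPartition la → Decreasing (beads la)
beads-decreasing (_ , l) r =
  ℤP.+-mono-≤-< (+≤+ (rowLen-antitone l r)) (ℤP.neg-mono-< (+<+ (ℕP.n<1+n r)))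

rowLen-length : ∀ la j → rowLen la (length la ℕ.+ j) ≡ 0
rowLen-length [] j = refl
rowLen-length (a ∷ la) j = rowLen-length la j

-∣k∣≤k : ∀ k → ℤ.- (+ ∣ k ∣) ℤ.≤ k
-∣k∣≤k (+ zero) = ℤP.≤-refl
-∣k∣≤k (+ suc j) = ℤ.-≤+
-∣k∣≤k (-[1+ j ]) = ℤP.≤-refl

-- This row is empty and its bead is minus its index, which is at most -|k|. Hence the number of
-- rounds allotted in `N` suffices.
beads-low : ∀ la k → beads la (length la ℕ.+ ∣ k ∣) ℤ.≤ k
beads-low la k rewrite rowLen-length la ∣ k ∣ | ℤP.+-identityˡ (ℤ.- (+ (length la ℕ.+ ∣ k ∣))) =
  ℤP.≤-trans (ℤP.neg-mono-≤ (+≤+ (ℕP.m≤n+m ∣ k ∣ (length la)))) (-∣k∣≤k k)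

-- Together with `N⁻` this is an adjunction between rows and diagonals, through which facts about
-- beads and about counts are exchanged.
N⁺ : IsPartition la → k ℤ.< beads la r → r ℕ.< N la k
N⁺ {la} {k} p = count⁺ (length la ℕ.+ ∣ k ∣) (beads-decreasing p) (beads-low la k)

N⁻ : r ℕ.< N la k → k ℤ.< beads la r
N⁻ {la = la} {k} = count⁻ (length la ℕ.+ ∣ k ∣)

N≤⇒beads≤ : IsPartition la → N la k ℕ.≤ r → beads la r ℤ.≤ k
N≤⇒beads≤ p N≤r = ℤP.≮⇒≥ λ k<b → ℕP.<⇒≱ (N⁺ p k<b) N≤r

beads≤⇒N≤ : beads la r ℤ.≤ k → N la k ℕ.≤ r
beads≤⇒N≤ {la = la} b≤k = ℕP.≮⇒≥ λ r<N → ℤP.<⇒≱ (N⁻ {la = la} r<N) b≤k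

N-antitone : IsPartition la → x ℤ.≤ y → N la y ℕ.≤ N la x
N-antitone {la} p x≤y =
  beads≤⇒N≤ {la = la} (ℤP.≤-trans (N≤⇒beads≤ p ℕP.≤-refl) x≤y)

-- Beads occupy distinct positions, so at most one of them sits at `suc k`.
N-step : IsPartition la → ∀ k → N la k ℕ.≤ suc (N la (ℤ.suc k))
N-step {la} p k = beads≤⇒N≤ {la = la} (ℤP.≮⇒≥ λ k<b →
  ℤP.<⇒≱ (ℤP.≤-<-trans (ℤP.i<j⇒suc[i]≤j k<b) (beads-decreasing p _)) (N≤⇒beads≤ p ℕP.≤-refl))

-- Positivity of the parts forces both lists to end at the same row.
rowLen-injective : All (1 ℕ.≤_) la → All (1 ℕ.≤_) mu → (∀ r → rowLen la r ≡ rowLen mu r) → la ≡ mu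
rowLen-injective [] [] e = refl
rowLen-injective [] (1≤m ∷ _) e = contradiction (subst (1 ℕ.≤_) (sym (e 0)) 1≤m) λ ()
rowLen-injective (1≤l ∷ _) [] e = contradiction (subst (1 ℕ.≤_) (e 0) 1≤l) λ ()
rowLen-injective (_ ∷ la⁺) (_ ∷ mu⁺) e = cong₂ _∷_ (e 0) (rowLen-injective la⁺ mu⁺ (e ∘ suc))

-- At k = beads mu r the count N mu k does not exceed r.
N-mono⇒beads-mono : IsPartition la → (∀ k → N la k ℕ.≤ N mu k) → ∀ r → beads la r ℤ.≤ beads mu r
N-mono⇒beads-mono {mu = mu} p N≤N r =
  N≤⇒beads≤ {r = r} p (ℕP.≤-trans (N≤N (beads mu r)) (beads≤⇒N≤ {la = mu} ℤP.≤-refl))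

beads-rowLen-≤ : ∀ la mu r → beads la r ℤ.≤ beads mu r → rowLen la r ℕ.≤ rowLen mu r
beads-rowLen-≤ la mu r b≤b =
  ℕP.≮⇒≥ λ m<l → ℤP.<⇒≱ (ℤP.+-monoˡ-< (ℤ.- (+ r)) (+<+ m<l)) b≤b

-- Partitions reached by different sequences of ribbons are identified through this, by comparing
-- counts.
N-injective : IsPartition la → IsPartition mu → (∀ k → N la k ≡ N mu k) → la ≡ mu
N-injective {la} {mu} p q e = rowLen-injective (proj₁ p) (proj₁ q) λ r → ℕP.≤-antisym
  (beads-rowLen-≤ la mu r (N-mono⇒beads-mono {mu = mu} p (ℕP.≤-reflexive ∘ e) r))
  (beads-rowLen-≤ mu la r (N-mono⇒beads-mono {mu = la} q (ℕP.≤-reflexive ∘ sym ∘ e) r))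

-- The window of diagonals met by a ribbon

δ : ℕ → ℤ → ℤ → ℕ
δ n i k = if ⌊ i ℤ.- + n ℤ.<? k ⌋ ∧ ⌊ k ℤ.≤? i ⌋ then 1 else 0

δ-in : i ℤ.- + n ℤ.< k → k ℤ.≤ i → δ n i k ≡ 1
δ-in {i} {n} {k} l u with i ℤ.- + n ℤ.<? k | k ℤ.≤? i
... | yes _ | yes _ = refl
... | yes _ | no ¬u = contradiction u ¬u
... | no ¬l | _ = contradiction l ¬l

δ-low : k ℤ.≤ i ℤ.- + n → δ n i k ≡ 0
δ-low {k} {i} {n} k≤ with i ℤ.- + n ℤ.<? k
... | yes l = contradiction k≤ (ℤP.<⇒≱ l)
... | no _ = refl

δ-high : i ℤ.< k → δ n i k ≡ 0
δ-high {i} {k} {n} i<k with i ℤ.- + n ℤ.<? k | k ℤ.≤? i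
... | yes _ | yes u = contradiction u (ℤP.<⇒≱ i<k)
... | yes _ | no _ = refl
... | no _ | _ = refl

data Window (n : ℕ) (i k : ℤ) : Set where
  below  : k ℤ.≤ i ℤ.- + n → δ n i k ≡ 0 → Window n i k
  inside : i ℤ.- + n ℤ.< k → k ℤ.≤ i → δ n i k ≡ 1 → Window n i k
  above  : i ℤ.< k → δ n i k ≡ 0 → Window n i k

window : ∀ n i k → Window n i k
window n i k with i ℤ.- + n ℤ.<? k | k ℤ.≤? i
... | no ¬l | _ = below (ℤP.≮⇒≥ ¬l) (δ-low {k} {i} {n} (ℤP.≮⇒≥ ¬l))
... | yes l | yes u = inside l u (δ-in {i} {n} l u)
... | yes l | no ¬u = above (ℤP.≰⇒> ¬u) (δ-high {n = n} (ℤP.≰⇒> ¬u))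

-- Boolean tests on cells and adjacency

==⇒≡ : T (r == c) → r ≡ c
==⇒≡ = toWitness

==-refl : ∀ r → T (r == r)
==-refl r = fromWitness {a? = r ℕ.≟ r} refl

T-cellEq : T (cellEq s t) → s ≡ t
T-cellEq {a , b} {c , d} p with to (T-∧ {a == c}) p
... | a≡c , b≡d = cong₂ _,_ (==⇒≡ a≡c) (==⇒≡ b≡d)

cellEq-refl : ∀ s → T (cellEq s s)
cellEq-refl (a , b) = from (T-∧ {a == a}) (==-refl a , ==-refl b)

mem⁻ : T (memᵇ s S) → s ∈ S
mem⁻ {s} {S} = Any.map T-cellEq ∘ AnyP.any⁻ (cellEq s) S

mem⁺ : s ∈ S → T (memᵇ s S)
mem⁺ {s} s∈S = AnyP.any⁺ (cellEq s) (Any.map (λ { refl → cellEq-refl s }) s∈S)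

diagonal-right : ∀ r c → diagonal (r , suc c) ≡ ℤ.suc (diagonal (r , c))
diagonal-right r c = ℤP.+-assoc (+ 1) (+ c) (ℤ.- + r)

diagonal-up : ∀ r c → diagonal (r , c) ≡ ℤ.suc (diagonal (suc r , c))
diagonal-up r c = lemma (+ c) (+ r)
  where
  open +-*-Solver
  lemma : ∀ x y → x ℤ.- y ≡ + 1 ℤ.+ (x ℤ.- (+ 1 ℤ.+ y))
  lemma = solve 2 (λ x y → x :- y := con (+ 1) :+ (x :- (con (+ 1) :+ y))) refl

adj⁻ : ∀ s t → T (adjᵇ s t) → diagonal t ≡ ℤ.suc (diagonal s) ⊎ diagonal s ≡ ℤ.suc (diagonal t)
adj⁻ (r , c) (r′ , c′) p with to (T-∨ {(r == r′) ∧ ((suc c == c′) ∨ (suc c′ == c))}) p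
adj⁻ (r , c) (r′ , c′) p | inj₁ q with to (T-∧ {r == r′}) q
... | r≡r′ , q′ with ==⇒≡ {r} {r′} r≡r′ | to (T-∨ {suc c == c′}) q′
...   | refl | inj₁ e = inj₁ (subst (λ c′ → diagonal (r , c′) ≡ _) (==⇒≡ e) (diagonal-right r c))
...   | refl | inj₂ e = inj₂ (subst (λ c → diagonal (r , c) ≡ _) (==⇒≡ e) (diagonal-right r c′))
adj⁻ (r , c) (r′ , c′) p | inj₂ q with to (T-∧ {c == c′}) q
... | c≡c′ , q′ with ==⇒≡ {c} {c′} c≡c′ | to (T-∨ {suc r == r′}) q′
...   | refl | inj₁ e = inj₂ (subst (λ r′ → _ ≡ ℤ.suc (diagonal (r′ , c))) (==⇒≡ e) (diagonal-up r c))
...   | refl | inj₂ e = inj₁ (subst (λ r → _ ≡ ℤ.suc (diagonal (r , c))) (==⇒≡ e) (diagonal-up r′ c))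

adj-row : ∀ r c → T (adjᵇ (r , c) (r , suc c)) × T (adjᵇ (r , suc c) (r , c))
adj-row r c =
  from (T-∨ {(r == r) ∧ _}) (inj₁ (from (T-∧ {r == r}) (==-refl r , from (T-∨ {suc c == suc c}) (inj₁ (==-refl (suc c)))))) ,
  from (T-∨ {(r == r) ∧ _}) (inj₁ (from (T-∧ {r == r}) (==-refl r , from (T-∨ {suc (suc c) == c}) (inj₂ (==-refl (suc c))))))

adj-column : ∀ r c → T (adjᵇ (r , c) (suc r , c)) × T (adjᵇ (suc r , c) (r , c))
adj-column r c =
  from (T-∨ {(r == suc r) ∧ _}) (inj₂ (from (T-∧ {c == c}) (==-refl c , from (T-∨ {suc r == suc r}) (inj₁ (==-refl (suc r)))))) ,
  from (T-∨ {(suc r == r) ∧ _}) (inj₂ (from (T-∧ {c == c}) (==-refl c , from (T-∨ {suc (suc r) == r}) (inj₂ (==-refl (suc r))))))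

-- Cells of a skew shape

rowLen-positive : ∀ la → r ℕ.< rowLen la m → m ℕ.< length la
rowLen-positive {m = zero} (a ∷ la) _ = s≤s z≤n
rowLen-positive {m = suc m} (a ∷ la) p = s≤s (rowLen-positive la p)

∈-skewCells⁻ : (r , c) ∈ skewCells la mu → rowLen la r ℕ.≤ c × c ℕ.< rowLen mu r
∈-skewCells⁻ {la = la} {mu} p with find (∈-concatMap⁻ _ {xs = upTo (length mu)} p)
... | r , _ , q with ∈-map⁻ _ q
...   | j , j∈ , refl = ℕP.m≤m+n _ j , ℕP.≰⇒> λ mu≤ → ℕP.<⇒≱ (∈-upTo⁻ j∈)
        (ℕP.≤-trans (ℕP.∸-monoˡ-≤ (rowLen la r) mu≤) (ℕP.≤-reflexive (ℕP.m+n∸m≡n (rowLen la r) j)))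

∈-skewCells⁺ : rowLen la r ℕ.≤ c → c ℕ.< rowLen mu r → (r , c) ∈ skewCells la mu
∈-skewCells⁺ {la} {r} {c} {mu} l u = ∈-concatMap⁺ _ (lose (∈-upTo⁺ (rowLen-positive mu u))
  (subst (λ c → (r , c) ∈ _) (ℕP.m+[n∸m]≡n l) (∈-map⁺ _ (∈-upTo⁺ (ℕP.∸-monoˡ-< u l)))))

diagonal-cancel-≤ : ∀ r → diagonal (r , c) ℤ.≤ diagonal (r , c′) → c ℕ.≤ c′
diagonal-cancel-≤ r d≤d = ℕP.≮⇒≥ λ c′<c → ℤP.<⇒≱ (ℤP.+-monoˡ-< (ℤ.- (+ r)) (+<+ c′<c)) d≤d

diagonal-cancel-< : ∀ r → diagonal (r , c) ℤ.< diagonal (r , c′) → c ℕ.< c′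
diagonal-cancel-< r d<d = ℕP.≰⇒> λ c′≤c → ℤP.<⇒≱ d<d (ℤP.+-monoˡ-≤ (ℤ.- (+ r)) (+≤+ c′≤c))

diagonal-injective : ∀ r → diagonal (r , c) ≡ diagonal (r , c′) → c ≡ c′
diagonal-injective r e = ℕP.≤-antisym
  (diagonal-cancel-≤ r (ℤP.≤-reflexive e)) (diagonal-cancel-≤ r (ℤP.≤-reflexive (sym e)))

-- This bound, `∈S⇒<N` and `N⇒∈S` together say that the cells of the skew shape on diagonal k are
-- those in rows `N la k` up to, but not including, `N mu k`.
∈S⇒N≤ : s ∈ skewCells la mu → N la (diagonal s) ℕ.≤ proj₁ s
∈S⇒N≤ {s = r , c} {la} {mu} s∈ =
  beads≤⇒N≤ {la = la} (ℤP.+-monoˡ-≤ (ℤ.- (+ r)) (+≤+ (proj₁ (∈-skewCells⁻ {la = la} {mu = mu} s∈))))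

∈S⇒<N : IsPartition mu → s ∈ skewCells la mu → proj₁ s ℕ.< N mu (diagonal s)
∈S⇒<N {mu = mu} {s = r , c} {la} p s∈ =
  N⁺ p (ℤP.+-monoˡ-< (ℤ.- (+ r)) (+<+ (proj₂ (∈-skewCells⁻ {la = la} {mu = mu} s∈))))

N⇒∈S : IsPartition la → N la (diagonal s) ℕ.≤ proj₁ s → proj₁ s ℕ.< N mu (diagonal s) → s ∈ skewCells la mu
N⇒∈S {la} {r , c} {mu} p l u = ∈-skewCells⁺ {la = la} {mu = mu}
  (diagonal-cancel-≤ r (N≤⇒beads≤ {r = r} p l)) (diagonal-cancel-< r (N⁻ {la = mu} u))

-- The cell of a ribbon over la on diagonal k.
cell : List ℕ → ℤ → Cell
cell la k = N la k , ∣ k ℤ.+ + N la k ∣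

-- The absolute value in `cell` changes nothing: the bead in row ρ = `N la k` is at most `k` and at
-- least -ρ, so the column k + ρ is nonnegative.
diagonal-cell : IsPartition la → ∀ k → diagonal (cell la k) ≡ k
diagonal-cell {la} p k = begin
  + ∣ k ℤ.+ + ρ ∣ ℤ.- + ρ ≡⟨ cong (ℤ._- + ρ) (ℤP.0≤i⇒+∣i∣≡i 0≤k+ρ) ⟩
  (k ℤ.+ + ρ) ℤ.- + ρ     ≡⟨ ℤP.+-assoc k (+ ρ) _ ⟩
  k ℤ.+ (+ ρ ℤ.- + ρ)     ≡⟨ cong (λ j → k ℤ.+ j) (ℤP.+-inverseʳ (+ ρ)) ⟩
  k ℤ.+ + 0               ≡⟨ ℤP.+-identityʳ k ⟩
  k                       ∎
  where
  open ≡-Reasoning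
  ρ = N la k
  -ρ≤k : ℤ.- (+ ρ) ℤ.≤ k
  -ρ≤k = ℤP.≤-trans (ℤP.i≤j+i (ℤ.- (+ ρ)) (+ rowLen la ρ)) (N≤⇒beads≤ {r = ρ} p ℕP.≤-refl)
  0≤k+ρ : + 0 ℤ.≤ k ℤ.+ + ρ
  0≤k+ρ = subst (ℤ._≤ k ℤ.+ + ρ) (ℤP.+-inverseˡ (+ ρ)) (ℤP.+-monoˡ-≤ (+ ρ) -ρ≤k)

cell-injective : IsPartition la → cell la x ≡ cell la y → x ≡ y
cell-injective p e = trans (sym (diagonal-cell p _)) (trans (cong diagonal e) (diagonal-cell p _))

skewCells-unique : ∀ la mu → Unique (skewCells la mu)
skewCells-unique la mu = UniqueP.concat⁺
  (AllP.map⁺ (All.universal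
    (λ r → UniqueP.map⁺ (ℕP.+-cancelˡ-≡ (rowLen la r) _ _ ∘ cong proj₂) (UniqueP.upTo⁺ (rowLen mu r ℕ.∸ rowLen la r))) _))
  (AllPairsP.map⁺ (AllPairs.map disjoint (UniqueP.upTo⁺ (length mu))))
  where
  row : ℕ → List Cell
  row r = map (λ j → (r , rowLen la r ℕ.+ j)) (upTo (rowLen mu r ℕ.∸ rowLen la r))
  disjoint : ∀ {r r′} → r ≢ r′ → ∀ {s} → ¬ (s ∈ row r × s ∈ row r′)
  disjoint r≢r′ (s∈ , s∈′) with ∈-map⁻ _ s∈ | ∈-map⁻ _ s∈′
  ... | _ , _ , refl | _ , _ , e = r≢r′ (cong proj₁ e)

-- Ribbons as windows: size, connectedness, spin and head

-- The pointwise equation stands for an n-ribbon with head on diagonal `i`. It is matched with the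
-- Boolean test by `isRibbon⁺` and `isRibbon⁻`, and with the head by `ribbon-head`.
Ribbon : ℕ → ℤ → List ℕ → List ℕ → Set
Ribbon n i la mu = ∀ k → N mu k ≡ N la k ℕ.+ δ n i k

δ≤1 : ∀ n i k → δ n i k ℕ.≤ 1
δ≤1 n i k with window n i k
... | below _ e = ℕP.≤-trans (ℕP.≤-reflexive e) z≤n
... | inside _ _ e = ℕP.≤-reflexive e
... | above _ e = ℕP.≤-trans (ℕP.≤-reflexive e) z≤n

module _ (p : IsPartition la) (q : IsPartition mu) (rib : Ribbon n i la mu) where

  private S₀ = skewCells la mu

  ribbon-window : s ∈ S₀ → i ℤ.- + n ℤ.< diagonal s × diagonal s ℤ.≤ i
  ribbon-window {s} s∈ with window n i (diagonal s)
  ... | inside l u _ = l , u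
  ... | below _ e = contradiction (∈S⇒<N {la = la} q s∈) (ℕP.≤⇒≯ (subst (ℕ._≤ proj₁ s)
          (sym (trans (rib _) (trans (cong (N la (diagonal s) ℕ.+_) e) (ℕP.+-identityʳ _)))) (∈S⇒N≤ {la = la} {mu = mu} s∈)))
  ... | above _ e = contradiction (∈S⇒<N {la = la} q s∈) (ℕP.≤⇒≯ (subst (ℕ._≤ proj₁ s)
          (sym (trans (rib _) (trans (cong (N la (diagonal s) ℕ.+_) e) (ℕP.+-identityʳ _)))) (∈S⇒N≤ {la = la} {mu = mu} s∈)))

  -- Since `δ` is at most 1, each diagonal leaves only the row `N la`, so a cell of a ribbon is
  -- determined by its diagonal.
  ribbon-cell : s ∈ S₀ → s ≡ cell la (diagonal s)
  ribbon-cell {s@(r , c)} s∈ = cong₂ _,_ r≡ (diagonal-injective r (trans (sym (diagonal-cell p _)) (cong (λ r → diagonal (r , proj₂ (cell la (diagonal s)))) (sym r≡))))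
    where
    r≡ : r ≡ N la (diagonal s)
    r≡ = ℕP.≤-antisym
      (ℕP.≤-pred (ℕP.≤-trans (∈S⇒<N {la = la} q s∈) (ℕP.≤-trans (ℕP.≤-reflexive (rib _))
        (ℕP.≤-trans (ℕP.+-monoʳ-≤ (N la (diagonal s)) (δ≤1 n i _)) (ℕP.≤-reflexive (ℕP.+-comm _ 1))))))
      (∈S⇒N≤ {la = la} {mu = mu} s∈)

  cell∈S : i ℤ.- + n ℤ.< k → k ℤ.≤ i → cell la k ∈ S₀
  cell∈S {k} l u = N⇒∈S {s = cell la k} {mu = mu} p (ℕP.≤-reflexive (cong (N la) (diagonal-cell p k)))
    (subst (λ d → N la k ℕ.< N mu d) (sym (diagonal-cell p k)) (ℕP.≤-reflexive
      (sym (trans (rib k) (trans (cong (N la k ℕ.+_) (δ-in {n = n} l u)) (ℕP.+-comm _ 1))))))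

  -- The diagonal maps the cells bijectively onto i, i - 1, ..., i - n + 1; two duplicate-free lists
  -- with the same members have the same length.
  length-ribbon : length S₀ ≡ n
  length-ribbon = trans
    (↭-length (∼bag⇒↭ (unique∧set⇒bag (skewCells-unique la mu) unique (mk⇔ fwd bwd))))
    (trans (length-map cell′ (upTo n)) (length-applyUpTo id n))
    where
    cell′ : ℕ → Cell
    cell′ j = cell la (i ℤ.- + j)
    unique : Unique (map cell′ (upTo n))
    unique = UniqueP.map⁺ (ℤP.+-injective ∘ ℤP.neg-injective ∘ ∙-cancelˡ i _ _ ∘ cell-injective p) (UniqueP.upTo⁺ n)
    bwd : ∀ {s} → s ∈ map cell′ (upTo n) → s ∈ S₀
    bwd s∈ with ∈-map⁻ cell′ s∈
    ... | j , j∈ , refl = cell∈S (ℤP.+-monoʳ-< i (ℤP.neg-mono-< (+<+ (∈-upTo⁻ j∈)))) (ℤP.i-j≤i i (+ j))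
    fwd : ∀ {s} → s ∈ S₀ → s ∈ map cell′ (upTo n)
    fwd {s} s∈ = subst (_∈ map cell′ (upTo n)) (trans (cong (cell la) i-j≡) (sym (ribbon-cell s∈))) (∈-map⁺ cell′ (∈-upTo⁺ j<n))
      where
      d : ℤ
      d = diagonal s
      j′ = ∣ i ℤ.- d ∣
      open +-*-Solver
      +j≡ : + j′ ≡ i ℤ.- d
      +j≡ = ℤP.0≤i⇒+∣i∣≡i (ℤP.i≤j⇒0≤j-i (proj₂ (ribbon-window s∈)))
      i-j≡ : i ℤ.- + j′ ≡ d
      i-j≡ = trans (cong (ℤ._-_ i) +j≡) (solve 2 (λ i d → i :- (i :- d) := d) refl i d)
      j<n : j′ ℕ.< n
      j<n = ℤP.drop‿+<+ (subst₂ ℤ._<_ (sym +j≡) (solve 2 (λ i n → i :- (i :- n) := n) refl i (+ n))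
        (ℤP.+-monoʳ-< i (ℤP.neg-mono-< (proj₁ (ribbon-window s∈)))))

-- Breadth-first search

iterate-suc : ∀ k (g : A → A) a → iterate (suc k) g a ≡ g (iterate k g a)
iterate-suc zero g a = refl
iterate-suc (suc k) g a = iterate-suc k g (g a)

∈-grow⁺ : s ∈ S → s ∈ R ⊎ (∃[ t ] t ∈ R × T (adjᵇ s t)) → s ∈ grow S R
∈-grow⁺ {s} {R = R} s∈ h = ∈-filter⁺ _ s∈ (from (T-∨ {memᵇ s R}) ([ inj₁ ∘ mem⁺ , inj₂ ∘ near ]′ h))
  where
  near : (∃[ t ] t ∈ R × T (adjᵇ s t)) → T (any (adjᵇ s) R)
  near (t , t∈ , a) = AnyP.any⁺ (adjᵇ s) (lose t∈ a)

∈-grow⁻ : s ∈ grow S R → s ∈ S × (s ∈ R ⊎ (∃[ t ] t ∈ R × T (adjᵇ s t)))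
∈-grow⁻ {s} {S} {R} s∈ with ∈-filter⁻ _ {xs = S} s∈
... | s∈S , h with to (T-∨ {memᵇ s R}) h
...   | inj₁ m = s∈S , inj₁ (mem⁻ m)
...   | inj₂ a = s∈S , inj₂ (find (AnyP.any⁻ (adjᵇ s) R a))

connected⁺ : ∀ S → (∀ {s t} → s ∈ S → t ∈ S → t ∈ iterate (length S) (grow S) (s ∷ [])) → T (connectedᵇ S)
connected⁺ [] h = tt
connected⁺ (s ∷ S) h = AllP.all⁻ _ (All.tabulate (mem⁺ ∘ h (here refl)))

-- A property that adjacent cells share is constant on a connected set.
connected⁻ : ∀ S → T (connectedᵇ S) → {P : Cell → Set} →
  (∀ {s t} → s ∈ S → t ∈ S → T (adjᵇ s t) → P s → P t) →
  (∀ {s t} → s ∈ S → t ∈ S → T (adjᵇ s t) → P t → P s) →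
  ∀ {s t} → s ∈ S → t ∈ S → P s → P t
connected⁻ S₀@(x ∷ S) conn {P} fwd bwd s∈ t∈ = proj₁ (from-x t∈) ∘ proj₂ (from-x s∈)
  where
  reached : ∀ d {t} → t ∈ iterate d (grow S₀) (x ∷ []) → t ∈ S₀ × (P x → P t) × (P t → P x)
  reached zero (here refl) = here refl , id , id
  reached (suc d) {t} t∈ with ∈-grow⁻ {S = S₀} (subst (t ∈_) (iterate-suc d (grow S₀) (x ∷ [])) t∈)
  ... | t∈S , inj₁ t∈R = reached d t∈R
  ... | t∈S , inj₂ (s , s∈R , a) with reached d s∈R
  ...   | s∈S , f , g = t∈S , bwd t∈S s∈S a ∘ f , g ∘ fwd t∈S s∈S a
  from-x : ∀ {t} → t ∈ S₀ → (P x → P t) × (P t → P x)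
  from-x t∈ = proj₂ (reached (length S₀) (mem⁻ (All.lookup (AllP.all⁺ _ S₀ conn) t∈)))

-- Occupied rows, containment and squares

filterᵇ-initial : ∀ (p : ℕ → Bool) f d m → (∀ j → j ℕ.< d → T (p (f j))) →
  (∀ j → d ℕ.≤ j → ¬ T (p (f j))) → filterᵇ p (applyUpTo f (d ℕ.+ m)) ≡ applyUpTo f d
filterᵇ-initial p f zero m yes′ no′ =
  filter-none (T? ∘ p) (AllP.applyUpTo⁺₂ f m (λ j → no′ j z≤n))
filterᵇ-initial p f (suc d) m yes′ no′ = trans (filter-accept (T? ∘ p) (yes′ 0 (s≤s z≤n)))
  (cong (f 0 ∷_) (filterᵇ-initial p (f ∘ suc) d m (λ j → yes′ (suc j) ∘ s≤s) (λ j → no′ (suc j) ∘ s≤s)))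

filterᵇ-interval : ∀ (p : ℕ → Bool) f l d m → (∀ j → j ℕ.< l → ¬ T (p (f j))) →
  (∀ j → j ℕ.< d → T (p (f (l ℕ.+ j)))) → (∀ j → d ℕ.≤ j → ¬ T (p (f (l ℕ.+ j)))) →
  filterᵇ p (applyUpTo f (l ℕ.+ (d ℕ.+ m))) ≡ applyUpTo (λ j → f (l ℕ.+ j)) d
filterᵇ-interval p f zero d m no₁ yes′ no₂ = filterᵇ-initial p f d m yes′ no₂
filterᵇ-interval p f (suc l) d m no₁ yes′ no₂ = trans (filter-reject (T? ∘ p) (no₁ 0 (s≤s z≤n)))
  (filterᵇ-interval p (f ∘ suc) l d m (λ j → no₁ (suc j) ∘ s≤s) yes′ no₂)

occupied⁻ : T (any (λ x → proj₁ x == r) S) → ∃[ s ] s ∈ S × proj₁ s ≡ r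
occupied⁻ {r} {S} h with find (AnyP.any⁻ (λ x → proj₁ x == r) S h)
... | s , s∈ , e = s , s∈ , ==⇒≡ {proj₁ s} e

occupied⁺ : s ∈ S → T (any (λ x → proj₁ x == proj₁ s) S)
occupied⁺ {s} s∈ = AnyP.any⁺ (λ x → proj₁ x == proj₁ s) (lose s∈ (==-refl (proj₁ s)))

headCell-first : ∀ la mu {r rs} → occupiedRows (length mu) (skewCells la mu) ≡ r ∷ rs →
  headCell la mu ≡ (r , rowLen mu r ℕ.∸ 1)
headCell-first la mu e with occupiedRows (length mu) (skewCells la mu)
headCell-first la mu refl | r ∷ _ = refl

contained⁺ : ∀ la mu → (∀ r → rowLen la r ℕ.≤ rowLen mu r) → T (containedᵇ la mu)
contained⁺ la mu h = AllP.all⁻ _ (All.universal (λ r → fromWitness {a? = rowLen la r ℕ.≤? rowLen mu r} (h r)) (upTo (length la)))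

contained⁻ : ∀ la mu → T (containedᵇ la mu) → ∀ r → rowLen la r ℕ.≤ rowLen mu r
contained⁻ la mu h r with rowLen la r in e
... | zero = z≤n
... | suc _ = subst (ℕ._≤ rowLen mu r) e (toWitness (All.lookup (AllP.all⁺ _ (upTo (length la)) h)
  (∈-upTo⁺ (rowLen-positive {r = 0} {m = r} la (subst (1 ℕ.≤_) (sym e) (s≤s z≤n))))))

none⁺ : ∀ (p : A → Bool) xs → (∀ {x} → x ∈ xs → ¬ T (p x)) → T (not (any p xs))
none⁺ p xs h with any p xs in e
... | false = tt
... | true with find (AnyP.any⁻ p xs (from T-≡ e))
...   | _ , x∈ , px = h x∈ px

none⁻ : ∀ (p : A → Bool) xs {x} → T (not (any p xs)) → x ∈ xs → ¬ T (p x)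
none⁻ p xs h x∈ px with any p xs | AnyP.any⁺ p (lose x∈ px)
... | true | _ = h

no2x2⁺ : ∀ S → (∀ {r c} → (r , c) ∈ S → (suc r , suc c) ∈ S → ⊥) → T (no2x2ᵇ S)
no2x2⁺ S h = none⁺ _ S λ { {r , c} s∈ t →
  h s∈ (mem⁻ (proj₂ (to (T-∧ {memᵇ (r , suc c) S}) (proj₂ (to (T-∧ {memᵇ (suc r , c) S}) t))))) }

no2x2⁻ : ∀ S → T (no2x2ᵇ S) → (r , c) ∈ S → (suc r , c) ∈ S → (r , suc c) ∈ S → (suc r , suc c) ∈ S → ⊥
no2x2⁻ S h s∈ a b d = none⁻ _ S h s∈ (from T-∧ (mem⁺ a , from T-∧ (mem⁺ b , mem⁺ d)))

δ-split : ∀ n i → 1 ℕ.≤ n → i ℤ.- + n ℤ.< i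
δ-split (suc n) i _ = subst (i ℤ.- + suc n ℤ.<_) (ℤP.+-identityʳ i) (ℤP.+-monoʳ-< i ℤ.-<+)

≤-diff : x ℤ.≤ y → y ≡ x ℤ.+ + ∣ y ℤ.- x ∣
≤-diff {x} {y} x≤y = trans (solve 2 (λ x y → y := x :+ (y :- x)) refl x y)
  (cong (λ d → x ℤ.+ d) (sym (ℤP.0≤i⇒+∣i∣≡i (ℤP.i≤j⇒0≤j-i x≤y))))
  where open +-*-Solver

module _ (p : IsPartition la) (q : IsPartition mu) (1≤n : 1 ℕ.≤ n) (rib : Ribbon n i la mu) where

  private
    S₀ : List Cell
    S₀ = skewCells la mu
    lo : ℤ
    lo = ℤ.suc (i ℤ.- + n)
    t₀ t₁ : ℕ
    t₀ = N la i
    t₁ = N la lo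

  private
    lo≤i : lo ℤ.≤ i
    lo≤i = ℤP.i<j⇒suc[i]≤j (δ-split n i 1≤n)

    <lo : i ℤ.- + n ℤ.< lo
    <lo = ℤP.suc[i]≤j⇒i<j ℤP.≤-refl

  -- The row on diagonal k is `N la k`, which drops by 0 or 1 at the next diagonal. No drop is a
  -- step to the right, a drop by 1 a step upwards.
  adjacent : s ∈ S₀ → t ∈ S₀ → diagonal t ≡ ℤ.suc (diagonal s) → T (adjᵇ s t) × T (adjᵇ t s)
  adjacent {s@(r , c)} {t@(r′ , c′)} s∈ t∈ e with ℕP.m≤n⇒m<n∨m≡n r≤1+r′
    where
    r≡ : r ≡ N la (diagonal s)
    r≡ = cong proj₁ (ribbon-cell p q rib s∈)
    r′≡ : r′ ≡ N la (ℤ.suc (diagonal s))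
    r′≡ = trans (cong proj₁ (ribbon-cell p q rib t∈)) (cong (N la) e)
    r≤1+r′ : r ℕ.≤ suc r′
    r≤1+r′ = subst₂ (λ r r′ → r ℕ.≤ suc r′) (sym r≡) (sym r′≡) (N-step p (diagonal s))
  ... | inj₂ refl = subst (λ c → T (adjᵇ s (r′ , c)) × T (adjᵇ (r′ , c) s)) c≡c′
          (proj₂ (adj-column r′ c) , proj₁ (adj-column r′ c))
    where
    c≡c′ : c ≡ c′
    c≡c′ = diagonal-injective r′ (trans (diagonal-up r′ c) (sym e))
  ... | inj₁ (s≤s r≤r′) with ℕP.≤-antisym r≤r′ r′≤r
    where
    r′≤r : r′ ℕ.≤ r
    r′≤r = subst₂ ℕ._≤_ (sym (cong proj₁ (ribbon-cell p q rib t∈))) (sym (cong proj₁ (ribbon-cell p q rib s∈)))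
      (N-antitone p (subst (diagonal s ℤ.≤_) (sym e) (ℤP.i≤suc[i] (diagonal s))))
  ...   | refl = subst (λ c → T (adjᵇ s (r , c)) × T (adjᵇ (r , c) s)) sc≡c′ (adj-row r c)
    where
    sc≡c′ : suc c ≡ c′
    sc≡c′ = diagonal-injective r (trans (diagonal-right r c) (sym e))

  private
    reach : Cell → ℕ → List Cell
    reach x d = iterate d (grow S₀) (x ∷ [])

    reach-suc : ∀ x d → s ∈ S₀ → s ∈ reach x d ⊎ (∃[ t ] t ∈ reach x d × T (adjᵇ s t)) → s ∈ reach x (suc d)
    reach-suc {s} x d s∈ h = subst (s ∈_) (sym (iterate-suc d (grow S₀) (x ∷ []))) (∈-grow⁺ s∈ h)

    reach-mono : ∀ x {d m} → d ℕ.≤′ m → s ∈ S₀ → s ∈ reach x d → s ∈ reach x m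
    reach-mono x ℕ.≤′-refl s∈ h = h
    reach-mono x (ℕ.≤′-step {m} d≤m) s∈ h = reach-suc x m s∈ (inj₁ (reach-mono x d≤m s∈ h))

    -- Each round steps from the cell on the preceding diagonal, which belongs to the ribbon because
    -- the window is an interval.
    reach-up : ∀ {x} → x ∈ S₀ → ∀ d {s} → s ∈ S₀ → diagonal s ≡ diagonal x ℤ.+ + d → s ∈ reach x d
    reach-up {x} x∈ zero s∈ e = here (trans (ribbon-cell p q rib s∈)
      (trans (cong (cell la) (trans e (ℤP.+-identityʳ _))) (sym (ribbon-cell p q rib x∈))))
    reach-up {x} x∈ (suc d) {s} s∈ e = reach-suc x d s∈ (inj₂ (cell la κ , reach-up x∈ d k∈ (diagonal-cell p κ) ,
      proj₂ (adjacent k∈ s∈ (trans ds≡ (cong ℤ.suc (sym (diagonal-cell p κ)))))))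
      where
      κ : ℤ
      κ = diagonal x ℤ.+ + d
      ds≡ : diagonal s ≡ ℤ.suc κ
      ds≡ = trans e (solve 2 (λ x d → x :+ (con (+ 1) :+ d) := con (+ 1) :+ (x :+ d)) refl (diagonal x) (+ d))
        where open +-*-Solver
      k∈ : cell la κ ∈ S₀
      k∈ = cell∈S p q rib
        (ℤP.<-≤-trans (proj₁ (ribbon-window p q rib x∈)) (ℤP.i≤i+j (diagonal x) (+ d)))
        (ℤP.≤-trans (ℤP.i≤suc[i] κ) (subst (ℤ._≤ i) ds≡ (proj₂ (ribbon-window p q rib s∈))))

    reach-down : ∀ {x} → x ∈ S₀ → ∀ d {s} → s ∈ S₀ → diagonal x ≡ diagonal s ℤ.+ + d → s ∈ reach x d
    reach-down x∈ zero s∈ e = reach-up x∈ zero s∈ (trans (sym (ℤP.+-identityʳ _)) (trans (sym e) (sym (ℤP.+-identityʳ _))))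
    reach-down {x} x∈ (suc d) {s} s∈ e = reach-suc x d s∈ (inj₂ (cell la κ ,
      reach-down x∈ d k∈ (trans x≡ (cong (ℤ._+ + d) (sym (diagonal-cell p κ)))) ,
      proj₁ (adjacent s∈ k∈ (diagonal-cell p κ))))
      where
      κ : ℤ
      κ = ℤ.suc (diagonal s)
      x≡ : diagonal x ≡ κ ℤ.+ + d
      x≡ = trans e (solve 2 (λ x d → x :+ (con (+ 1) :+ d) := (con (+ 1) :+ x) :+ d) refl (diagonal s) (+ d))
        where open +-*-Solver
      k∈ : cell la κ ∈ S₀
      k∈ = cell∈S p q rib
        (ℤP.<-≤-trans (proj₁ (ribbon-window p q rib s∈)) (ℤP.i≤suc[i] (diagonal s)))
        (ℤP.≤-trans (subst (κ ℤ.≤_) (sym x≡) (ℤP.i≤i+j κ (+ d))) (proj₂ (ribbon-window p q rib x∈)))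

    -- The window spans n diagonals and the shape has n cells, so the rounds of search granted by
    -- `connectedᵇ` suffice for any two cells.
    distance≤n : s ∈ S₀ → t ∈ S₀ → diagonal s ℤ.≤ diagonal t → ∣ diagonal t ℤ.- diagonal s ∣ ℕ.≤′ length S₀
    distance≤n {s} {t} s∈ t∈ s≤t = subst (_ ℕ.≤′_) (sym (length-ribbon p q rib)) (ℕP.≤⇒≤′ (ℤ.drop‿+≤+
      (subst₂ ℤ._≤_ (sym (ℤP.0≤i⇒+∣i∣≡i (ℤP.i≤j⇒0≤j-i s≤t))) (solve 2 (λ i n → i :- (i :- n) := n) refl i (+ n))
        (ℤP.+-mono-≤ (proj₂ (ribbon-window p q rib t∈)) (ℤP.neg-mono-≤ (ℤP.<⇒≤ (proj₁ (ribbon-window p q rib s∈))))))))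
      where open +-*-Solver

  ribbon-connected : T (connectedᵇ S₀)
  ribbon-connected = connected⁺ S₀ λ {s} {t} s∈ t∈ →
    [ (λ s≤t → reach-mono s (distance≤n s∈ t∈ s≤t) t∈ (reach-up s∈ _ t∈ (≤-diff s≤t)))
    , (λ t≤s → reach-mono s (distance≤n t∈ s∈ t≤s) t∈ (reach-down s∈ _ t∈ (≤-diff t≤s)))
    ]′ (ℤP.≤-total (diagonal s) (diagonal t))

  -- Opposite corners of a square share a diagonal but not a row, against `ribbon-cell`.
  ribbon-no2x2 : T (no2x2ᵇ S₀)
  ribbon-no2x2 = no2x2⁺ S₀ λ {r} {c} s∈ t∈ → ℕP.1+n≢n (sym (cong proj₁ (trans (ribbon-cell p q rib s∈)
    (trans (cong (cell la) (trans (diagonal-up r c) (sym (diagonal-right (suc r) c)))) (sym (ribbon-cell p q rib t∈))))))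

  ribbon-contained : ∀ r → rowLen la r ℕ.≤ rowLen mu r
  ribbon-contained r = beads-rowLen-≤ la mu r (N-mono⇒beads-mono {mu = mu} p
    (λ k → subst (N la k ℕ.≤_) (sym (rib k)) (ℕP.m≤m+n (N la k) _)) r)

  isRibbon⁺ : T (isRibbonᵇ n la mu)
  isRibbon⁺ = from (T-∧ {containedᵇ la mu}) (contained⁺ la mu ribbon-contained ,
    from (T-∧ {length S₀ == n}) (fromWitness {a? = length S₀ ℕ.≟ n} (length-ribbon p q rib) ,
    from (T-∧ {connectedᵇ S₀}) (ribbon-connected , ribbon-no2x2)))

  private
    occupied : ℕ → Bool
    occupied r = any (λ x → proj₁ x == r) S₀

    occupied⇒ : T (occupied r) → t₀ ℕ.≤ r × r ℕ.≤ t₁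
    occupied⇒ {r} o with occupied⁻ {r} {S₀} o
    ... | s , s∈ , refl with ribbon-window p q rib s∈
    ...   | l , u = subst (t₀ ℕ.≤_) (sym (cong proj₁ (ribbon-cell p q rib s∈))) (N-antitone p u) ,
                    subst (ℕ._≤ t₁) (sym (cong proj₁ (ribbon-cell p q rib s∈))) (N-antitone p (ℤP.i<j⇒suc[i]≤j l))

    occupied-cell : lo ℤ.≤ k → k ℤ.≤ i → N la k ≡ r → T (occupied r)
    occupied-cell {k} l u refl = occupied⁺ {s = cell la k} (cell∈S p q rib (ℤP.<-≤-trans <lo l) u)

    -- Row r meets the ribbon on diagonal max (beads la r) lo.
    occupied⇐ : t₀ ℕ.≤ r → r ℕ.≤ t₁ → T (occupied r)
    occupied⇐ {r} t₀≤r r≤t₁ with ℤP.≤-total lo (beads la r)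
    ... | inj₁ lo≤b = occupied-cell lo≤b (N≤⇒beads≤ p t₀≤r) (ℕP.≤-antisym (beads≤⇒N≤ {la = la} ℤP.≤-refl) r≤N)
      where
      β : ℤ
      β = beads la r
      r≤N : r ℕ.≤ N la β
      r≤N = ℕP.≤-pred (ℕP.≤-trans (N⁺ {r = r} p (ℤP.i≤pred[j]⇒i<j ℤP.≤-refl))
        (subst (λ k → N la (ℤ.pred β) ℕ.≤ suc (N la k)) (ℤP.suc-pred β) (N-step p (ℤ.pred β))))
    ... | inj₂ b≤lo = occupied-cell ℤP.≤-refl lo≤i (ℕP.≤-antisym (beads≤⇒N≤ {la = la} b≤lo) r≤t₁)

    t₀≤t₁ : t₀ ℕ.≤ t₁
    t₀≤t₁ = N-antitone p lo≤i

    t₁<length : t₁ ℕ.< length mu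
    t₁<length = rowLen-positive mu (proj₂ (∈-skewCells⁻ {la = la} {mu = mu} (cell∈S p q rib <lo lo≤i)))

  -- The rows met form an interval, from row `t₀` at the head to row `t₁` at the tail. The explicit
  -- list yields both the spin and the head.
  ribbon-rows : occupiedRows (length mu) S₀ ≡ applyUpTo (λ j → t₀ ℕ.+ j) (suc (t₁ ℕ.∸ t₀))
  ribbon-rows = trans (cong (λ m → filterᵇ occupied (upTo m)) (sym length≡))
    (filterᵇ-interval occupied id t₀ (suc (t₁ ℕ.∸ t₀)) (length mu ℕ.∸ suc t₁)
      (λ j j<t₀ o → ℕP.<⇒≱ j<t₀ (proj₁ (occupied⇒ o)))
      (λ { j (s≤s j≤) → occupied⇐ (ℕP.m≤m+n t₀ j)
        (ℕP.≤-trans (ℕP.+-monoʳ-≤ t₀ j≤) (ℕP.≤-reflexive (ℕP.m+[n∸m]≡n t₀≤t₁))) })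
      (λ j <j o → ℕP.<⇒≱ (ℕP.≤-trans (ℕP.≤-reflexive (sym (trans (ℕP.+-suc t₀ _) (cong suc (ℕP.m+[n∸m]≡n t₀≤t₁)))))
        (ℕP.+-monoʳ-≤ t₀ <j)) (proj₂ (occupied⇒ o))))
    where
    length≡ : t₀ ℕ.+ (suc (t₁ ℕ.∸ t₀) ℕ.+ (length mu ℕ.∸ suc t₁)) ≡ length mu
    length≡ = trans (sym (ℕP.+-assoc t₀ (suc (t₁ ℕ.∸ t₀)) _))
      (trans (cong (ℕ._+ (length mu ℕ.∸ suc t₁)) (trans (ℕP.+-suc t₀ _) (cong suc (ℕP.m+[n∸m]≡n t₀≤t₁))))
        (ℕP.m+[n∸m]≡n t₁<length))

  -- The spin is `t₁` minus `t₀`. The additive form avoids truncated subtraction in the later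
  -- comparisons of exponents.
  ribbon-spin : spin la mu ℕ.+ N la i ≡ N la (ℤ.suc (i ℤ.- + n))
  ribbon-spin = trans (cong (λ l → (l ℕ.∸ 1) ℕ.+ t₀)
    (trans (cong length ribbon-rows) (length-applyUpTo (λ j → t₀ ℕ.+ j) (suc (t₁ ℕ.∸ t₀)))))
    (ℕP.m∸n+n≡m t₀≤t₁)

  -- The head is the last box of row `t₀` of `mu`, one diagonal before the bead of that row. This
  -- bead lies at `suc i`, because `N mu` exceeds `t₀` at `i` but not at `suc i`.
  ribbon-head : diagonal (headCell la mu) ≡ i
  ribbon-head with rowLen mu t₀ in e | cell∈S p q rib (δ-split n i 1≤n) ℤP.≤-refl
  ... | zero | s∈ = ⊥-elim (ℕP.n≮0 (subst (_ ℕ.<_) e (proj₂ (∈-skewCells⁻ {la = la} {mu = mu} s∈))))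
  ... | suc m | s∈ = trans (cong diagonal (trans (headCell-first la mu ribbon-rows)
          (cong₂ _,_ (ℕP.+-identityʳ t₀) (trans (cong (λ r → rowLen mu r ℕ.∸ 1) (ℕP.+-identityʳ t₀)) (cong (ℕ._∸ 1) e)))))
          (suc-injective (ℤP.≤-antisym suc≤ ≤suc))
    where
    beads≡ : beads mu t₀ ≡ ℤ.suc (diagonal (t₀ , m))
    beads≡ = trans (cong (λ m → + m ℤ.- + t₀) e) (diagonal-right t₀ m)
    suc-injective : ℤ.suc x ≡ ℤ.suc y → x ≡ y
    suc-injective = ∙-cancelˡ (+ 1) _ _
    suc≤ : ℤ.suc (diagonal (t₀ , m)) ℤ.≤ ℤ.suc i
    suc≤ = subst (ℤ._≤ ℤ.suc i) beads≡ (N≤⇒beads≤ q (subst (ℕ._≤ t₀)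
      (sym (trans (rib _) (trans (cong (N la (ℤ.suc i) ℕ.+_) (δ-high {i} {n = n} (ℤP.suc[i]≤j⇒i<j ℤP.≤-refl))) (ℕP.+-identityʳ _))))
      (N-antitone p (ℤP.i≤suc[i] i))))
    ≤suc : ℤ.suc i ℤ.≤ ℤ.suc (diagonal (t₀ , m))
    ≤suc = subst (ℤ.suc i ℤ.≤_) beads≡ (ℤP.i<j⇒suc[i]≤j (N⁻ {la = mu} (subst (t₀ ℕ.<_)
      (sym (trans (rib i) (trans (cong (t₀ ℕ.+_) (δ-in {n = n} (δ-split n i 1≤n) ℤP.≤-refl)) (ℕP.+-comm _ 1)))) (ℕP.n<1+n t₀))))

-- From the Boolean ribbon test back to a window

private
  greatest : ∀ x S → ∃[ s ] s ∈ x ∷ S × (∀ {t} → t ∈ x ∷ S → diagonal t ℤ.≤ diagonal s)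
  greatest x S = argmax diagonal x S , argmax-all diagonal (here refl) (All.tabulate there) ,
    All.lookup (f[⊥]≤f[argmax] {f = diagonal} x S ∷ f[xs]≤f[argmax] {f = diagonal} x S)

  least : ∀ x S → ∃[ s ] s ∈ x ∷ S × (∀ {t} → t ∈ x ∷ S → diagonal s ℤ.≤ diagonal t)
  least x S = argmin diagonal x S , argmin-all diagonal (here refl) (All.tabulate there) ,
    All.lookup (f[argmin]≤f[⊤] {f = diagonal} x S ∷ f[argmin]≤f[xs] {f = diagonal} x S)

nonempty : ∀ (S : List A) → 1 ℕ.≤ length S → ∃[ x ] ∃[ xs ] S ≡ x ∷ xs
nonempty (x ∷ xs) _ = x , xs , refl

module _ (p : IsPartition la) (q : IsPartition mu) (contained : ∀ r → rowLen la r ℕ.≤ rowLen mu r) where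

  private
    S₀ : List Cell
    S₀ = skewCells la mu

  contained⇒N≤ : ∀ k → N la k ℕ.≤ N mu k
  contained⇒N≤ k = beads≤⇒N≤ {la = la}
    (ℤP.≤-trans (ℤP.+-monoˡ-≤ (ℤ.- (+ N mu k)) (+≤+ (contained (N mu k)))) (N≤⇒beads≤ q ℕP.≤-refl))

  -- Two cells of a skew shape on one diagonal span a 2×2 square.
  no2x2⇒N≤ : T (no2x2ᵇ S₀) → ∀ k → N mu k ℕ.≤ suc (N la k)
  no2x2⇒N≤ h k = ℕP.≮⇒≥ λ r<N → corner r<N (s∈ (ℕP.<-trans (ℕP.n<1+n _) r<N)) (t∈ r<N)
    where
    ρ χ : ℕ
    ρ = N la k
    χ = ∣ k ℤ.+ + N la k ∣
    dₛ : diagonal (ρ , χ) ≡ k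
    dₛ = diagonal-cell p k
    dₜ : diagonal (suc ρ , suc χ) ≡ k
    dₜ = trans (diagonal-right (suc ρ) χ) (trans (sym (diagonal-up ρ χ)) dₛ)
    s∈ : ρ ℕ.< N mu k → (ρ , χ) ∈ S₀
    s∈ ρ< = N⇒∈S {s = ρ , χ} {mu = mu} p (ℕP.≤-reflexive (cong (N la) dₛ)) (subst (λ k → ρ ℕ.< N mu k) (sym dₛ) ρ<)
    t∈ : suc ρ ℕ.< N mu k → (suc ρ , suc χ) ∈ S₀
    t∈ ρ< = N⇒∈S {s = suc ρ , suc χ} {mu = mu} p (ℕP.≤-trans (ℕP.≤-reflexive (cong (N la) dₜ)) (ℕP.n≤1+n ρ))
      (subst (λ k → suc ρ ℕ.< N mu k) (sym dₜ) ρ<)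
    corner : suc ρ ℕ.< N mu k → (ρ , χ) ∈ S₀ → (suc ρ , suc χ) ∈ S₀ → ⊥
    corner ρ< s∈ t∈ with ∈-skewCells⁻ {la = la} {mu = mu} s∈ | ∈-skewCells⁻ {la = la} {mu = mu} t∈
    ... | l , _ | _ , u = no2x2⁻ S₀ h s∈
      (∈-skewCells⁺ {la} {mu = mu} (ℕP.≤-trans (rowLen-antitone (proj₂ p) ρ) l) (ℕP.<-trans (ℕP.n<1+n χ) u))
      (∈-skewCells⁺ {la} {mu = mu} (ℕP.≤-trans l (ℕP.n≤1+n χ)) (ℕP.<-≤-trans u (rowLen-antitone (proj₂ q) ρ)))
      t∈

  diagonal-occupied : s ∈ S₀ → N la (diagonal s) ℕ.< N mu (diagonal s)
  diagonal-occupied s∈ = ℕP.≤-<-trans (∈S⇒N≤ {la = la} {mu = mu} s∈) (∈S⇒<N {la = la} q s∈)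

  occupied-diagonal : N la k ℕ.< N mu k → cell la k ∈ S₀
  occupied-diagonal {k} l = N⇒∈S {s = cell la k} {mu = mu} p (ℕP.≤-reflexive (cong (N la) (diagonal-cell p k)))
    (subst (λ d → N la k ℕ.< N mu d) (sym (diagonal-cell p k)) l)

  -- Were diagonal `k` free of cells, lying below `k` would be a property shared by adjacent cells,
  -- as adjacency changes the diagonal by one. By `connected⁻` it would then pass from `s` to `t`.
  connected⇒convex : T (connectedᵇ S₀) → s ∈ S₀ → t ∈ S₀ →
    diagonal s ℤ.≤ k → k ℤ.≤ diagonal t → N la k ℕ.< N mu k
  connected⇒convex {s} {t} {k} conn s∈ t∈ s≤k k≤t = ℕP.≰⇒> λ N≤ → ℤP.<⇒≱
    (connected⁻ S₀ conn {λ x → diagonal x ℤ.< k}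
      (λ {x} {y} x∈ y∈ a → step N≤ {x} y∈ (adj⁻ x y a))
      (λ {x} {y} x∈ y∈ a → step N≤ {y} x∈ ([ inj₂ , inj₁ ]′ (adj⁻ x y a)))
      s∈ t∈ (≤∧≢ N≤ s∈ s≤k)) k≤t
    where
    ≤∧≢ : N mu k ℕ.≤ N la k → ∀ {x} → x ∈ S₀ → diagonal x ℤ.≤ k → diagonal x ℤ.< k
    ≤∧≢ N≤ x∈ x≤k = ℤP.≤∧≢⇒< x≤k λ { refl → ℕP.<⇒≱ (diagonal-occupied x∈) N≤ }
    step : N mu k ℕ.≤ N la k → ∀ {x y} → y ∈ S₀ →
      diagonal y ≡ ℤ.suc (diagonal x) ⊎ diagonal x ≡ ℤ.suc (diagonal y) → diagonal x ℤ.< k → diagonal y ℤ.< k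
    step N≤ {x} {y} y∈ (inj₁ e) x<k = ≤∧≢ N≤ y∈ (subst (ℤ._≤ k) (sym e) (ℤP.i<j⇒suc[i]≤j x<k))
    step N≤ {x} {y} y∈ (inj₂ e) x<k = ℤP.≤-<-trans (subst (diagonal y ℤ.≤_) (sym e) (ℤP.i≤suc[i] (diagonal y))) x<k

  -- The window runs between the extreme diagonals of the shape: connectedness puts at least one
  -- cell on each diagonal between them, the absence of squares at most one.
  ribbon⁻ : T (no2x2ᵇ S₀) → T (connectedᵇ S₀) → 1 ℕ.≤ length S₀ → ∃[ i ] Ribbon (length S₀) i la mu
  ribbon⁻ sq conn l with nonempty S₀ l
  ... | x , xs , S≡ = hi , subst (λ n → Ribbon n hi la mu) (sym (length-ribbon p q rib)) rib
    where
    top = greatest x xs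
    bottom = least x xs
    in-S : ∀ {s} → s ∈ x ∷ xs → s ∈ S₀
    in-S {s} = subst (s ∈_) (sym S≡)
    hi lo : ℤ
    hi = diagonal (proj₁ top)
    lo = diagonal (proj₁ bottom)
    in-range : N la k ℕ.< N mu k → lo ℤ.≤ k × k ℤ.≤ hi
    in-range {k} l = subst (λ k → lo ℤ.≤ k × k ℤ.≤ hi) (diagonal-cell p k)
      (proj₂ (proj₂ bottom) c∈ , proj₂ (proj₂ top) c∈)
      where
      c∈ : cell la k ∈ x ∷ xs
      c∈ = subst (cell la k ∈_) S≡ (occupied-diagonal l)
    -- The number of diagonals from `lo` to `hi`. That it is also the number of cells follows from
    -- `rib` through `length-ribbon`.
    n′ : ℕ
    n′ = suc ∣ hi ℤ.- lo ∣
    lo≡ : ℤ.suc (hi ℤ.- + n′) ≡ lo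
    lo≡ = trans (cong (λ d → ℤ.suc (hi ℤ.- ℤ.suc d)) (ℤP.0≤i⇒+∣i∣≡i (ℤP.i≤j⇒0≤j-i (proj₂ (proj₂ top) (proj₁ (proj₂ bottom))))))
      (solve 2 (λ h l → con (+ 1) :+ (h :- (con (+ 1) :+ (h :- l))) := l) refl hi lo)
      where open +-*-Solver
    empty : ¬ (N la k ℕ.< N mu k) → ∀ {d} → d ≡ 0 → N mu k ≡ N la k ℕ.+ d
    empty N≮ refl = trans (ℕP.≤-antisym (ℕP.≮⇒≥ N≮) (contained⇒N≤ _)) (sym (ℕP.+-identityʳ _))
    rib : Ribbon n′ hi la mu
    rib k with window n′ hi k
    ... | below k≤ e = empty (λ l → ℤP.<⇒≱ (ℤP.≤-<-trans k≤ (ℤP.suc[i]≤j⇒i<j (ℤP.≤-reflexive lo≡))) (proj₁ (in-range l))) e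
    ... | above <k e = empty (λ l → ℤP.<⇒≱ <k (proj₂ (in-range l))) e
    ... | inside <k k≤ e = trans (ℕP.≤-antisym (no2x2⇒N≤ sq k)
            (connected⇒convex conn (in-S (proj₁ (proj₂ bottom))) (in-S (proj₁ (proj₂ top)))
              (subst (ℤ._≤ k) lo≡ (ℤP.i<j⇒suc[i]≤j <k)) k≤))
            (sym (trans (cong (N la k ℕ.+_) e) (ℕP.+-comm _ 1)))

isRibbon⁻ : IsPartition la → IsPartition mu → 1 ℕ.≤ n → T (isRibbonᵇ n la mu) → ∃[ i ] Ribbon n i la mu
isRibbon⁻ {la} {mu} {n} p q 1≤n h with to (T-∧ {containedᵇ la mu}) h
... | ct , h′ with to (T-∧ {length (skewCells la mu) == n}) h′
...   | l , h″ with to (T-∧ {connectedᵇ (skewCells la mu)}) h″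
...     | conn , sq = subst (λ n → ∃[ i ] Ribbon n i la mu) len (ribbon⁻ p q (contained⁻ la mu ct) sq conn (subst (1 ℕ.≤_) (sym len) 1≤n))
  where
  len : length (skewCells la mu) ≡ n
  len = ==⇒≡ l

-- Constructing the partition with one more ribbon

fromRows : ℕ → (ℕ → ℕ) → List ℕ
fromRows zero f = []
fromRows (suc l) f with f 0
... | zero = []
... | suc a = suc a ∷ fromRows l (f ∘ suc)

fromRows-positive : ∀ l f → All (1 ℕ.≤_) (fromRows l f)
fromRows-positive zero f = []
fromRows-positive (suc l) f with f 0
... | zero = []
... | suc a = s≤s z≤n ∷ fromRows-positive l (f ∘ suc)

rowLen-fromRows : ∀ l f → (∀ r → f (suc r) ℕ.≤ f r) → f l ≡ 0 → ∀ r → rowLen (fromRows l f) r ≡ f r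
rowLen-fromRows zero f anti f0≡0 r = sym (zeros r)
  where
  zeros : ∀ r → f r ≡ 0
  zeros zero = f0≡0
  zeros (suc r) = ℕP.n≤0⇒n≡0 (subst (f (suc r) ℕ.≤_) (zeros r) (anti r))
rowLen-fromRows (suc l) f anti fl≡0 r with f 0 in e
rowLen-fromRows (suc l) f anti fl≡0 r | zero = sym (zeros r)
  where
  zeros : ∀ r → f r ≡ 0
  zeros zero = e
  zeros (suc r) = ℕP.n≤0⇒n≡0 (subst (f (suc r) ℕ.≤_) (zeros r) (anti r))
rowLen-fromRows (suc l) f anti fl≡0 zero | suc a = sym e
rowLen-fromRows (suc l) f anti fl≡0 (suc r) | suc a = rowLen-fromRows l (f ∘ suc) (anti ∘ suc) fl≡0 r

antitone⇒Linked : ∀ la → (∀ r → rowLen la (suc r) ℕ.≤ rowLen la r) → Linked ℕ._≥_ la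
antitone⇒Linked [] anti = []
antitone⇒Linked (a ∷ []) anti = [-]
antitone⇒Linked (a ∷ a′ ∷ la) anti = anti 0 ∷ antitone⇒Linked (a′ ∷ la) (anti ∘ suc)

-- Row r gets length b r + r: the lower bound makes it a natural number, strict decrease of `b`
-- makes the lengths weakly decreasing, and the value at `l` ends the list.
fromBeads : (b : ℕ → ℤ) → Decreasing b → (∀ r → ℤ.- (+ r) ℤ.≤ b r) → ∀ l → b l ≡ ℤ.- (+ l) →
  ∃[ mu ] IsPartition mu × (∀ r → beads mu r ≡ b r)
fromBeads b d low l bl≡ = ν , (fromRows-positive l f , antitone⇒Linked ν anti′) ,
  λ r → trans (cong (λ a → + a ℤ.- + r) (rows r)) (f-beads r)
  where
  f : ℕ → ℕ
  f r = ∣ b r ℤ.+ + r ∣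
  f≡ : ∀ r → + f r ≡ b r ℤ.+ + r
  f≡ r = ℤP.0≤i⇒+∣i∣≡i (subst (ℤ._≤ b r ℤ.+ + r) (ℤP.+-inverseˡ (+ r)) (ℤP.+-monoˡ-≤ (+ r) (low r)))
  f-beads : ∀ r → + f r ℤ.- + r ≡ b r
  f-beads r = trans (cong (ℤ._- + r) (f≡ r)) (solve 2 (λ x y → (x :+ y) :- y := x) refl (b r) (+ r))
    where open +-*-Solver
  anti : ∀ r → f (suc r) ℕ.≤ f r
  anti r = ℤ.drop‿+≤+ (subst₂ ℤ._≤_
    (trans (solve 2 (λ x y → (con (+ 1) :+ x) :+ y := x :+ (con (+ 1) :+ y)) refl (b (suc r)) (+ r)) (sym (f≡ (suc r))))
    (sym (f≡ r)) (ℤP.+-monoˡ-≤ (+ r) (ℤP.i<j⇒suc[i]≤j (d r))))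
    where open +-*-Solver
  ν : List ℕ
  ν = fromRows l f
  rows : ∀ r → rowLen ν r ≡ f r
  rows = rowLen-fromRows l f anti (cong ∣_∣ (trans (cong (ℤ._+ + l) bl≡) (ℤP.+-inverseˡ (+ l))))
  anti′ : ∀ r → rowLen ν (suc r) ℕ.≤ rowLen ν r
  anti′ r = subst₂ ℕ._≤_ (sym (rows (suc r))) (sym (rows r)) (anti r)

<suc⇒≤ : x ℤ.< ℤ.suc y → x ℤ.≤ y
<suc⇒≤ {x} {y} x< = subst (x ℤ.≤_) (ℤP.pred-suc y) (ℤP.i<j⇒i≤pred[j] x<)

-- A bead can move from suc (i - n) to the free position suc i.
Addable : ℕ → ℤ → List ℕ → Set
Addable n i la = N la (i ℤ.- + n) ≡ suc (N la (ℤ.suc (i ℤ.- + n))) × N la i ≡ N la (ℤ.suc i)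

addable? : ∀ n i la → Dec (Addable n i la)
addable? n i la = (_ ℕ.≟ _) ×-dec (_ ℕ.≟ _)

module _ (p : IsPartition la) (1≤n : 1 ℕ.≤ n) (addable : Addable n i la) where

  private
    lo : ℤ
    lo = ℤ.suc (i ℤ.- + n)
    t₁ : ℕ
    t₁ = N la lo
    -- The position offered to row r by the shift: the bead of the row above, cut off at `suc i`. In
    -- `moved` the maximum keeps beads already beyond `suc i`, gives the next row `suc i` itself,
    -- and passes each further row the bead above it, down to row `t₁`, whose own bead at `lo`
    -- disappears.
    cap : ℕ → ℤ
    cap zero = ℤ.suc i
    cap (suc r) = beads la r ℤ.⊓ ℤ.suc i

    -- The beads between the two positions and the moved bead shift by one row.
    moved : ℕ → ℤ
    moved r with r ℕ.≤? t₁
    ... | yes _ = beads la r ℤ.⊔ cap r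
    ... | no _ = beads la r

    N⁺δ : ℤ → ℕ
    N⁺δ k = N la k ℕ.+ δ n i k

    beads≤moved : ∀ r → beads la r ℤ.≤ moved r
    beads≤moved r with r ℕ.≤? t₁
    ... | yes _ = ℤP.i≤i⊔j _ _
    ... | no _ = ℤP.≤-refl

    i<suci : i ℤ.< ℤ.suc i
    i<suci = ℤP.suc[i]≤j⇒i<j ℤP.≤-refl

    cap⇒ : ∀ r → k ℤ.< cap r → k ℤ.≤ i × r ℕ.≤ N la k
    cap⇒ {k} zero k< = <suc⇒≤ k< , z≤n
    cap⇒ {k} (suc r) k< = <suc⇒≤ (ℤP.<-≤-trans k< (ℤP.i⊓j≤j (beads la r) _)) ,
      N⁺ p (ℤP.<-≤-trans k< (ℤP.i⊓j≤i (beads la r) _))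

    cap⇐ : ∀ r → k ℤ.≤ i → r ℕ.≤ N la k → k ℤ.< cap r
    cap⇐ zero k≤i _ = ℤP.≤-<-trans k≤i i<suci
    cap⇐ {k} (suc r) k≤i r< with ℤP.⊓-sel (beads la r) (ℤ.suc i)
    ... | inj₁ e = subst (k ℤ.<_) (sym e) (N⁻ {la = la} r<)
    ... | inj₂ e = subst (k ℤ.<_) (sym e) (ℤP.≤-<-trans k≤i i<suci)

    -- With `moved⇐` this is the adjunction of `N⁺` and `N⁻` for the new beads, which identifies
    -- their count as `N⁺δ`.
    moved⇒ : ∀ r → k ℤ.< moved r → r ℕ.< N⁺δ k
    moved⇒ {k} r k< with r ℕ.≤? t₁
    ... | no _ = ℕP.<-≤-trans (N⁺ {r = r} p k<) (ℕP.m≤m+n (N la k) _)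
    ... | yes r≤t₁ with ℤP.⊔-sel (beads la r) (cap r)
    ...   | inj₁ e = ℕP.<-≤-trans (N⁺ {r = r} p (subst (k ℤ.<_) e k<)) (ℕP.m≤m+n (N la k) _)
    ...   | inj₂ e with cap⇒ r (subst (k ℤ.<_) e k<) | window n i k
    -- The bead at `lo` counts here, so at least `suc t₁` beads of `la` lie beyond `k`.
    ...     | k≤i , r≤N | below k≤ _ = ℕP.<-≤-trans
                (ℕP.<-≤-trans (s≤s r≤t₁) (subst (ℕ._≤ N la k) (proj₁ addable) (N-antitone p k≤))) (ℕP.m≤m+n (N la k) _)
    ...     | k≤i , r≤N | inside _ _ δ≡ = ℕP.≤-trans (s≤s r≤N) (ℕP.≤-reflexive (sym (trans (cong (N la k ℕ.+_) δ≡) (ℕP.+-comm _ 1))))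
    ...     | k≤i , r≤N | above i<k _ = contradiction k≤i (ℤP.<⇒≱ i<k)

    moved⇐-beads : ∀ r → r ℕ.< N la k → k ℤ.< moved r
    moved⇐-beads r r< = ℤP.<-≤-trans (N⁻ {la = la} r<) (beads≤moved r)

    moved⇐-cap : ∀ r → r ℕ.≤ t₁ → k ℤ.< cap r → k ℤ.< moved r
    moved⇐-cap r r≤t₁ k< with r ℕ.≤? t₁
    ... | yes _ = ℤP.<-≤-trans k< (ℤP.i≤j⊔i _ _)
    ... | no r≰ = contradiction r≤t₁ r≰

    moved⇐ : ∀ r → r ℕ.< N⁺δ k → k ℤ.< moved r
    moved⇐ {k} r r< with window n i k
    ... | below _ e = moved⇐-beads r (subst (r ℕ.<_) (trans (cong (N la k ℕ.+_) e) (ℕP.+-identityʳ _)) r<)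
    ... | above _ e = moved⇐-beads r (subst (r ℕ.<_) (trans (cong (N la k ℕ.+_) e) (ℕP.+-identityʳ _)) r<)
    ... | inside lo≤ k≤i e = moved⇐-cap r
            (ℕP.≤-trans r≤N (N-antitone p (ℤP.i<j⇒suc[i]≤j lo≤))) (cap⇐ r k≤i r≤N)
      where
      r≤N : r ℕ.≤ N la k
      r≤N = ℕP.≤-pred (subst (r ℕ.<_) (trans (cong (N la k ℕ.+_) e) (ℕP.+-comm _ 1)) r<)

    N⁺δ-step : ∀ k → N⁺δ k ℕ.≤ suc (N⁺δ (ℤ.suc k))
    N⁺δ-step k with window n i k
    ... | below _ e = ℕP.≤-trans (ℕP.≤-reflexive (trans (cong (N la k ℕ.+_) e) (ℕP.+-identityʳ _)))
            (ℕP.≤-trans (N-step p k) (s≤s (ℕP.m≤m+n _ _)))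
    ... | above _ e = ℕP.≤-trans (ℕP.≤-reflexive (trans (cong (N la k ℕ.+_) e) (ℕP.+-identityʳ _)))
            (ℕP.≤-trans (N-step p k) (s≤s (ℕP.m≤m+n _ _)))
    ... | inside lo≤ k≤i e with k ℤ.≟ i
    -- At the upper end of the window `δ` falls by one, and `N la` stays constant because position
    -- `suc i` is free.
    ...   | yes refl = ℕP.≤-trans (ℕP.≤-reflexive (trans (cong (N la k ℕ.+_) e) (ℕP.+-comm _ 1)))
              (s≤s (ℕP.≤-trans (ℕP.≤-reflexive (proj₂ addable)) (ℕP.m≤m+n _ _)))
    ...   | no k≢i = ℕP.≤-trans (ℕP.+-monoˡ-≤ (δ n i k) (N-step p k)) (ℕP.≤-reflexive (cong (λ d → suc (N la (ℤ.suc k)) ℕ.+ d)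
              (trans e (sym (δ-in {i} {n} (ℤP.<-≤-trans lo≤ (ℤP.i≤suc[i] k)) (ℤP.i<j⇒suc[i]≤j (ℤP.≤∧≢⇒< k≤i k≢i)))))))

    -- Just before the bead of row r + 1 the count exceeds r + 1, so by `N⁺δ-step` it still exceeds
    -- r at that bead, which places the bead of row r beyond it.
    moved-decreasing : Decreasing moved
    moved-decreasing r = moved⇐ r (ℕP.≤-pred (ℕP.≤-trans
      (moved⇒ (suc r) (ℤP.i≤pred[j]⇒i<j ℤP.≤-refl))
      (subst (λ k → N⁺δ (ℤ.pred (moved (suc r))) ℕ.≤ suc (N⁺δ k)) (ℤP.suc-pred _) (N⁺δ-step (ℤ.pred (moved (suc r)))))))

    -- A row past both the nonempty rows of `la` and the rows that move.
    last : ℕ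
    last = length la ℕ.+ suc t₁

    moved-last : moved last ≡ ℤ.- (+ last)
    moved-last with last ℕ.≤? t₁
    ... | yes l≤ = contradiction (ℕP.≤-trans (ℕP.m≤n+m (suc t₁) (length la)) l≤) ℕP.1+n≰n
    ... | no _ = trans (cong (λ a → + a ℤ.- + last) (rowLen-length la (suc t₁))) (ℤP.+-identityˡ _)

  addRibbon : ∃[ mu ] IsPartition mu × Ribbon n i la mu
  addRibbon with fromBeads moved moved-decreasing
    (λ r → ℤP.≤-trans (ℤP.i≤j+i (ℤ.- (+ r)) (+ rowLen la r)) (beads≤moved r)) last moved-last
  ... | mu , q , b≡ = mu , q , λ k → ℕP.≤-antisym
    (beads≤⇒N≤ {la = mu} (ℤP.≮⇒≥ λ k< → ℕP.n≮n _ (moved⇒ (N⁺δ k) (subst (k ℤ.<_) (b≡ (N⁺δ k)) k<))))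
    (ℕP.≮⇒≥ λ N< → ℕP.n≮n _ (N⁺ q (subst (k ℤ.<_) (sym (b≡ (N mu k))) (moved⇐ (N mu k) N<))))

-- At each end of the window `δ` jumps by one, while the drop of `N` from one diagonal to the next
-- is 0 or 1 for both partitions. Only one pair of drops is compatible with this.
ribbon-addable : IsPartition la → IsPartition mu → 1 ℕ.≤ n → Ribbon n i la mu → Addable n i la
ribbon-addable {la} {mu} {n} {i} p q 1≤n rib =
  ℕP.≤-antisym (N-step p _) (subst₂ ℕ._≤_ N-lo N-low (N-antitone q (ℤP.i≤suc[i] _))) ,
  ℕP.≤-antisym (ℕP.≤-pred (subst₂ ℕ._≤_ N-i (cong suc N-suci) (N-step q i))) (N-antitone p (ℤP.i≤suc[i] i))
  where
  lo : ℤ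
  lo = ℤ.suc (i ℤ.- + n)
  N-lo : N mu lo ≡ suc (N la lo)
  N-lo = trans (rib lo) (trans (cong (N la lo ℕ.+_)
    (δ-in {n = n} (ℤP.suc[i]≤j⇒i<j ℤP.≤-refl) (ℤP.i<j⇒suc[i]≤j (δ-split n i 1≤n)))) (ℕP.+-comm _ 1))
  N-low : N mu (i ℤ.- + n) ≡ N la (i ℤ.- + n)
  N-low = trans (rib _) (trans (cong (N la (i ℤ.- + n) ℕ.+_) (δ-low {i = i} {n = n} ℤP.≤-refl)) (ℕP.+-identityʳ _))
  N-i : N mu i ≡ suc (N la i)
  N-i = trans (rib i) (trans (cong (N la i ℕ.+_) (δ-in {n = n} (δ-split n i 1≤n) ℤP.≤-refl)) (ℕP.+-comm _ 1))
  N-suci : N mu (ℤ.suc i) ≡ N la (ℤ.suc i)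
  N-suci = trans (rib _) (trans (cong (N la (ℤ.suc i) ℕ.+_) (δ-high {i} {n = n} (ℤP.suc[i]≤j⇒i<j ℤP.≤-refl))) (ℕP.+-identityʳ _))

-- The enumeration of partitions and the value of `u`

partitionsBounded-sound : ∀ f r b → la ∈ partitionsBounded f r b → IsPartition la × rowLen la 0 ℕ.≤ b
partitionsBounded-sound f zero b (here refl) = ([] , []) , z≤n
partitionsBounded-sound (suc f) (suc r) b la∈ with find (∈-concatMap⁻ _ {xs = filterᵇ (λ k → k ≤ᵇ b) (applyUpTo suc (suc r))} la∈)
... | k , k∈ , q with ∈-map⁻ (k ∷_) q | ∈-filter⁻ (λ k → T? (k ≤ᵇ b)) {xs = applyUpTo suc (suc r)} k∈
...   | la′ , la′∈ , refl | k∈′ , k≤b with partitionsBounded-sound f (suc r ℕ.∸ k) k la′∈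
...     | (pos , l) , head≤k = (All.lookup (AllP.applyUpTo⁺₂ {P = 1 ℕ.≤_} suc (suc r) (λ _ → s≤s z≤n)) k∈′ ∷ pos ,
            antitone⇒Linked (k ∷ la′) λ { zero → head≤k ; (suc r) → rowLen-antitone l r }) , toWitness {a? = k ℕ.≤? b} k≤b

partitionsBounded-complete : ∀ f b → IsPartition la → rowLen la 0 ℕ.≤ b → size la ℕ.≤ f → la ∈ partitionsBounded f (size la) b
partitionsBounded-complete {[]} zero b _ _ _ = here refl
partitionsBounded-complete {[]} (suc f) b _ _ _ = here refl
partitionsBounded-complete {suc a ∷ la} (suc f) b (_ ∷ pos , l) a≤b (s≤s s≤f) =
  ∈-concatMap⁺ (λ k → map (k ∷_) (partitionsBounded f (size (suc a ∷ la) ℕ.∸ k) k)) (lose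
    (∈-filter⁺ (λ k → T? (k ≤ᵇ b)) (∈-applyUpTo⁺ suc (s≤s (ℕP.m≤m+n a (size la)))) (fromWitness {a? = suc a ℕ.≤? b} a≤b))
    (∈-map⁺ (suc a ∷_) (subst (λ s → la ∈ partitionsBounded f s (suc a)) (sym (ℕP.m+n∸m≡n a (size la)))
      (partitionsBounded-complete f (suc a) (pos , Linked.tail l) (rowLen-antitone l 0)
        (ℕP.≤-trans (ℕP.m≤n+m (size la) a) s≤f)))))

partitionsBounded-unique : ∀ f r b → Unique (partitionsBounded f r b)
partitionsBounded-unique zero zero b = [] ∷ []
partitionsBounded-unique (suc f) zero b = [] ∷ []
partitionsBounded-unique zero (suc r) b = []
partitionsBounded-unique (suc f) (suc r) b = UniqueP.concat⁺
  (AllP.map⁺ {f = block} (All.universal (λ k → UniqueP.map⁺ ∷-injectiveʳ (partitionsBounded-unique f (suc r ℕ.∸ k) k)) _))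
  (AllPairsP.map⁺ (AllPairs.map disjoint (UniqueP.filter⁺ (λ k → T? (k ≤ᵇ b))
    (UniqueP.applyUpTo⁺₁ suc (suc r) (λ i<j _ → ℕP.<⇒≢ i<j ∘ ℕP.suc-injective)))))
  where
  block : ℕ → List (List ℕ)
  block k = map (k ∷_) (partitionsBounded f (suc r ℕ.∸ k) k)
  disjoint : ∀ {k k′} → k ≢ k′ → ∀ {la} → ¬ (la ∈ block k × la ∈ block k′)
  disjoint k≢k′ (la∈ , la∈′) with ∈-map⁻ _ la∈ | ∈-map⁻ _ la∈′
  ... | _ , _ , refl | _ , _ , refl = k≢k′ refl

rowLen≤size : ∀ la → rowLen la 0 ℕ.≤ size la
rowLen≤size [] = z≤n
rowLen≤size (a ∷ la) = ℕP.m≤m+n a _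

length-concatMap : (F : ℕ → List A) (f : ℕ → ℕ) → ∀ m →
  length (concatMap F (applyUpTo f m)) ≡ sum (applyUpTo (length ∘ F ∘ f) m)
length-concatMap F f zero = refl
length-concatMap F f (suc m) = trans (length-++ (F (f 0))) (cong (length (F (f 0)) ℕ.+_) (length-concatMap F (f ∘ suc) m))

-- The row counts enter as an arbitrary `f` with pointwise values so that the induction can shift
-- it.
size-skew : ∀ la mu → All (1 ℕ.≤_) la → (∀ r → rowLen la r ℕ.≤ rowLen mu r) → ∀ (f : ℕ → ℕ) →
  (∀ r → f r ≡ rowLen mu r ℕ.∸ rowLen la r) → size mu ≡ size la ℕ.+ sum (applyUpTo f (length mu))
size-skew [] [] pos le f e = refl
size-skew [] (m ∷ mu) pos le f e = cong₂ ℕ._+_ (sym (e 0)) (size-skew [] mu [] (λ _ → z≤n) (f ∘ suc) (e ∘ suc))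
size-skew (a ∷ la) [] (1≤a ∷ _) le f e = contradiction (ℕP.≤-trans 1≤a (le 0)) λ ()
size-skew (a ∷ la) (m ∷ mu) (_ ∷ pos) le f e = begin
  m ℕ.+ size mu                                         ≡⟨ cong₂ ℕ._+_ (sym (ℕP.m+[n∸m]≡n (le 0))) (size-skew la mu pos (le ∘ suc) (f ∘ suc) (e ∘ suc)) ⟩
  (a ℕ.+ (m ℕ.∸ a)) ℕ.+ (size la ℕ.+ rest)              ≡⟨ cong (λ d → (a ℕ.+ d) ℕ.+ (size la ℕ.+ rest)) (sym (e 0)) ⟩
  (a ℕ.+ f 0) ℕ.+ (size la ℕ.+ rest)                    ≡⟨ interchange a (f 0) (size la) rest ⟩
  (a ℕ.+ size la) ℕ.+ (f 0 ℕ.+ rest)                    ∎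
  where
  open ≡-Reasoning
  open Algebra.Properties.CommutativeSemigroup ℕP.+-commutativeSemigroup using (interchange)
  rest : ℕ
  rest = sum (applyUpTo (f ∘ suc) (length mu))

size-contained : IsPartition la → (∀ r → rowLen la r ℕ.≤ rowLen mu r) → size mu ≡ size la ℕ.+ length (skewCells la mu)
size-contained {la} {mu} (pos , _) le = trans
  (size-skew la mu pos le (λ r → length (map (λ j → (r , rowLen la r ℕ.+ j)) (upTo (rowLen mu r ℕ.∸ rowLen la r)))) (λ r → trans (length-map _ (upTo (rowLen mu r ℕ.∸ rowLen la r))) (length-applyUpTo id _)))
  (cong (size la ℕ.+_) (sym (length-concatMap (λ r → map (λ j → (r , rowLen la r ℕ.+ j)) (upTo (rowLen mu r ℕ.∸ rowLen la r))) id (length mu))))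

partitionsOf-complete : IsPartition la → IsPartition mu → Ribbon n i la mu → 1 ℕ.≤ n → mu ∈ partitionsOf (size la ℕ.+ n)
partitionsOf-complete {la} {mu} {n} p q rib 1≤n = subst (λ s → mu ∈ partitionsOf s) size≡
  (partitionsBounded-complete (size mu) (size mu) q (rowLen≤size mu) ℕP.≤-refl)
  where
  size≡ : size mu ≡ size la ℕ.+ n
  size≡ = trans (size-contained {mu = mu} p (ribbon-contained p q 1≤n rib)) (cong (size la ℕ.+_) (length-ribbon p q rib))

concatMap-none : ∀ (G : A → List B) xs → (∀ {x} → x ∈ xs → G x ≡ []) → concatMap G xs ≡ []
concatMap-none G [] h = refl
concatMap-none G (x ∷ xs) h rewrite h (here refl) = concatMap-none G xs (h ∘ there)

concatMap-single : ∀ (G : A → List B) {xs x} → Unique xs → x ∈ xs → (∀ {y} → y ∈ xs → y ≢ x → G y ≡ []) → concatMap G xs ≡ G x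
concatMap-single G {x ∷ xs} (x∉ ∷ _) (here refl) h =
  trans (cong (G x ++_) (concatMap-none G xs (λ y∈ → h (there y∈) (All.lookup x∉ y∈ ∘ sym)))) (++-identityʳ (G x))
concatMap-single G {z ∷ xs} {x} (z∉ ∷ uniq) (there x∈) h rewrite h (here refl) (All.lookup z∉ x∈) =
  concatMap-single G uniq x∈ (h ∘ there)

filterᵇ-concatMap : ∀ (P : B → Bool) (g : A → List B) xs → filterᵇ P (concatMap g xs) ≡ concatMap (filterᵇ P ∘ g) xs
filterᵇ-concatMap P g [] = refl
filterᵇ-concatMap P g (x ∷ xs) = trans (filter-++ (T? ∘ P) (g x) (concatMap g xs)) (cong (filterᵇ P (g x) ++_) (filterᵇ-concatMap P g xs))

module _ (p : IsPartition la) (1≤n : 1 ℕ.≤ n) where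

  private
    step : List ℕ → List (ℤ × ℕ × List ℕ)
    step mu = if isRibbonᵇ n la mu then (diagonal (headCell la mu) , spin la mu , mu) ∷ [] else []

    headed : ℤ → (ℤ × ℕ × List ℕ) → Bool
    headed i t = ⌊ proj₁ t ℤ.≟ i ⌋

    L : List (List ℕ)
    L = partitionsOf (size la ℕ.+ n)

    headed-self : ∀ {i j sp} → j ≡ i → filterᵇ (headed i) ((j , sp , mu) ∷ []) ≡ (i , sp , mu) ∷ []
    headed-self {i = i} refl = filter-accept (T? ∘ headed i) {xs = []} (fromWitness {a? = i ℤ.≟ i} refl)

    headed-other : ∀ {i j sp} → j ≢ i → filterᵇ (headed i) ((j , sp , mu) ∷ []) ≡ []
    headed-other {mu} {i} {j} {sp} j≢i = filter-reject (T? ∘ headed i) {x = j , sp , mu} {xs = []} (j≢i ∘ toWitness)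

    step-ribbon : IsPartition mu → Ribbon n i la mu → filterᵇ (headed i) (step mu) ≡ (i , spin la mu , mu) ∷ []
    step-ribbon {mu} {i} q rib = trans
      (cong (λ b → filterᵇ (headed i) (if b then _ ∷ [] else [])) (to T-≡ (isRibbon⁺ p q 1≤n rib)))
      (headed-self (ribbon-head p q 1≤n rib))

    filterᵇ-if : ∀ (P : A → Bool) b {t} → (T b → filterᵇ P (t ∷ []) ≡ []) → filterᵇ P (if b then t ∷ [] else []) ≡ []
    filterᵇ-if P true h = h tt
    filterᵇ-if P false h = refl

    step-other : IsPartition mu → ¬ Ribbon n i la mu → filterᵇ (headed i) (step mu) ≡ []
    step-other {mu} {i} q ¬rib = filterᵇ-if (headed i) (isRibbonᵇ n la mu) λ h → other (isRibbon⁻ p q 1≤n h)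
      where
      other : (∃[ j ] Ribbon n j la mu) → filterᵇ (headed i) ((diagonal (headCell la mu) , spin la mu , mu) ∷ []) ≡ []
      other (j , rib) = headed-other λ head≡i →
        ¬rib (subst (λ j → Ribbon n j la mu) (trans (sym (ribbon-head p q 1≤n rib)) head≡i) rib)

    sound : mu ∈ L → IsPartition mu
    sound = proj₁ ∘ partitionsBounded-sound (size la ℕ.+ n) (size la ℕ.+ n) (size la ℕ.+ n)

  -- The enumeration has no repetitions, and `N-injective` leaves `mu` as the only partition whose
  -- ribbon over `la` has head `i`, so one term survives.
  u-addable : IsPartition mu → Ribbon n i la mu → u n i la ≡ (+ 1 , spin la mu , mu) ∷ []
  u-addable {mu} {i} q rib = cong (map _) (trans (filterᵇ-concatMap (headed i) step L) (trans
    (concatMap-single _ (partitionsBounded-unique (size la ℕ.+ n) (size la ℕ.+ n) (size la ℕ.+ n)) (partitionsOf-complete p q rib 1≤n)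
      (λ y∈ y≢ → step-other (sound y∈) (λ rib′ → y≢ (N-injective (sound y∈) q (λ k → trans (rib′ k) (sym (rib k)))))))
    (step-ribbon q rib)))

  u-not-addable : ¬ Addable n i la → u n i la ≡ []
  u-not-addable {i} ¬a = cong (map _) (trans (filterᵇ-concatMap (headed i) step L)
    (concatMap-none _ L (λ y∈ → step-other (sound y∈) (¬a ∘ ribbon-addable p (sound y∈) 1≤n))))

-- Interaction of two ribbons

δ-flat : k ≢ i → k ≢ i ℤ.- + n → δ n i k ≡ δ n i (ℤ.suc k)
δ-flat {k} {i} {n} k≢i k≢i-n with window n i k
... | below k≤ e = trans e (sym (δ-low {i = i} {n = n} (ℤP.i<j⇒suc[i]≤j (ℤP.≤∧≢⇒< k≤ k≢i-n))))
... | inside l k≤ e = trans e (sym (δ-in {n = n} (ℤP.<-≤-trans l (ℤP.i≤suc[i] k)) (ℤP.i<j⇒suc[i]≤j (ℤP.≤∧≢⇒< k≤ k≢i))))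
... | above i<k e = trans e (sym (δ-high {n = n} (ℤP.<-≤-trans i<k (ℤP.i≤suc[i] k))))

δ-rise : suc (δ n i k) ≡ δ n i (ℤ.suc k) → k ≡ i ℤ.- + n
δ-rise {n} {i} {k} e with k ℤ.≟ i ℤ.- + n | window n i k
... | yes k≡ | _ = k≡
... | no _ | inside _ _ e′ = contradiction (subst (ℕ._≤ 1) (trans (sym e) (cong suc e′)) (δ≤1 n i (ℤ.suc k))) (ℕP.<⇒≱ (ℕP.n<1+n 1))
... | no k≢ | below k≤ _ = contradiction (trans e (sym (δ-flat (ℤP.<⇒≢ (ℤP.<-≤-trans (ℤP.≤∧≢⇒< k≤ k≢) (ℤP.i-j≤i i (+ n)))) k≢))) ℕP.1+n≢n
... | no k≢ | above i<k _ = contradiction (trans e (sym (δ-flat (ℤP.<⇒≢ i<k ∘ sym) k≢))) ℕP.1+n≢n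

δ-fall : δ n i k ≡ suc (δ n i (ℤ.suc k)) → k ≡ i
δ-fall {n} {i} {k} e with k ℤ.≟ i | k ℤ.≟ i ℤ.- + n
... | yes k≡i | _ = k≡i
... | no k≢i | no k≢ = contradiction (trans (sym e) (δ-flat k≢i k≢)) ℕP.1+n≢n
... | no k≢i | yes refl = contradiction (trans (sym (δ-low {i = i} {n = n} ℤP.≤-refl)) e) λ ()

-- No end of one window coincides with an end of the other. Then neither ribbon affects whether the
-- other can be added.
Apart : ℕ → ℤ → ℤ → Set
Apart n x z = z ≢ x × z ℤ.- + n ≢ x × z ≢ x ℤ.- + n

apart-sym : Apart n x z → Apart n z x
apart-sym (a , b , c) = a ∘ sym , c ∘ sym , b ∘ sym

shift-injective : ∀ m → x ℤ.- m ≡ y ℤ.- m → x ≡ y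
shift-injective {x} {y} m e = trans (sym (back x)) (trans (cong (λ x → x ℤ.+ m) e) (back y))
  where
  open +-*-Solver
  back : ∀ x → (x ℤ.- m) ℤ.+ m ≡ x
  back x = solve 2 (λ x m → (x :- m) :+ m := x) refl x m

module _ (rib : Ribbon n x la mu) (apart : Apart n x z) where

  private
    flat : δ n x (z ℤ.- + n) ≡ δ n x (ℤ.suc (z ℤ.- + n))
    flat = δ-flat (proj₁ (proj₂ apart)) (proj₁ apart ∘ shift-injective (+ n))

    flat′ : δ n x z ≡ δ n x (ℤ.suc z)
    flat′ = δ-flat (proj₁ apart) (proj₂ (proj₂ apart))

  -- `Addable` only compares `N` across the two ends of the window of `z`, where the indicator of
  -- the window of `x` is constant.
  addable-after : Addable n z la → Addable n z mu
  addable-after (e₁ , e₂) =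
    trans (rib _) (trans (cong₂ ℕ._+_ e₁ flat) (cong suc (sym (rib _)))) ,
    trans (rib _) (trans (cong₂ ℕ._+_ e₂ flat′) (sym (rib _)))

  addable-before : Addable n z mu → Addable n z la
  addable-before (e₁ , e₂) =
    ℕP.+-cancelʳ-≡ (δ n x _) _ _ (trans (sym (rib _)) (trans e₁ (cong suc (trans (rib _) (cong (N la _ ℕ.+_) (sym flat)))))) ,
    ℕP.+-cancelʳ-≡ (δ n x _) _ _ (trans (sym (rib _)) (trans e₂ (trans (rib _) (cong (N la _ ℕ.+_) (sym flat′)))))

-- The first ribbon leaves a bead at `suc x`, so this position is no longer free.
not-addable-again : 1 ℕ.≤ n → Ribbon n x la mu → Addable n x la → ¬ Addable n x mu
not-addable-again {n} {x} {la} {mu} 1≤n rib (_ , e) (_ , e′) = ℕP.1+n≢n (begin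
  suc (N la (ℤ.suc x))               ≡⟨ cong suc (sym e) ⟩
  suc (N la x)                       ≡⟨ ℕP.+-comm 1 _ ⟩
  N la x ℕ.+ 1                       ≡⟨ cong (N la x ℕ.+_) (sym (δ-in {n = n} (δ-split n x 1≤n) ℤP.≤-refl)) ⟩
  N la x ℕ.+ δ n x x                 ≡⟨ sym (rib x) ⟩
  N mu x                             ≡⟨ e′ ⟩
  N mu (ℤ.suc x)                     ≡⟨ rib _ ⟩
  N la (ℤ.suc x) ℕ.+ δ n x (ℤ.suc x) ≡⟨ cong (N la (ℤ.suc x) ℕ.+_) (δ-high {x} {n = n} (ℤP.suc[i]≤j⇒i<j ℤP.≤-refl)) ⟩
  N la (ℤ.suc x) ℕ.+ 0               ≡⟨ ℕP.+-identityʳ _ ⟩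
  N la (ℤ.suc x)                     ∎)
  where open ≡-Reasoning

-- Adding the ribbon with head x fills position suc x and frees position suc (x - n);
-- a single further ribbon cannot reverse both.
not-addable-returning : 1 ℕ.≤ n → Ribbon n x la mu → Ribbon n y mu nu → Addable n x la → ¬ Addable n x nu
not-addable-returning {n} {x} {la} {mu} {y} {nu} 1≤n rib rib′ (e₁ , e₂) (e₁′ , e₂′) =
  ℤP.<-irrefl refl (ℤP.<-trans (subst (ℤ._< x) low (δ-split n x 1≤n)) (subst (ℤ._< y) (sym high) (δ-split n y 1≤n)))
  where
  lo : ℤ
  lo = ℤ.suc (x ℤ.- + n)
  total : ∀ k {d} → δ n x k ≡ d → N nu k ≡ N la k ℕ.+ (d ℕ.+ δ n y k)
  total k {d} refl = trans (rib′ k) (trans (cong (ℕ._+ δ n y k) (rib k)) (ℕP.+-assoc (N la k) _ _))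
  high : x ≡ y ℤ.- + n
  high = δ-rise (ℕP.+-cancelˡ-≡ (N la x) _ _ (trans
    (sym (total x (δ-in {n = n} (δ-split n x 1≤n) ℤP.≤-refl)))
    (trans e₂′ (trans (total _ (δ-high {x} {n = n} (ℤP.suc[i]≤j⇒i<j ℤP.≤-refl))) (cong (ℕ._+ δ n y (ℤ.suc x)) (sym e₂))))))
  low : x ℤ.- + n ≡ y
  low = δ-fall (ℕP.+-cancelˡ-≡ (N la (x ℤ.- + n)) _ _ (trans
    (sym (total (x ℤ.- + n) (δ-low {i = x} {n = n} ℤP.≤-refl)))
    (trans e₁′ (trans (cong suc (total lo (δ-in {n = n} (ℤP.suc[i]≤j⇒i<j ℤP.≤-refl) (ℤP.i<j⇒suc[i]≤j (δ-split n x 1≤n)))))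
      (cong (ℕ._+ suc (δ n y lo)) (sym e₁))))))

-- Relations between the ribbon operators

scale-scale : ∀ c e c′ e′ v → scale c e (scale c′ e′ v) ≡ scale (c ℤ.* c′) (e ℕ.+ e′) v
scale-scale c e c′ e′ [] = refl
scale-scale c e c′ e′ ((d , f , mu) ∷ v) = cong₂ _∷_
  (cong₂ _,_ (sym (ℤP.*-assoc c c′ d)) (cong (_, mu) (sym (ℕP.+-assoc e e′ f)))) (scale-scale c e c′ e′ v)

applyOp-scale : ∀ A c e v → applyOp A (scale c e v) ≡ scale c e (applyOp A v)
applyOp-scale A c e [] = refl
applyOp-scale A c e ((d , f , mu) ∷ v) = trans
  (cong₂ _++_ (sym (scale-scale c e d f (A mu))) (applyOp-scale A c e v)) (sym (map-++ _ (scale d f (A mu)) (applyOp A v)))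

term : ℕ → List ℕ → FSum
term e la = (+ 1 , e , la) ∷ []

-- Everything that ribbon operators produce from a basis vector is zero or a power of q times one
-- partition, so the relations are needed on these vectors only.
data Monomial : FSum → Set where
  zero : Monomial []
  unit : ∀ e → IsPartition la → Monomial (term e la)

private
  -- Puts numerals for the `δ` values in the last two equations of `Diamond`.
  at : ∀ b m l {d d₀ d′ d₀′} → d ≡ d₀ → d′ ≡ d₀′ → b ℕ.+ (m ℕ.+ d) ≡ l ℕ.+ d′ → b ℕ.+ (m ℕ.+ d₀) ≡ l ℕ.+ d₀′
  at b m l refl refl eq = eq

-- Only the action of the operators on single terms matters, so U is abstract here:
-- goals about u itself unfold to the enumeration of all partitions.
module Relations (n : ℕ) (1≤n : 1 ℕ.≤ n) (U : ℤ → FSum → FSum) (U-[] : ∀ i → U i [] ≡ [])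
  (add-ribbon : ∀ {i la mu} → IsPartition la → IsPartition mu → Ribbon n i la mu →
    ∀ e → U i (term e la) ≡ term (e ℕ.+ spin la mu) mu)
  (add-stuck : ∀ {i la} → IsPartition la → ¬ Addable n i la → ∀ e → U i (term e la) ≡ []) where

  data Added (i : ℤ) (e : ℕ) (la : List ℕ) : FSum → Set where
    stuck : ¬ Addable n i la → Added i e la []
    added : IsPartition mu → Ribbon n i la mu → Added i e la (term (e ℕ.+ spin la mu) mu)

  add : IsPartition la → ∀ i e → Added i e la (U i (term e la))
  add {la} p i e = decide (addable? n i la)
    where
    use : (∃[ mu ] IsPartition mu × Ribbon n i la mu) → Added i e la (U i (term e la))
    use (mu , q , rib) = subst (Added i e la) (sym (add-ribbon p q rib e)) (added q rib)
    decide : Dec (Addable n i la) → Added i e la (U i (term e la))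
    decide (no ¬a) = subst (Added i e la) (sym (add-stuck p ¬a e)) (stuck ¬a)
    decide (yes a) = use (addRibbon p 1≤n a)

  added-monomial : ∀ {i e v} → Added i e la v → Monomial v
  added-monomial (stuck _) = zero
  added-monomial (added q _) = unit _ q

  monomial-U : ∀ i {v} → Monomial v → Monomial (U i v)
  monomial-U i zero = subst Monomial (sym (U-[] i)) zero
  monomial-U i (unit e p) = added-monomial (add p i e)

  square-zero : ∀ x {v} → Monomial v → U x (U x v) ≡ []
  square-zero x zero = trans (cong (U x) (U-[] x)) (U-[] x)
  square-zero x (unit {la} e p) = again (add p x e)
    where
    again : ∀ {v} → Added x e la v → U x v ≡ []
    again (stuck _) = U-[] x
    again (added {mu} q rib) = add-stuck q (not-addable-again {la = la} {mu} 1≤n rib (ribbon-addable p q 1≤n rib)) _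

  return-zero : ∀ x y {v} → Monomial v → U x (U y (U x v)) ≡ []
  return-zero x y zero = trans (cong (U x) (trans (cong (U y) (U-[] x)) (U-[] y))) (U-[] x)
  return-zero x y (unit {la} e p) = again (add p x e)
    where
    again : ∀ {v} → Added x e la v → U x (U y v) ≡ []
    again (stuck _) = trans (cong (U x) (U-[] y)) (U-[] x)
    again (added {mu} q rib) = back (add q y _)
      where
      back : ∀ {e v} → Added y e mu v → U x v ≡ []
      back (stuck _) = U-[] x
      back (added {nu} q′ rib′) = add-stuck q′ (not-addable-returning {la = la} {mu} {nu = nu} 1≤n rib rib′ (ribbon-addable p q 1≤n rib)) _

  -- The four equations are ribbon-spin for the sides of the diamond, expressed through la.
  data Diamond (x z : ℤ) (e : ℕ) (la : List ℕ) : FSum → FSum → Set where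
    zero : Diamond x z e la [] []
    both : ∀ {mu mu′ nu} → spin la mu ℕ.+ N la x ≡ N la (ℤ.suc (x ℤ.- + n)) →
      spin la mu′ ℕ.+ N la z ≡ N la (ℤ.suc (z ℤ.- + n)) →
      spin mu nu ℕ.+ (N la z ℕ.+ δ n x z) ≡ N la (ℤ.suc (z ℤ.- + n)) ℕ.+ δ n x (ℤ.suc (z ℤ.- + n)) →
      spin mu′ nu ℕ.+ (N la x ℕ.+ δ n z x) ≡ N la (ℤ.suc (x ℤ.- + n)) ℕ.+ δ n z (ℤ.suc (x ℤ.- + n)) →
      Diamond x z e la (term ((e ℕ.+ spin la mu) ℕ.+ spin mu nu) nu) (term ((e ℕ.+ spin la mu′) ℕ.+ spin mu′ nu) nu)

  -- A ribbon can be added after the other exactly when it can be added before it, so both orders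
  -- vanish together. Otherwise both add the same two indicators to `N la` and end at the same
  -- partition.
  diamond : IsPartition la → Apart n x z → ∀ e → Diamond x z e la (U z (U x (term e la))) (U x (U z (term e la)))
  diamond {la} {x} {z} p apart e = decide (addable? n x la) (addable? n z la)
    where
    Goal : Set
    Goal = Diamond x z e la (U z (U x (term e la))) (U x (U z (term e la)))
    Sum : ℤ → Set
    Sum i = ∃[ mu ] IsPartition mu × Ribbon n i la mu
    close : ∀ {mu mu′ nu nu′} → IsPartition mu → Ribbon n x la mu → IsPartition mu′ → Ribbon n z la mu′ →
      IsPartition nu → Ribbon n z mu nu → IsPartition nu′ → Ribbon n x mu′ nu′ → nu ≡ nu′ → Goal
    close {mu} {mu′} {nu} q rib q′ rib′ r ribz r′ ribx refl = subst₂ (Diamond x z e la)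
      (sym (trans (cong (U z) (add-ribbon p q rib e)) (add-ribbon q r ribz _)))
      (sym (trans (cong (U x) (add-ribbon p q′ rib′ e)) (add-ribbon q′ r′ ribx _)))
      (both {mu = mu} {mu′} {nu} (ribbon-spin p q 1≤n rib) (ribbon-spin p q′ 1≤n rib′)
        (trans (cong (spin mu nu ℕ.+_) (sym (rib z))) (trans (ribbon-spin q r 1≤n ribz) (rib _)))
        (trans (cong (spin mu′ nu ℕ.+_) (sym (rib′ x))) (trans (ribbon-spin q′ r′ 1≤n ribx) (rib′ _))))
    complete : ∀ {mu mu′} → IsPartition mu → Ribbon n x la mu → IsPartition mu′ → Ribbon n z la mu′ →
      (∃[ nu ] IsPartition nu × Ribbon n z mu nu) → (∃[ nu ] IsPartition nu × Ribbon n x mu′ nu) → Goal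
    complete {mu} {mu′} q rib q′ rib′ (nu , r , ribz) (nu′ , r′ , ribx) =
      close q rib q′ rib′ r ribz r′ ribx (N-injective r r′ λ k → begin
        N nu k                             ≡⟨ trans (ribz k) (cong (ℕ._+ δ n z k) (rib k)) ⟩
        (N la k ℕ.+ δ n x k) ℕ.+ δ n z k   ≡⟨ ℕP.+-assoc (N la k) _ _ ⟩
        N la k ℕ.+ (δ n x k ℕ.+ δ n z k)   ≡⟨ cong (N la k ℕ.+_) (ℕP.+-comm (δ n x k) _) ⟩
        N la k ℕ.+ (δ n z k ℕ.+ δ n x k)   ≡⟨ sym (ℕP.+-assoc (N la k) _ _) ⟩
        (N la k ℕ.+ δ n z k) ℕ.+ δ n x k   ≡⟨ sym (trans (ribx k) (cong (ℕ._+ δ n x k) (rib′ k))) ⟩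
        N nu′ k                            ∎)
      where open ≡-Reasoning
    yes-yes : Addable n x la → Addable n z la → Sum x → Sum z → Goal
    yes-yes ax az (mu , q , rib) (mu′ , q′ , rib′) = complete q rib q′ rib′
      (addRibbon q 1≤n (addable-after {la = la} {mu} rib apart az)) (addRibbon q′ 1≤n (addable-after {la = la} {mu′} rib′ (apart-sym apart) ax))
    no-yes : ¬ Addable n x la → Sum z → Goal
    no-yes ¬x (mu , q , rib) = subst₂ (Diamond x z e la)
      (sym (trans (cong (U z) (add-stuck p ¬x e)) (U-[] z)))
      (sym (trans (cong (U x) (add-ribbon p q rib e)) (add-stuck q (¬x ∘ addable-before {la = la} {mu} rib (apart-sym apart)) _))) zero
    yes-no : ¬ Addable n z la → Sum x → Goal
    yes-no ¬z (mu , q , rib) = subst₂ (Diamond x z e la)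
      (sym (trans (cong (U z) (add-ribbon p q rib e)) (add-stuck q (¬z ∘ addable-before {la = la} {mu} rib apart) _)))
      (sym (trans (cong (U x) (add-stuck p ¬z e)) (U-[] x))) zero
    decide : Dec (Addable n x la) → Dec (Addable n z la) → Goal
    decide (no ¬x) (no ¬z) = subst₂ (Diamond x z e la)
      (sym (trans (cong (U z) (add-stuck p ¬x e)) (U-[] z))) (sym (trans (cong (U x) (add-stuck p ¬z e)) (U-[] x))) zero
    decide (no ¬x) (yes az) = no-yes ¬x (addRibbon p 1≤n az)
    decide (yes ax) (no ¬z) = yes-no ¬z (addRibbon p 1≤n ax)
    decide (yes ax) (yes az) = yes-yes ax az (addRibbon p 1≤n ax) (addRibbon p 1≤n az)

  -- The windows are disjoint, so neither ribbon changes `N` at the two diagonals that give the spin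
  -- of the other.
  commute-far : x ℤ.< z ℤ.- + n → ∀ {v} → Monomial v → U z (U x v) ≡ U x (U z v)
  commute-far {x} {z} far zero =
    trans (cong (U z) (U-[] x)) (trans (U-[] z) (sym (trans (cong (U x) (U-[] z)) (U-[] x))))
  commute-far {x} {z} far (unit {la} e p) = equal (diamond p apart e)
    where
    x<z : x ℤ.< z
    x<z = ℤP.<-≤-trans far (ℤP.i-j≤i z (+ n))
    x-n<z : x ℤ.- + n ℤ.< z
    x-n<z = ℤP.≤-<-trans (ℤP.i-j≤i x (+ n)) x<z
    apart : Apart n x z
    apart = ℤP.<⇒≢ x<z ∘ sym , ℤP.<⇒≢ far ∘ sym , ℤP.<⇒≢ x-n<z ∘ sym
    lo≤z : ℤ.suc (x ℤ.- + n) ℤ.≤ z ℤ.- + n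
    lo≤z = ℤP.≤-trans (ℤP.i<j⇒suc[i]≤j (δ-split n x 1≤n)) (ℤP.<⇒≤ far)
    exponents : ∀ {a a′ b b′ Nx Nz Lx Lz} → a ℕ.+ Nx ≡ Lx → a′ ℕ.+ Nz ≡ Lz →
      b ℕ.+ (Nz ℕ.+ 0) ≡ Lz ℕ.+ 0 → b′ ℕ.+ (Nx ℕ.+ 0) ≡ Lx ℕ.+ 0 → (e ℕ.+ a) ℕ.+ b ≡ (e ℕ.+ a′) ℕ.+ b′
    exponents {a} {a′} {b} {b′} {Nx} {Nz} refl refl eb eb′
      rewrite ℕP.+-identityʳ Nx | ℕP.+-identityʳ Nz | ℕP.+-identityʳ (a ℕ.+ Nx) | ℕP.+-identityʳ (a′ ℕ.+ Nz)
        | ℕP.+-cancelʳ-≡ Nz b a′ eb | ℕP.+-cancelʳ-≡ Nx b′ a eb′ = solve 3 (λ e a b → (e :+ a) :+ b := (e :+ b) :+ a) refl e a a′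
      where open ℕSolver.+-*-Solver
    equal : ∀ {v w} → Diamond x z e la v w → v ≡ w
    equal zero = refl
    equal (both {mu} {mu′} {nu} s₁ s₂ s₃ s₄) = cong (λ e → term e nu) (exponents {spin la mu} {spin la mu′} {spin mu nu} {spin mu′ nu} {N la x} {N la z} s₁ s₂
      (at (spin mu nu) (N la z) (N la (ℤ.suc (z ℤ.- + n))) (δ-high {x} {n = n} x<z) (δ-high {x} {n = n} (ℤP.<-trans far (ℤP.suc[i]≤j⇒i<j ℤP.≤-refl))) s₃)
      (at (spin mu′ nu) (N la x) (N la (ℤ.suc (x ℤ.- + n))) (δ-low {i = z} {n = n} (ℤP.<⇒≤ far)) (δ-low {i = z} {n = n} lo≤z) s₄))

  -- The ribbon of `z` gains one in spin when added second, since the window of `x` contains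
  -- `suc (z - n)`; that of `x` loses one when added second, since the window of `z` contains `x`.
  commute-near : x ℤ.< z → z ℤ.- + n ℤ.< x → ∀ {v} → Monomial v → U z (U x v) ≡ scale (+ 1) 2 (U x (U z v))
  commute-near {x} {z} x<z near zero =
    trans (cong (U z) (U-[] x)) (trans (U-[] z) (cong (scale (+ 1) 2) (sym (trans (cong (U x) (U-[] z)) (U-[] x)))))
  commute-near {x} {z} x<z near (unit {la} e p) = equal (diamond p apart e)
    where
    x-n<z-n : x ℤ.- + n ℤ.< z ℤ.- + n
    x-n<z-n = ℤP.+-monoˡ-< (ℤ.- (+ n)) x<z
    apart : Apart n x z
    apart = ℤP.<⇒≢ x<z ∘ sym , ℤP.<⇒≢ near , ℤP.<⇒≢ (ℤP.<-trans (δ-split n x 1≤n) x<z) ∘ sym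
    exponents : ∀ {a a′ b b′ Nx Nz Lx Lz} → a ℕ.+ Nx ≡ Lx → a′ ℕ.+ Nz ≡ Lz →
      b ℕ.+ (Nz ℕ.+ 0) ≡ Lz ℕ.+ 1 → b′ ℕ.+ (Nx ℕ.+ 1) ≡ Lx ℕ.+ 0 → (e ℕ.+ a) ℕ.+ b ≡ 2 ℕ.+ ((e ℕ.+ a′) ℕ.+ b′)
    exponents {a} {a′} {b} {b′} {Nx} {Nz} refl refl eb eb′ = trans (cong₂ (λ a b → (e ℕ.+ a) ℕ.+ b) a≡ b≡)
      (solve 3 (λ e a b → (e :+ (con 1 :+ b)) :+ (con 1 :+ a) := con 2 :+ ((e :+ a) :+ b)) refl e a′ b′)
      where
      open ℕSolver.+-*-Solver
      b≡ : b ≡ suc a′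
      b≡ = ℕP.+-cancelʳ-≡ Nz b (suc a′) (trans (cong (b ℕ.+_) (sym (ℕP.+-identityʳ Nz))) (trans eb (ℕP.+-comm _ 1)))
      a≡ : a ≡ suc b′
      a≡ = sym (ℕP.+-cancelʳ-≡ Nx (suc b′) a (trans (solve 2 (λ b x → (con 1 :+ b) :+ x := b :+ (x :+ con 1)) refl b′ Nx)
        (trans eb′ (ℕP.+-identityʳ _))))
    equal : ∀ {v w} → Diamond x z e la v w → v ≡ scale (+ 1) 2 w
    equal zero = refl
    equal (both {mu} {mu′} {nu} s₁ s₂ s₃ s₄) = cong (λ e → term e nu) (exponents {spin la mu} {spin la mu′} {spin mu nu} {spin mu′ nu} {N la x} {N la z} s₁ s₂
      (at (spin mu nu) (N la z) (N la (ℤ.suc (z ℤ.- + n))) (δ-high {x} {n = n} x<z)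
        (δ-in {n = n} (ℤP.<-trans x-n<z-n (ℤP.suc[i]≤j⇒i<j ℤP.≤-refl)) (ℤP.i<j⇒suc[i]≤j near)) s₃)
      (at (spin mu′ nu) (N la x) (N la (ℤ.suc (x ℤ.- + n))) (δ-in {n = n} near (ℤP.<⇒≤ x<z)) (δ-low {i = z} {n = n} (ℤP.i<j⇒suc[i]≤j x-n<z-n)) s₄))

-- Finite sums and the cancellation over three letters

∑ : List A → (A → ℤ) → ℤ
∑ [] f = + 0
∑ (x ∷ xs) f = f x ℤ.+ ∑ xs f

∑-cong : ∀ (xs : List A) {f g : A → ℤ} → (∀ x → f x ≡ g x) → ∑ xs f ≡ ∑ xs g
∑-cong [] e = refl
∑-cong (x ∷ xs) e = cong₂ ℤ._+_ (e x) (∑-cong xs e)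

∑-zero : ∀ (xs : List A) {f : A → ℤ} → (∀ x → f x ≡ + 0) → ∑ xs f ≡ + 0
∑-zero [] e = refl
∑-zero (x ∷ xs) e = trans (cong₂ ℤ._+_ (e x) (∑-zero xs e)) refl

∑-+ : ∀ (xs : List A) (f g : A → ℤ) → ∑ xs (λ x → f x ℤ.+ g x) ≡ ∑ xs f ℤ.+ ∑ xs g
∑-+ [] f g = refl
∑-+ (x ∷ xs) f g = trans (cong (λ t → (f x ℤ.+ g x) ℤ.+ t) (∑-+ xs f g)) (+-interchange (f x) (g x) (∑ xs f) (∑ xs g))

∑-swap : ∀ (xs : List A) (ys : List B) (f : A → B → ℤ) → ∑ xs (λ x → ∑ ys (f x)) ≡ ∑ ys (λ y → ∑ xs (λ x → f x y))
∑-swap [] ys f = sym (∑-zero ys (λ _ → refl))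
∑-swap (x ∷ xs) ys f = trans (cong (λ t → ∑ ys (f x) ℤ.+ t) (∑-swap xs ys f)) (sym (∑-+ ys (f x) _))

infix 0 _when_
_when_ : ℤ → Bool → ℤ
t when b = if b then t else + 0

when-zero : ∀ b {t} → t ≡ + 0 → (t when b) ≡ + 0
when-zero true e = e
when-zero false e = refl

<ℤ-true : x ℤ.< y → (x <ℤ y) ≡ true
<ℤ-true {x} {y} x<y with x ℤ.<? y
... | yes _ = refl
... | no x≮y = contradiction x<y x≮y

<ℤ-false : y ℤ.≤ x → (x <ℤ y) ≡ false
<ℤ-false {y} {x} y≤x with x ℤ.<? y
... | yes x<y = contradiction y≤x (ℤP.<⇒≱ x<y)
... | no _ = refl

≤ℤ-true : x ℤ.≤ y → (x ≤ℤ y) ≡ true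
≤ℤ-true {x} {y} x≤y with x ℤ.≤? y
... | yes _ = refl
... | no x≰y = contradiction x≤y x≰y

≤ℤ-false : y ℤ.< x → (x ≤ℤ y) ≡ false
≤ℤ-false {y} {x} y<x with x ℤ.≤? y
... | yes x≤y = contradiction x≤y (ℤP.<⇒≱ y<x)
... | no _ = refl

-- The part of the n-commuting condition that involves the first two columns,
-- for the filling with first row a b … and second row c d.
commuting : ℕ → ℤ → ℤ → ℤ → ℤ → Bool
commuting n a b c d = (a <ℤ b) ∧ (c <ℤ d) ∧ (b ≤ℤ d)
  ∧ ( ((c <ℤ a) ∧ ((d ℤ.- c) ≤ℤ (+ n)))
    ∨ ((a <ℤ c) ∧ ((b ≤ℤ c) ∨ ((c <ℤ b) ∧ ((+ n) <ℤ (d ℤ.- a))))))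

-- Group the terms by the set {x < y < z} of letters.  Only four of the six orders can have a
-- nonzero coefficient, and these cancel by the relations between the ribbon operators.
module TripleSum (n : ℕ) (L : List ℤ) (f : ℤ → ℤ → ℤ → ℤ)
  (f-aac : ∀ a c → f a a c ≡ + 0) (f-acc : ∀ a c → f a c c ≡ + 0) (f-ada : ∀ a d → f a d a ≡ + 0)
  (far₁ : ∀ {x y z} → x ℤ.< z ℤ.- + n → f x z y ≡ f z x y)
  (far₂ : ∀ {x y z} → x ℤ.< z ℤ.- + n → f y x z ≡ f y z x)
  (near₁ : ∀ {x y z} → x ℤ.< y → y ℤ.< z → z ℤ.- + n ℤ.≤ x → f x z y ≡ f y x z)
  (near₂ : ∀ {x y z} → x ℤ.< y → y ℤ.< z → z ℤ.- + n ℤ.≤ x → f y z x ≡ f z x y)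
  (b : ℤ) where

  private
    -- For a fixed prefix ending in `b` these are the summands of h_s h_2, of h_{s+1} h_1 and of the
    -- tableau sum; the claim is that the sum of `G` is zero.
    G₁ G₂ G₃ G : ℤ → ℤ → ℤ → ℤ
    G₁ a d c = f a d c when ((a <ℤ b) ∧ (c <ℤ d))
    G₂ a d c = f a d c when ((a <ℤ b) ∧ (d <ℤ a))
    G₃ a d c = f a d c when commuting n a b c d
    G a d c = G₁ a d c ℤ.- (G₂ a d c ℤ.+ G₃ a d c)

    J : ℤ → ℤ → ℤ → ℤ → ℤ
    J x y z t = t when ((x <ℤ y) ∧ (y <ℤ z))

    J-true : x ℤ.< y → y ℤ.< z → ∀ t → J x y z t ≡ t
    J-true x<y y<z t rewrite <ℤ-true x<y | <ℤ-true y<z = refl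

    J-false₁ : y ℤ.≤ x → ∀ t → J x y z t ≡ + 0
    J-false₁ y≤x t rewrite <ℤ-false y≤x = refl

    J-false₂ : ∀ x → z ℤ.≤ y → ∀ t → J x y z t ≡ + 0
    J-false₂ {z} {y} x z≤y t with x <ℤ y
    ... | false = refl
    ... | true rewrite <ℤ-false z≤y = refl

    four : ℤ → ℤ → ℤ → ℤ → ℤ
    four p q r s = ((p ℤ.+ q) ℤ.+ r) ℤ.+ s

    split-zero : ∀ a d c → G a d c ≡ + 0 →
      G a d c ≡ four (J a c d (G a d c)) (J d a c (G a d c)) (J c a d (G a d c)) (J d c a (G a d c))
    split-zero a d c e rewrite e
      | when-zero ((a <ℤ c) ∧ (c <ℤ d)) {+ 0} refl | when-zero ((d <ℤ a) ∧ (a <ℤ c)) {+ 0} refl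
      | when-zero ((c <ℤ a) ∧ (a <ℤ d)) {+ 0} refl | when-zero ((d <ℤ c) ∧ (c <ℤ a)) {+ 0} refl = refl

    vanish : ∀ a d c → f a d c ≡ + 0 → G a d c ≡ + 0
    vanish a d c e rewrite when-zero ((a <ℤ b) ∧ (c <ℤ d)) e | when-zero ((a <ℤ b) ∧ (d <ℤ a)) e
      | when-zero (commuting n a b c d) e = refl

    increasing : ∀ a d c → a ℤ.< d → d ℤ.< c → G a d c ≡ + 0
    increasing a d c a<d d<c with a <ℤ b
    ... | false = refl
    ... | true rewrite <ℤ-false (ℤP.<⇒≤ d<c) | <ℤ-false (ℤP.<⇒≤ a<d) = refl

    -- Both products contain a decreasing word, with opposite signs, and no tableau does: d < a < b
    -- contradicts b ≤ d.
    decreasing : ∀ a d c → d ℤ.< a → c ℤ.< d → G a d c ≡ + 0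
    decreasing a d c d<a c<d with a ℤ.<? b
    ... | no _ = refl
    ... | yes a<b rewrite <ℤ-true c<d | <ℤ-true d<a | ≤ℤ-false (ℤP.<-trans d<a a<b) =
      trans (cong (λ t → f a d c ℤ.- t) (ℤP.+-identityʳ _)) (ℤP.+-inverseʳ (f a d c))

    J₁ J₂ J₃ J₄ : ℤ → ℤ → ℤ → ℤ
    J₁ x y z = J x y z (G x z y)
    J₂ x y z = J x y z (G y x z)
    J₃ x y z = J x y z (G y z x)
    J₄ x y z = J x y z (G z x y)

    four-cong : ∀ {p q r s p′ q′ r′ s′} → p ≡ p′ → q ≡ q′ → r ≡ r′ → s ≡ s′ → four p q r s ≡ four p′ q′ r′ s′
    four-cong refl refl refl refl = refl

    -- At most one of the four terms is nonzero, the one that matches the order of the letters.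
    -- Repeated letters contribute nothing because there `f` vanishes.
    split : ∀ a d c → G a d c ≡ four (J₁ a c d) (J₂ d a c) (J₃ c a d) (J₄ d c a)
    split a d c with ℤP.<-cmp a d | ℤP.<-cmp d c | ℤP.<-cmp a c
    ... | tri≈ _ refl _ | _ | _ = split-zero a d c (vanish a d c (f-aac a c))
    ... | _ | tri≈ _ refl _ | _ = split-zero a d c (vanish a d c (f-acc a d))
    ... | _ | _ | tri≈ _ refl _ = split-zero a d c (vanish a d c (f-ada a d))
    ... | tri< a<d _ _ | tri< d<c _ _ | _ = split-zero a d c (increasing a d c a<d d<c)
    ... | tri> _ _ d<a | tri> _ _ c<d | _ = split-zero a d c (decreasing a d c d<a c<d)
    ... | tri< a<d _ _ | tri> _ _ c<d | tri< a<c _ _ = sym (trans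
          (four-cong (J-true a<c c<d _) (J-false₁ (ℤP.<⇒≤ a<d) _) (J-false₁ (ℤP.<⇒≤ a<c) _) (J-false₁ (ℤP.<⇒≤ c<d) _))
          (trans (ℤP.+-identityʳ _) (trans (ℤP.+-identityʳ _) (ℤP.+-identityʳ _))))
    ... | tri< a<d _ _ | tri> _ _ c<d | tri> _ _ c<a = sym (trans
          (four-cong (J-false₁ (ℤP.<⇒≤ c<a) _) (J-false₁ (ℤP.<⇒≤ a<d) _) (J-true c<a a<d _) (J-false₁ (ℤP.<⇒≤ c<d) _))
          (trans (ℤP.+-identityʳ _) (ℤP.+-identityˡ _)))
    ... | tri> _ _ d<a | tri< d<c _ _ | tri< a<c _ _ = sym (trans
          (four-cong (J-false₂ a (ℤP.<⇒≤ d<c) _) (J-true d<a a<c _) (J-false₁ (ℤP.<⇒≤ a<c) _) (J-false₂ d (ℤP.<⇒≤ a<c) _))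
          (trans (ℤP.+-identityʳ _) (trans (ℤP.+-identityʳ _) (ℤP.+-identityˡ _))))
    ... | tri> _ _ d<a | tri< d<c _ _ | tri> _ _ c<a = sym (trans
          (four-cong (J-false₁ (ℤP.<⇒≤ c<a) _) (J-false₂ d (ℤP.<⇒≤ c<a) _) (J-false₂ c (ℤP.<⇒≤ d<a) _) (J-true d<c c<a _))
          (ℤP.+-identityˡ _))

    difference-≤ : z ℤ.- + n ℤ.≤ x → z ℤ.- x ℤ.≤ + n
    difference-≤ {z} {x} h = subst₂ ℤ._≤_ (solve 3 (λ x z n → (z :- n) :+ (n :- x) := z :- x) refl x z (+ n))
      (solve 2 (λ x n → x :+ (n :- x) := n) refl x (+ n)) (ℤP.+-monoˡ-≤ (+ n ℤ.- x) h)
      where open +-*-Solver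

    difference-> : x ℤ.< z ℤ.- + n → + n ℤ.< z ℤ.- x
    difference-> {x} {z} h = subst₂ ℤ._<_ (solve 2 (λ x n → x :+ (n :- x) := n) refl x (+ n))
      (solve 3 (λ x z n → (z :- n) :+ (n :- x) := z :- x) refl x z (+ n)) (ℤP.+-monoˡ-< (+ n ℤ.- x) h)
      where open +-*-Solver

    cancel : ℤ → ℤ → ℤ → Set
    cancel x y z = four (G x z y) (G y x z) (G y z x) (G z x y) ≡ + 0

    cancel-b≤x : x ℤ.< y → y ℤ.< z → b ℤ.≤ x → cancel x y z
    cancel-b≤x x<y y<z b≤x rewrite <ℤ-false b≤x | <ℤ-false (ℤP.≤-trans b≤x (ℤP.<⇒≤ x<y))
      | <ℤ-false (ℤP.≤-trans b≤x (ℤP.<⇒≤ (ℤP.<-trans x<y y<z))) = refl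

    -- Only a = x passes a < b; the word x z y occurs in h_s h_2 and, since b ≤ c = y, also in the
    -- tableau sum.
    cancel-x<b≤y : x ℤ.< y → y ℤ.< z → x ℤ.< b → b ℤ.≤ y → cancel x y z
    cancel-x<b≤y {x} {y} {z} x<y y<z x<b b≤y rewrite <ℤ-true x<b | <ℤ-false b≤y
      | <ℤ-false (ℤP.≤-trans b≤y (ℤP.<⇒≤ y<z)) | ≤ℤ-true b≤y | ≤ℤ-true (ℤP.≤-trans b≤y (ℤP.<⇒≤ y<z))
      | <ℤ-true y<z | <ℤ-true x<y | <ℤ-false (ℤP.<⇒≤ x<y) | <ℤ-false (ℤP.<⇒≤ (ℤP.<-trans x<y y<z)) =
      solve 1 (λ p → (((p :- (con (+ 0) :+ p)) :+ con (+ 0)) :+ con (+ 0)) :+ con (+ 0) := con (+ 0)) refl (f x z y)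
      where open +-*-Solver

    -- The word y z x belongs to a tableau through z - x ≤ n and cancels. The words x z y and y x z
    -- remain, with opposite signs, and `near₁` equates them.
    cancel-near : x ℤ.< y → y ℤ.< z → y ℤ.< b → b ℤ.≤ z → z ℤ.- + n ℤ.≤ x → cancel x y z
    cancel-near {x} {y} {z} x<y y<z y<b b≤z near rewrite <ℤ-true (ℤP.<-trans x<y y<b) | <ℤ-true y<b | <ℤ-false b≤z
      | ≤ℤ-false y<b | ≤ℤ-true b≤z | <ℤ-true y<z | <ℤ-true x<y | <ℤ-true (ℤP.<-trans x<y y<z)
      | <ℤ-false (ℤP.<⇒≤ x<y) | <ℤ-false (ℤP.<⇒≤ y<z) | <ℤ-false (ℤP.<⇒≤ (ℤP.<-trans x<y y<z))
      | ≤ℤ-true (difference-≤ {z} {x} near) | <ℤ-false (difference-≤ {z} {x} near) | near₁ x<y y<z near =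
      solve 2 (λ p q → (((p :- con (+ 0)) :+ (con (+ 0) :- (p :+ con (+ 0)))) :+ (q :- (con (+ 0) :+ q))) :+ con (+ 0) := con (+ 0))
        refl (f y x z) (f y z x)
      where open +-*-Solver

    -- Now x z y belongs to a tableau through z - x > n and cancels. The words y z x and y x z
    -- remain, and `far₂` equates them.
    cancel-far : x ℤ.< y → y ℤ.< z → y ℤ.< b → b ℤ.≤ z → x ℤ.< z ℤ.- + n → cancel x y z
    cancel-far {x} {y} {z} x<y y<z y<b b≤z far rewrite <ℤ-true (ℤP.<-trans x<y y<b) | <ℤ-true y<b | <ℤ-false b≤z
      | ≤ℤ-false y<b | ≤ℤ-true b≤z | <ℤ-true y<z | <ℤ-true x<y | <ℤ-true (ℤP.<-trans x<y y<z)
      | <ℤ-false (ℤP.<⇒≤ x<y) | <ℤ-false (ℤP.<⇒≤ y<z) | <ℤ-false (ℤP.<⇒≤ (ℤP.<-trans x<y y<z))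
      | ≤ℤ-false (difference-> {x} {z} far) | <ℤ-true (difference-> {x} {z} far) | far₂ {x} {y} {z} far =
      solve 2 (λ p q → (((p :- (con (+ 0) :+ p)) :+ (con (+ 0) :- (q :+ con (+ 0)))) :+ (q :- con (+ 0))) :+ con (+ 0) := con (+ 0))
        refl (f x z y) (f y z x)
      where open +-*-Solver

    pairs : ∀ {p q r s} → (p ≡ q × r ≡ s) ⊎ (p ≡ s × q ≡ r) →
      four (p ℤ.- + 0) (+ 0 ℤ.- (q ℤ.+ + 0)) (r ℤ.- + 0) (+ 0 ℤ.- (s ℤ.+ + 0)) ≡ + 0
    pairs {p} {r = r} (inj₁ (refl , refl)) = solve 2
      (λ p r → (((p :- con (+ 0)) :+ (con (+ 0) :- (p :+ con (+ 0)))) :+ (r :- con (+ 0))) :+ (con (+ 0) :- (r :+ con (+ 0))) := con (+ 0)) refl p r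
      where open +-*-Solver
    pairs {p} {q} (inj₂ (refl , refl)) = solve 2
      (λ p q → (((p :- con (+ 0)) :+ (con (+ 0) :- (q :+ con (+ 0)))) :+ (q :- con (+ 0))) :+ (con (+ 0) :- (p :+ con (+ 0))) := con (+ 0)) refl p q
      where open +-*-Solver

    -- There is no tableau, as b ≤ d fails. The four words cancel in two pairs, and the pairing
    -- depends on whether x + n < z.
    cancel-z<b : x ℤ.< y → y ℤ.< z → z ℤ.< b → cancel x y z
    cancel-z<b {x} {y} {z} x<y y<z z<b rewrite <ℤ-true z<b | <ℤ-true (ℤP.<-trans y<z z<b) | <ℤ-true (ℤP.<-trans x<y (ℤP.<-trans y<z z<b))
      | ≤ℤ-false z<b | <ℤ-true y<z | <ℤ-true x<y | <ℤ-true (ℤP.<-trans x<y y<z)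
      | <ℤ-false (ℤP.<⇒≤ x<y) | <ℤ-false (ℤP.<⇒≤ y<z) | <ℤ-false (ℤP.<⇒≤ (ℤP.<-trans x<y y<z)) = pairs relation
      where
      relation : (f x z y ≡ f y x z × f y z x ≡ f z x y) ⊎ (f x z y ≡ f z x y × f y x z ≡ f y z x)
      relation with x ℤ.<? z ℤ.- + n
      ... | yes far = inj₂ (far₁ {x} {y} {z} far , far₂ {x} {y} {z} far)
      ... | no ¬far = inj₁ (near₁ x<y y<z (ℤP.≮⇒≥ ¬far) , near₂ x<y y<z (ℤP.≮⇒≥ ¬far))

    cancels : x ℤ.< y → y ℤ.< z → cancel x y z
    cancels {x} {y} {z} x<y y<z = decide (x ℤ.<? b) (y ℤ.<? b) (z ℤ.<? b) (x ℤ.<? z ℤ.- + n)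
      where
      decide : Dec (x ℤ.< b) → Dec (y ℤ.< b) → Dec (z ℤ.< b) → Dec (x ℤ.< z ℤ.- + n) → cancel x y z
      decide (no x≮b) _ _ _ = cancel-b≤x x<y y<z (ℤP.≮⇒≥ x≮b)
      decide (yes x<b) (no y≮b) _ _ = cancel-x<b≤y x<y y<z x<b (ℤP.≮⇒≥ y≮b)
      decide _ (yes y<b) (no z≮b) (yes far) = cancel-far x<y y<z y<b (ℤP.≮⇒≥ z≮b) far
      decide _ (yes y<b) (no z≮b) (no ¬far) = cancel-near x<y y<z y<b (ℤP.≮⇒≥ z≮b) (ℤP.≮⇒≥ ¬far)
      decide _ _ (yes z<b) _ = cancel-z<b x<y y<z z<b

    J-cancels : ∀ x y z → four (J₁ x y z) (J₂ x y z) (J₃ x y z) (J₄ x y z) ≡ + 0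
    J-cancels x y z = decide (x ℤ.<? y) (y ℤ.<? z)
      where
      decide : Dec (x ℤ.< y) → Dec (y ℤ.< z) → four (J₁ x y z) (J₂ x y z) (J₃ x y z) (J₄ x y z) ≡ + 0
      decide (yes x<y) (yes y<z) = trans
        (four-cong (J-true x<y y<z _) (J-true x<y y<z _) (J-true x<y y<z _) (J-true x<y y<z _)) (cancels x<y y<z)
      decide (no x≮y) _ = four-cong (J-false₁ y≤x _) (J-false₁ y≤x _) (J-false₁ y≤x _) (J-false₁ y≤x _)
        where
        y≤x : y ℤ.≤ x
        y≤x = ℤP.≮⇒≥ x≮y
      decide (yes _) (no y≮z) = four-cong (J-false₂ x z≤y _) (J-false₂ x z≤y _) (J-false₂ x z≤y _) (J-false₂ x z≤y _)
        where
        z≤y : z ℤ.≤ y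
        z≤y = ℤP.≮⇒≥ y≮z

  ∑³ : (ℤ → ℤ → ℤ → ℤ) → ℤ
  ∑³ g = ∑ L λ x → ∑ L λ y → ∑ L λ z → g x y z

  private
    ∑³-cong : ∀ {g h} → (∀ x y z → g x y z ≡ h x y z) → ∑³ g ≡ ∑³ h
    ∑³-cong e = ∑-cong L λ x → ∑-cong L λ y → ∑-cong L λ z → e x y z

    ∑³-+ : ∀ g h → ∑³ (λ x y z → g x y z ℤ.+ h x y z) ≡ ∑³ g ℤ.+ ∑³ h
    ∑³-+ g h = trans (∑-cong L λ x → trans (∑-cong L λ y → ∑-+ L (g x y) (h x y)) (∑-+ L _ _)) (∑-+ L _ _)

    ∑³-four : ∀ g h k l → ∑³ (λ x y z → four (g x y z) (h x y z) (k x y z) (l x y z)) ≡ four (∑³ g) (∑³ h) (∑³ k) (∑³ l)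
    ∑³-four g h k l = trans (∑³-+ _ l) (cong (λ t → t ℤ.+ ∑³ l) (trans (∑³-+ _ k) (cong (λ t → t ℤ.+ ∑³ k) (∑³-+ g h))))

    swap₁₂ : ∀ g → ∑³ (λ x y z → g y x z) ≡ ∑³ g
    swap₁₂ g = ∑-swap L L (λ x y → ∑ L (λ z → g y x z))

    swap₂₃ : ∀ g → ∑³ (λ x y z → g x z y) ≡ ∑³ g
    swap₂₃ g = ∑-cong L λ x → ∑-swap L L (λ y z → g x z y)

    ∑³G≡0 : ∑³ G ≡ + 0
    ∑³G≡0 = begin
      ∑³ G
        ≡⟨ ∑³-cong split ⟩
      ∑³ (λ a d c → four (J₁ a c d) (J₂ d a c) (J₃ c a d) (J₄ d c a))
        ≡⟨ ∑³-four _ _ _ _ ⟩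
      four (∑³ λ a d c → J₁ a c d) (∑³ λ a d c → J₂ d a c) (∑³ λ a d c → J₃ c a d) (∑³ λ a d c → J₄ d c a)
        -- The sum over all triples of letters is symmetric, so each of the four orders can be
        -- relabelled to x, y, z.
        ≡⟨ four-cong (swap₂₃ J₁) (swap₁₂ J₂)
             (trans (swap₂₃ (λ a c d → J₃ c a d)) (swap₁₂ J₃))
             (trans (swap₁₂ (λ d a c → J₄ d c a)) (swap₂₃ J₄)) ⟩
      four (∑³ J₁) (∑³ J₂) (∑³ J₃) (∑³ J₄)
        ≡⟨ sym (∑³-four J₁ J₂ J₃ J₄) ⟩
      ∑³ (λ x y z → four (J₁ x y z) (J₂ x y z) (J₃ x y z) (J₄ x y z))
        ≡⟨ ∑-zero L (λ x → ∑-zero L (λ y → ∑-zero L (J-cancels x y))) ⟩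
      + 0 ∎
      where open ≡-Reasoning

  triple-sum : ∑³ (λ a d c → f a d c when ((a <ℤ b) ∧ (c <ℤ d))) ≡
    ∑³ (λ a d c → f a d c when ((a <ℤ b) ∧ (d <ℤ a))) ℤ.+ ∑³ (λ a d c → f a d c when commuting n a b c d)
  triple-sum = begin
    ∑³ G₁                                            ≡⟨ ∑³-cong (λ a d c → recover (G₁ a d c) (G₂ a d c ℤ.+ G₃ a d c)) ⟩
    ∑³ (λ a d c → G a d c ℤ.+ (G₂ a d c ℤ.+ G₃ a d c)) ≡⟨ trans (∑³-+ G _) (cong (λ t → t ℤ.+ ∑³ (λ a d c → G₂ a d c ℤ.+ G₃ a d c)) ∑³G≡0) ⟩
    + 0 ℤ.+ ∑³ (λ a d c → G₂ a d c ℤ.+ G₃ a d c)       ≡⟨ trans (ℤP.+-identityˡ _) (∑³-+ G₂ G₃) ⟩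
    ∑³ G₂ ℤ.+ ∑³ G₃                                  ∎
    where
    open ≡-Reasoning
    open +-*-Solver
    recover : ∀ p q → p ≡ (p ℤ.- q) ℤ.+ q
    recover = solve 2 (λ p q → p := (p :- q) :+ q) refl

-- Sums over words in a finite alphabet

∑-↭ : ∀ {xs ys : List A} (f : A → ℤ) → xs ↭ ys → ∑ xs f ≡ ∑ ys f
∑-↭ f Perm.refl = refl
∑-↭ f (Perm.prep x p) = cong (λ t → f x ℤ.+ t) (∑-↭ f p)
∑-↭ f (Perm.swap x y p) = trans (cong (λ t → f x ℤ.+ (f y ℤ.+ t)) (∑-↭ f p)) (exchange (f x) (f y) _)
  where
  open +-*-Solver
  exchange : ∀ a b t → a ℤ.+ (b ℤ.+ t) ≡ b ℤ.+ (a ℤ.+ t)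
  exchange = solve 3 (λ a b t → a :+ (b :+ t) := b :+ (a :+ t)) refl
∑-↭ f (Perm.trans p q) = trans (∑-↭ f p) (∑-↭ f q)

∑-filter : ∀ (f : A → ℤ) xs → ∑ (filter (λ x → ¬? (f x ℤ.≟ + 0)) xs) f ≡ ∑ xs f
∑-filter f [] = refl
∑-filter f (x ∷ xs) with f x ℤ.≟ + 0
... | yes e = trans (∑-filter f xs) (sym (trans (cong (λ t → t ℤ.+ ∑ xs f) e) (ℤP.+-identityˡ _)))
... | no _ = cong (λ t → f x ℤ.+ t) (∑-filter f xs)

-- This trades `candidates`, which depend on the vector acted on, for all words over a fixed
-- alphabet.
∑-support : ∀ {xs ys : List A} (f : A → ℤ) → Unique xs → Unique ys →
  (∀ {x} → x ∈ xs → f x ≢ + 0 → x ∈ ys) → (∀ {x} → x ∈ ys → f x ≢ + 0 → x ∈ xs) → ∑ xs f ≡ ∑ ys f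
∑-support {xs = xs} {ys} f uxs uys fwd bwd = trans (sym (∑-filter f xs)) (trans
  (∑-↭ f (∼bag⇒↭ (unique∧set⇒bag (UniqueP.filter⁺ nz uxs) (UniqueP.filter⁺ nz uys) (mk⇔ (restrict fwd) (restrict bwd)))))
  (∑-filter f ys))
  where
  nz = λ x → ¬? (f x ℤ.≟ + 0)
  restrict : ∀ {xs ys} → (∀ {x} → x ∈ xs → f x ≢ + 0 → x ∈ ys) → ∀ {x} → x ∈ filter nz xs → x ∈ filter nz ys
  restrict sub x∈ with ∈-filter⁻ nz x∈
  ... | x∈xs , fx≢0 = ∈-filter⁺ nz (sub x∈xs fx≢0) fx≢0

∑-++ : ∀ (xs ys : List A) (f : A → ℤ) → ∑ (xs ++ ys) f ≡ ∑ xs f ℤ.+ ∑ ys f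
∑-++ [] ys f = sym (ℤP.+-identityˡ _)
∑-++ (x ∷ xs) ys f = trans (cong (λ t → f x ℤ.+ t) (∑-++ xs ys f)) (sym (ℤP.+-assoc (f x) _ _))

∑-map : ∀ (g : A → B) xs (f : B → ℤ) → ∑ (map g xs) f ≡ ∑ xs (f ∘ g)
∑-map g [] f = refl
∑-map g (x ∷ xs) f = cong (λ t → f (g x) ℤ.+ t) (∑-map g xs f)

∑-concatMap : ∀ (g : A → List B) xs (f : B → ℤ) → ∑ (concatMap g xs) f ≡ ∑ xs (λ x → ∑ (g x) f)
∑-concatMap g [] f = refl
∑-concatMap g (x ∷ xs) f = trans (∑-++ (g x) _ f) (cong (λ t → ∑ (g x) f ℤ.+ t) (∑-concatMap g xs f))

words : ℕ → List A → List (List A)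
words zero xs = [] ∷ []
words (suc k) xs = concatMap (λ x → map (x ∷_) (words k xs)) xs

∑-words-suc : ∀ k (xs : List A) f → ∑ (words (suc k) xs) f ≡ ∑ xs (λ x → ∑ (words k xs) (f ∘ (x ∷_)))
∑-words-suc k xs f = trans (∑-concatMap _ xs f) (∑-cong xs (λ x → ∑-map (x ∷_) (words k xs) f))

∑-words-+ : ∀ j k (xs : List A) f → ∑ (words (j ℕ.+ k) xs) f ≡ ∑ (words j xs) (λ v → ∑ (words k xs) (λ w → f (v ++ w)))
∑-words-+ zero k xs f = sym (ℤP.+-identityʳ _)
∑-words-+ (suc j) k xs f = trans (∑-words-suc (j ℕ.+ k) xs f) (trans
  (∑-cong xs (λ x → ∑-words-+ j k xs (f ∘ (x ∷_))))
  (sym (∑-words-suc j xs _)))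

words-unique : ∀ k {xs : List A} → Unique xs → Unique (words k xs)
words-unique zero u = [] ∷ []
words-unique {A = A} (suc k) {xs} u = UniqueP.concat⁺
  (AllP.map⁺ {f = block} (All.universal (λ x → UniqueP.map⁺ ∷-injectiveʳ (words-unique k u)) xs))
  (AllPairsP.map⁺ (AllPairs.map disjoint u))
  where
  block : A → List (List A)
  block x = map (x ∷_) (words k xs)
  disjoint : ∀ {x y} → x ≢ y → ∀ {w} → ¬ (w ∈ block x × w ∈ block y)
  disjoint x≢y (w∈ , w∈′) with ∈-map⁻ _ w∈ | ∈-map⁻ _ w∈′
  ... | _ , _ , refl | _ , _ , refl = x≢y refl

∈-words⁺ : ∀ {xs w : List A} → All (_∈ xs) w → w ∈ words (length w) xs
∈-words⁺ [] = here refl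
∈-words⁺ {xs = xs} {x ∷ w} (x∈ ∷ w∈) = ∈-concatMap⁺ (λ x → map (x ∷_) (words (length w) xs)) (lose x∈ (∈-map⁺ (x ∷_) (∈-words⁺ w∈)))

∈-words-length : ∀ k {xs w : List A} → w ∈ words k xs → length w ≡ k
∈-words-length zero (here refl) = refl
∈-words-length (suc k) {xs} w∈ with find (∈-concatMap⁻ (λ x → map (x ∷_) (words k xs)) {xs = xs} w∈)
... | x , _ , q with ∈-map⁻ (x ∷_) q
...   | w′ , w′∈ , refl = cong suc (∈-words-length k w′∈)

-- Coefficients of formal sums and candidate words

module Coefficient (mu : List ℕ) (e : ℕ) where

  coeff-++ : ∀ v w → coeff (v ++ w) mu e ≡ coeff v mu e ℤ.+ coeff w mu e
  coeff-++ [] w = sym (ℤP.+-identityˡ _)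
  coeff-++ ((c , e′ , p) ∷ v) w = trans (cong (λ t → τ ℤ.+ t) (coeff-++ v w)) (sym (ℤP.+-assoc τ (coeff v mu e) (coeff w mu e)))
    where
    τ : ℤ
    τ = c when (⌊ ≡-dec ℕ._≟_ p mu ⌋ ∧ (e′ == e))

  coeff-concatMap : ∀ (F : A → FSum) xs → coeff (concatMap F xs) mu e ≡ ∑ xs (λ x → coeff (F x) mu e)
  coeff-concatMap F [] = refl
  coeff-concatMap F (x ∷ xs) = trans (coeff-++ (F x) _) (cong (λ t → coeff (F x) mu e ℤ.+ t) (coeff-concatMap F xs))

  coeff-when : ∀ b v → coeff (if b then v else []) mu e ≡ (coeff v mu e when b)
  coeff-when true v = refl
  coeff-when false v = refl

  coeff-negate : ∀ v → coeff (scale (-[1+ 0 ]) 0 v) mu e ≡ ℤ.- coeff v mu e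
  coeff-negate [] = refl
  coeff-negate ((c , e′ , p) ∷ v) = trans (cong₂ ℤ._+_ (negate-if (⌊ ≡-dec ℕ._≟_ p mu ⌋ ∧ (e′ == e)) c) (coeff-negate v))
    (sym (ℤP.neg-distrib-+ (c when (⌊ ≡-dec ℕ._≟_ p mu ⌋ ∧ (e′ == e))) (coeff v mu e)))
    where
    negate-if : ∀ b c → ((-[1+ 0 ] ℤ.* c) when b) ≡ ℤ.- (c when b)
    negate-if true c = ℤP.-1*i≡-i c
    negate-if false c = refl

scale-injective : ∀ e {v w} → scale (+ 1) e v ≡ scale (+ 1) e w → v ≡ w
scale-injective e = map-injective λ { {c , f , p} {c′ , f′ , p′} eq → cong₂ _,_
  (trans (sym (ℤP.*-identityˡ c)) (trans (cong proj₁ eq) (ℤP.*-identityˡ c′)))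
  (cong₂ _,_ (ℕP.+-cancelˡ-≡ e f f′ (cong (proj₁ ∘ proj₂) eq)) (cong (proj₂ ∘ proj₂) eq)) }

runs-length : ∀ n k la {v} → v ∈ runs n k la → length v ≡ k
runs-length n zero la (here refl) = refl
runs-length n (suc k) la v∈ with find (∈-concatMap⁻ _ {xs = steps n la} v∈)
... | (i , _ , mu) , _ , q with ∈-map⁻ (i ∷_) q
...   | v′ , v′∈ , refl = cong suc (runs-length n k mu v′∈)

candidates-length : ∀ n k la {w} → w ∈ candidates n k la → length w ≡ k
candidates-length n k la w∈ with ∈-map⁻ reverse (∈-deduplicate⁻ (≡-dec ℤ._≟_) (map reverse (runs n k la)) w∈)
... | v , v∈ , refl = trans (length-reverse v) (runs-length n k la v∈)

candidates-unique : ∀ n k la → Unique (candidates n k la)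
candidates-unique n k la = DecUnique.deduplicate-! (≡-dec ℤ._≟_) (map reverse (runs n k la))

u⇒steps : ∀ n i la {s mu} → u n i la ≡ term s mu → (i , s , mu) ∈ steps n la
u⇒steps n i la {s} {mu} e with ∈-map⁻ _ (subst ((+ 1 , s , mu) ∈_) (sym e) (here refl))
... | (j , _) , t∈ , refl with ∈-filter⁻ (λ t → T? ⌊ proj₁ t ℤ.≟ i ⌋) {xs = steps n la} t∈
...   | t∈′ , j≡i = subst (λ j → (j , s , mu) ∈ steps n la) (toWitness {a? = j ℤ.≟ i} j≡i) t∈′

-- The operators `U` and words in them

module Operators (n : ℕ) (1≤n : 1 ℕ.≤ n) where

  opaque
    U : ℤ → FSum → FSum
    U i = applyOp (u n i)

    U-def : ∀ i v → U i v ≡ applyOp (u n i) v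
    U-def i v = refl

  U-[] : ∀ i → U i [] ≡ []
  U-[] i = U-def i []

  U-scale : ∀ i c e v → U i (scale c e v) ≡ scale c e (U i v)
  U-scale i c e v = trans (U-def i _) (trans (applyOp-scale (u n i) c e v) (cong (scale c e) (sym (U-def i v))))

  U-ribbon : IsPartition la → IsPartition mu → Ribbon n i la mu →
    ∀ e → U i (term e la) ≡ term (e ℕ.+ spin la mu) mu
  U-ribbon p q rib e = trans (U-def _ _) (cong (λ v → scale (+ 1) e v ++ []) (u-addable p 1≤n q rib))

  U-stuck : IsPartition la → ¬ Addable n i la → ∀ e → U i (term e la) ≡ []
  U-stuck p ¬a e = trans (U-def _ _) (cong (λ v → scale (+ 1) e v ++ []) (u-not-addable p 1≤n ¬a))

  open Relations n 1≤n U U-[] U-ribbon U-stuck public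

  run : List ℤ → FSum → FSum
  run [] v = v
  run (i ∷ w) v = U i (run w v)

  run-++ : ∀ w₁ w₂ v → run (w₁ ++ w₂) v ≡ run w₁ (run w₂ v)
  run-++ [] w₂ v = refl
  run-++ (i ∷ w₁) w₂ v = cong (U i) (run-++ w₁ w₂ v)

  run-[] : ∀ w → run w [] ≡ []
  run-[] [] = refl
  run-[] (i ∷ w) = trans (cong (U i) (run-[] w)) (U-[] i)

  run-scale : ∀ w c e v → run w (scale c e v) ≡ scale c e (run w v)
  run-scale [] c e v = refl
  run-scale (i ∷ w) c e v = trans (cong (U i) (run-scale w c e v)) (U-scale i c e (run w v))

  uWord-run : ∀ w la → uWord n w la ≡ run w (term 0 la)
  uWord-run [] la = refl
  uWord-run (i ∷ w) la = trans (sym (U-def i _)) (cong (U i) (uWord-run w la))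

  run-term : ∀ w e mu → run w (term e mu) ≡ scale (+ 1) e (uWord n w mu)
  run-term w e mu = trans (cong (λ e → run w (term e mu)) (sym (ℕP.+-identityʳ e)))
    (trans (run-scale w (+ 1) e (term 0 mu)) (cong (scale (+ 1) e) (sym (uWord-run w mu))))

  monomial-run : ∀ w {v} → Monomial v → Monomial (run w v)
  monomial-run [] m = m
  monomial-run (i ∷ w) m = monomial-U i (monomial-run w m)

  steps-complete : IsPartition la → IsPartition mu → Ribbon n i la mu → (i , spin la mu , mu) ∈ steps n la
  steps-complete {la} {mu} {i} p q rib = u⇒steps n i la (u-addable p 1≤n q rib)

  -- A run lists letters in the order of application, hence the reversal. If the word acts
  -- nontrivially, its first applied letter is an actual step, and the rest acts nontrivially on the
  -- partition reached, up to a power of q.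
  runs-complete : IsPartition la → ∀ v → run (reverse v) (term 0 la) ≢ [] → v ∈ runs n (length v) la
  runs-complete p [] _ = here refl
  runs-complete {la} p (i ∷ v) nonzero = first (add p i 0) refl
    where
    split : run (reverse (i ∷ v)) (term 0 la) ≡ run (reverse v) (U i (term 0 la))
    split = trans (cong (λ w → run w (term 0 la)) (unfold-reverse i v)) (run-++ (reverse v) (i ∷ []) (term 0 la))
    first : ∀ {v′} → Added i 0 la v′ → v′ ≡ U i (term 0 la) → i ∷ v ∈ runs n (suc (length v)) la
    first (stuck _) e = contradiction (trans split (trans (cong (run (reverse v)) (sym e)) (run-[] (reverse v)))) nonzero
    first (added {mu} q rib) e = ∈-concatMap⁺ _ (lose (steps-complete p q rib) (∈-map⁺ (i ∷_) (runs-complete q v λ zero →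
      nonzero (trans split (trans (cong (run (reverse v)) (sym e)) (trans (run-term (reverse v) (spin la mu) mu)
        (cong (scale (+ 1) (spin la mu)) (trans (uWord-run (reverse v) mu) zero))))))))

  candidates-complete : IsPartition la → ∀ w → uWord n w la ≢ [] → w ∈ candidates n (length w) la
  candidates-complete {la} p w nonzero = subst₂ (λ w k → w ∈ candidates n k la) (reverse-involutive w) (length-reverse w)
    (∈-deduplicate⁺ (≡-dec ℤ._≟_) (∈-map⁺ reverse (runs-complete p (reverse w) λ zero →
      nonzero (trans (uWord-run w la) (trans (cong (λ w → run w (term 0 la)) (sym (reverse-involutive w))) zero)))))

  far-relation₁ : x ℤ.< z ℤ.- + n → ∀ {v} → Monomial v → U x (U z v) ≡ U z (U x v)
  far-relation₁ far m = sym (commute-far far m)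

  private
    -- Strictness of x < y < z keeps both inner distances below n even when z = x + n.
    sandwiched : x ℤ.< y → y ℤ.< z → z ℤ.- + n ℤ.≤ x → y ℤ.- + n ℤ.< x × z ℤ.- + n ℤ.< y
    sandwiched x<y y<z near = ℤP.<-≤-trans (ℤP.+-monoˡ-< (ℤ.- (+ n)) y<z) near , ℤP.≤-<-trans near x<y

  -- u_x u_z and u_z u_x commute with u_y, since the two powers of q cancel.
  near-relation₁ : x ℤ.< y → y ℤ.< z → z ℤ.- + n ℤ.≤ x → ∀ {v} → Monomial v → U x (U z (U y v)) ≡ U y (U x (U z v))
  near-relation₁ {x} {y} {z} x<y y<z near {v} m = begin
    U x (U z (U y v))                    ≡⟨ cong (U x) (commute-near y<z (proj₂ (sandwiched x<y y<z near)) m) ⟩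
    U x (scale (+ 1) 2 (U y (U z v)))    ≡⟨ U-scale x (+ 1) 2 _ ⟩
    scale (+ 1) 2 (U x (U y (U z v)))    ≡⟨ sym (commute-near x<y (proj₁ (sandwiched x<y y<z near)) (monomial-U z m)) ⟩
    U y (U x (U z v))                    ∎
    where open ≡-Reasoning

  -- Here both sides reduce to the same word only after multiplication by q², which
  -- `scale-injective` then removes.
  near-relation₂ : x ℤ.< y → y ℤ.< z → z ℤ.- + n ℤ.≤ x → ∀ {v} → Monomial v → U y (U z (U x v)) ≡ U z (U x (U y v))
  near-relation₂ {x} {y} {z} x<y y<z near {v} m = scale-injective 2 (begin
    scale (+ 1) 2 (U y (U z (U x v)))    ≡⟨ sym (commute-near y<z (proj₂ (sandwiched x<y y<z near)) (monomial-U x m)) ⟩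
    U z (U y (U x v))                    ≡⟨ cong (U z) (commute-near x<y (proj₁ (sandwiched x<y y<z near)) m) ⟩
    U z (scale (+ 1) 2 (U x (U y v)))    ≡⟨ U-scale z (+ 1) 2 _ ⟩
    scale (+ 1) 2 (U z (U x (U y v)))    ∎)
    where open ≡-Reasoning

-- Monotone words and reading words of fillings

-- The letter `b` is kept in both pieces, so no comparison is lost at the cut. The left piece
-- becomes the factor common to all three sums.
strictlyDecreasing-++ : ∀ v b w → strictlyDecreasingᵇ (v ++ b ∷ w) ≡ strictlyDecreasingᵇ (v ++ b ∷ []) ∧ strictlyDecreasingᵇ (b ∷ w)
strictlyDecreasing-++ [] b w = refl
strictlyDecreasing-++ (x ∷ []) b w = cong (_∧ strictlyDecreasingᵇ (b ∷ w)) (sym (∧-identityʳ (b <ℤ x)))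
strictlyDecreasing-++ (x ∷ y ∷ v) b w = trans (cong ((y <ℤ x) ∧_) (strictlyDecreasing-++ (y ∷ v) b w))
  (sym (∧-assoc (y <ℤ x) (strictlyDecreasingᵇ (y ∷ v ++ b ∷ [])) _))

strictlyIncreasing-++ : ∀ v b w → strictlyIncreasingᵇ (v ++ b ∷ w) ≡ strictlyIncreasingᵇ (v ++ b ∷ []) ∧ strictlyIncreasingᵇ (b ∷ w)
strictlyIncreasing-++ [] b w = refl
strictlyIncreasing-++ (x ∷ []) b w = cong (_∧ strictlyIncreasingᵇ (b ∷ w)) (sym (∧-identityʳ (x <ℤ b)))
strictlyIncreasing-++ (x ∷ y ∷ v) b w = trans (cong ((x <ℤ y) ∧_) (strictlyIncreasing-++ (y ∷ v) b w))
  (sym (∧-assoc (x <ℤ y) (strictlyIncreasingᵇ (y ∷ v ++ b ∷ [])) _))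

strictlyIncreasing-reverse : ∀ w → strictlyIncreasingᵇ (reverse w) ≡ strictlyDecreasingᵇ w
strictlyIncreasing-reverse [] = refl
strictlyIncreasing-reverse (x ∷ []) = refl
strictlyIncreasing-reverse (x ∷ y ∷ w) = begin
  strictlyIncreasingᵇ (reverse (x ∷ y ∷ w))
    ≡⟨ cong strictlyIncreasingᵇ (trans (unfold-reverse x (y ∷ w)) (trans (cong (_++ x ∷ []) (unfold-reverse y w)) (++-assoc (reverse w) (y ∷ []) (x ∷ [])))) ⟩
  strictlyIncreasingᵇ (reverse w ++ y ∷ x ∷ [])
    ≡⟨ strictlyIncreasing-++ (reverse w) y (x ∷ []) ⟩
  strictlyIncreasingᵇ (reverse w ++ y ∷ []) ∧ ((y <ℤ x) ∧ true)
    ≡⟨ cong₂ _∧_ (trans (cong strictlyIncreasingᵇ (sym (unfold-reverse y w))) (strictlyIncreasing-reverse (y ∷ w))) (∧-identityʳ (y <ℤ x)) ⟩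
  strictlyDecreasingᵇ (y ∷ w) ∧ (y <ℤ x)
    ≡⟨ ∧-comm (strictlyDecreasingᵇ (y ∷ w)) (y <ℤ x) ⟩
  strictlyDecreasingᵇ (x ∷ y ∷ w) ∎
  where open ≡-Reasoning

toVec?-just : ∀ m l → length l ≡ m → ∃[ r ] toVec? m l ≡ just r × toList r ≡ l
toVec?-just zero [] e = []ᵥ , refl , refl
toVec?-just (suc m) (x ∷ l) e with toVec? m l | toVec?-just m l (ℕP.suc-injective e)
... | just r | .r , refl , refl = x ∷ᵥ r , refl , refl

fillings-just : ∀ s w {r₁ r₂} → toVec? s (reverse (proj₁ (splitAt s w))) ≡ just r₁ →
  toVec? 2 (reverse (proj₂ (splitAt s w))) ≡ just r₂ → fillingsWithReading s w ≡ filling r₁ r₂ ∷ []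
fillings-just s w e₁ e₂ rewrite e₁ | e₂ = refl

splitAt-++ : ∀ s (v w : List A) → length v ≡ s → splitAt s (v ++ w) ≡ (v , w)
splitAt-++ .0 [] w refl = refl
splitAt-++ ._ (x ∷ v) w refl rewrite splitAt-++ (length v) v w refl = refl

-- The word is read backwards row by row, so the first row is a, b followed by the reversal of `v`
-- and the second is c, d. A decreasing `v b` then expresses that the first row increases from b on.
commutingFilling : ∀ s v a b c d → length v ≡ s → ∃[ T ]
  fillingsWithReading (2 ℕ.+ s) (v ++ b ∷ a ∷ d ∷ c ∷ []) ≡ T ∷ [] ×
  reading T ≡ v ++ b ∷ a ∷ d ∷ c ∷ [] ×
  (∀ n → nCommutingᵇ n T ≡ strictlyDecreasingᵇ (v ++ b ∷ []) ∧ commuting n a b c d)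
commutingFilling s v a b c d len with toVec?-just (2 ℕ.+ s) (a ∷ b ∷ reverse v) (cong (suc ∘ suc) (trans (length-reverse v) len))
... | x ∷ᵥ y ∷ᵥ r , just-r , list-r with ∷-injectiveˡ list-r | ∷-injectiveˡ (∷-injectiveʳ list-r) | ∷-injectiveʳ (∷-injectiveʳ list-r)
...   | refl | refl | r≡ = filled , fillings-just (2 ℕ.+ s) word
          (trans (cong (toVec? (2 ℕ.+ s)) (trans (cong (reverse ∘ proj₁) split) row₁)) just-r)
          (cong (toVec? 2 ∘ reverse ∘ proj₂) split) ,
          reading≡ , commuting≡
  where
  filled : Filling (2 ℕ.+ s)
  filled = filling (a ∷ᵥ b ∷ᵥ r) (c ∷ᵥ d ∷ᵥ []ᵥ)
  word : List ℤ
  word = v ++ b ∷ a ∷ d ∷ c ∷ []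
  row₁ : reverse (v ++ b ∷ a ∷ []) ≡ a ∷ b ∷ reverse v
  row₁ = reverse-++ v (b ∷ a ∷ [])
  word≡ : word ≡ (v ++ b ∷ a ∷ []) ++ d ∷ c ∷ []
  word≡ = sym (++-assoc v (b ∷ a ∷ []) (d ∷ c ∷ []))
  split : splitAt (2 ℕ.+ s) word ≡ (v ++ b ∷ a ∷ [] , d ∷ c ∷ [])
  split = trans (cong (splitAt (2 ℕ.+ s)) word≡) (splitAt-++ (2 ℕ.+ s) (v ++ b ∷ a ∷ []) (d ∷ c ∷ [])
    (trans (length-++ v) (trans (ℕP.+-comm (length v) 2) (cong (2 ℕ.+_) len))))
  reading≡ : reading filled ≡ word
  reading≡ = trans (cong (λ l → reverse (a ∷ b ∷ l) ++ d ∷ c ∷ []) r≡)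
    (trans (cong (_++ d ∷ c ∷ []) (trans (cong reverse (sym row₁)) (reverse-involutive (v ++ b ∷ a ∷ [])))) (sym word≡))
  commuting≡ : ∀ n → nCommutingᵇ n filled ≡ strictlyDecreasingᵇ (v ++ b ∷ []) ∧ commuting n a b c d
  commuting≡ n = trans (cong (λ q → ((a <ℤ b) ∧ q) ∧ rest) tail≡)
    (trans (cong (_∧ rest) (∧-comm (a <ℤ b) (strictlyDecreasingᵇ (v ++ b ∷ []))))
      (∧-assoc (strictlyDecreasingᵇ (v ++ b ∷ [])) (a <ℤ b) rest))
    where
    rest : Bool
    rest = (c <ℤ d) ∧ (b ≤ℤ d)
      ∧ ( ((c <ℤ a) ∧ ((d ℤ.- c) ≤ℤ (+ n)))
        ∨ ((a <ℤ c) ∧ ((b ≤ℤ c) ∨ ((c <ℤ b) ∧ ((+ n) <ℤ (d ℤ.- a))))))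
    tail≡ : strictlyIncreasingᵇ (b ∷ toList r) ≡ strictlyDecreasingᵇ (v ++ b ∷ [])
    tail≡ = trans (cong (λ l → strictlyIncreasingᵇ (b ∷ l)) r≡)
      (trans (cong strictlyIncreasingᵇ (sym (reverse-++ v (b ∷ [])))) (strictlyIncreasing-reverse (v ++ b ∷ [])))

-- Comparison of coefficients on both sides

∑-cong-∈ : ∀ (xs : List A) {f g : A → ℤ} → (∀ {x} → x ∈ xs → f x ≡ g x) → ∑ xs f ≡ ∑ xs g
∑-cong-∈ [] e = refl
∑-cong-∈ (x ∷ xs) e = cong₂ ℤ._+_ (e (here refl)) (∑-cong-∈ xs (e ∘ there))

∑-when : ∀ (xs : List A) (f : A → ℤ) b → ∑ xs (λ x → f x when b) ≡ (∑ xs f when b)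
∑-when xs f true = refl
∑-when xs f false = ∑-zero xs (λ _ → refl)

when-∧ : ∀ p q {t} → ((t when q) when p) ≡ (t when (p ∧ q))
when-∧ true q = refl
when-∧ false q = refl

when-nonzero : ∀ b {t} → (t when b) ≢ + 0 → t ≢ + 0
when-nonzero b h refl = h (when-zero b refl)

applyOp-concatMap : ∀ Op (F : A → FSum) xs → applyOp Op (concatMap F xs) ≡ concatMap (applyOp Op ∘ F) xs
applyOp-concatMap Op F [] = refl
applyOp-concatMap Op F (x ∷ xs) = trans (concatMap-++ _ (F x) (concatMap F xs)) (cong (applyOp Op (F x) ++_) (applyOp-concatMap Op F xs))

decompose : ∀ j {k} (w : List A) → length w ≡ j ℕ.+ k → ∃[ v ] ∃[ v′ ] w ≡ v ++ v′ × length v ≡ j × length v′ ≡ k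
decompose zero w e = [] , w , refl , refl , e
decompose (suc j) (x ∷ w) e with decompose j w (ℕP.suc-injective e)
... | v , v′ , refl , l , l′ = x ∷ v , v′ , refl , cong suc l , l′

when-+ : ∀ b {t t′} → (t ℤ.+ t′ when b) ≡ (t when b) ℤ.+ (t′ when b)
when-+ true = refl
when-+ false = refl

module _ (xs : List A) where

  ∑-words-1 : ∀ f → ∑ (words 1 xs) f ≡ ∑ xs (λ x → f (x ∷ []))
  ∑-words-1 f = trans (∑-words-suc 0 xs f) (∑-cong xs (λ x → ℤP.+-identityʳ _))

  ∑-words-2 : ∀ f → ∑ (words 2 xs) f ≡ ∑ xs (λ x → ∑ xs (λ y → f (x ∷ y ∷ [])))
  ∑-words-2 f = trans (∑-words-suc 1 xs f) (∑-cong xs (λ x → ∑-words-1 (f ∘ (x ∷_))))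

  ∑-words-3 : ∀ f → ∑ (words 3 xs) f ≡ ∑ xs (λ x → ∑ xs (λ y → ∑ xs (λ z → f (x ∷ y ∷ z ∷ []))))
  ∑-words-3 f = trans (∑-words-suc 2 xs f) (∑-cong xs (λ x → ∑-words-2 (f ∘ (x ∷_))))

  ∑-words-4 : ∀ f → ∑ (words 4 xs) f ≡ ∑ xs (λ w → ∑ xs (λ x → ∑ xs (λ y → ∑ xs (λ z → f (w ∷ x ∷ y ∷ z ∷ [])))))
  ∑-words-4 f = trans (∑-words-suc 3 xs f) (∑-cong xs (λ x → ∑-words-3 (f ∘ (x ∷_))))

  ∑²-when : ∀ (f : A → A → ℤ) b → ∑ xs (λ x → ∑ xs (λ y → f x y when b)) ≡ (∑ xs (λ x → ∑ xs (f x)) when b)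
  ∑²-when f b = trans (∑-cong xs (λ x → ∑-when xs (f x) b)) (∑-when xs _ b)

  ∑³-when : ∀ (f : A → A → A → ℤ) b → ∑ xs (λ x → ∑ xs (λ y → ∑ xs (λ z → f x y z when b))) ≡ (∑ xs (λ x → ∑ xs (λ y → ∑ xs (f x y))) when b)
  ∑³-when f b = trans (∑-cong xs (λ x → ∑²-when (f x) b)) (∑-when xs _ b)

module Assembly (n : ℕ) (1≤n : 1 ℕ.≤ n) (s′ : ℕ) (la : List ℕ) (p : IsPartition la) (mu : List ℕ) (e : ℕ) where

  open Operators n 1≤n
  open Coefficient mu e

  private
    ς K : ℕ
    ς = 2 ℕ.+ s′
    K = ς ℕ.+ 2

    sd : List ℤ → Bool
    sd = strictlyDecreasingᵇ

    χ : FSum → ℤ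
    χ v = coeff v mu e

    -- Taken from the effective words of full length `K`, so that one alphabet serves every way of
    -- cutting such a word into factors.
    letters : List ℤ
    letters = deduplicate ℤ._≟_ (concat (candidates n K la))

    letters-unique : Unique letters
    letters-unique = DecUnique.deduplicate-! ℤ._≟_ (concat (candidates n K la))

    cw : List ℤ → ℤ
    cw w = χ (run w (term 0 la))

    candidate-letters : ∀ {w} → w ∈ candidates n K la → All (_∈ letters) w
    candidate-letters w∈ = All.tabulate λ x∈ → ∈-deduplicate⁺ ℤ._≟_ (∈-concat⁺′ x∈ w∈)

    nonzero-candidate : ∀ {la} → IsPartition la → ∀ w → χ (run w (term 0 la)) ≢ + 0 → w ∈ candidates n (length w) la
    nonzero-candidate {la} p w nz = candidates-complete p w λ zero → nz (cong χ (trans (sym (uWord-run w la)) zero))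

    nonzero-letters : ∀ w → length w ≡ K → cw w ≢ + 0 → All (_∈ letters) w
    nonzero-letters w len nz = candidate-letters (subst (λ k → w ∈ candidates n k la) len (nonzero-candidate p w nz))

    h-sum : ∀ j {v} → Monomial v → (∀ w → length w ≡ j → χ (run w v) ≢ + 0 → w ∈ words j letters) →
      χ (applyOp (h n j) v) ≡ ∑ (words j letters) (λ w → χ (run w v) when sd w)
    h-sum j zero _ = sym (∑-zero (words j letters) λ w → when-zero (sd w) (cong χ (run-[] w)))
    h-sum j (unit {nu} e′ q) among = begin
      χ (scale (+ 1) e′ (h n j nu) ++ [])
        ≡⟨ cong χ (++-identityʳ (scale (+ 1) e′ (h n j nu))) ⟩
      χ (scale (+ 1) e′ (concatMap (λ w → if sd w then uWord n w nu else []) cand))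
        ≡⟨ cong χ (map-concatMap _ (λ w → if sd w then uWord n w nu else []) cand) ⟩
      χ (concatMap (λ w → scale (+ 1) e′ (if sd w then uWord n w nu else [])) cand)
        ≡⟨ coeff-concatMap _ cand ⟩
      ∑ cand (λ w → χ (scale (+ 1) e′ (if sd w then uWord n w nu else [])))
        ≡⟨ ∑-cong cand summand ⟩
      ∑ cand (λ w → χ (run w (term e′ nu)) when sd w)
        ≡⟨ ∑-support _ (candidates-unique n j nu) (words-unique j letters-unique)
             (λ {w} w∈ nz → among w (candidates-length n j nu w∈) (when-nonzero (sd w) nz))
             (λ {w} w∈ nz → subst (λ k → w ∈ candidates n k nu) (∈-words-length j w∈)
               (candidates-complete q w λ zero → when-nonzero (sd w) nz
                 (cong χ (trans (run-term w e′ nu) (cong (scale (+ 1) e′) zero))))) ⟩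
      ∑ (words j letters) (λ w → χ (run w (term e′ nu)) when sd w) ∎
      where
      open ≡-Reasoning
      cand : List (List ℤ)
      cand = candidates n j nu
      pick : ∀ b v → χ (scale (+ 1) e′ (if b then v else [])) ≡ (χ (scale (+ 1) e′ v) when b)
      pick true v = refl
      pick false v = refl
      summand : ∀ w → χ (scale (+ 1) e′ (if sd w then uWord n w nu else [])) ≡ (χ (run w (term e′ nu)) when sd w)
      summand w = trans (pick (sd w) (uWord n w nu)) (cong (λ v → χ v when sd w) (sym (run-term w e′ nu)))

    product-sum : ∀ j m → j ℕ.+ m ≡ K → χ ((h n j ∘Op h n m) la) ≡
      ∑ (words j letters) (λ w₁ → ∑ (words m letters) (λ w₂ → cw (w₁ ++ w₂) when sd w₂) when sd w₁)
    product-sum j m j+m≡K = begin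
      χ (applyOp (h n j) (concatMap (λ w → if sd w then uWord n w la else []) cand))
        ≡⟨ cong χ (applyOp-concatMap (h n j) (λ w → if sd w then uWord n w la else []) cand) ⟩
      χ (concatMap (λ w → applyOp (h n j) (if sd w then uWord n w la else [])) cand)
        ≡⟨ coeff-concatMap _ cand ⟩
      ∑ cand (λ w₂ → χ (applyOp (h n j) (if sd w₂ then uWord n w₂ la else [])))
        ≡⟨ ∑-cong-∈ cand (λ {w₂} w₂∈ → summand w₂ (candidates-length n m la w₂∈)) ⟩
      ∑ cand (λ w₂ → ∑ (words j letters) (λ w₁ → (cw (w₁ ++ w₂) when sd w₂) when sd w₁))
        ≡⟨ ∑-swap cand (words j letters) _ ⟩
      ∑ (words j letters) (λ w₁ → ∑ cand (λ w₂ → (cw (w₁ ++ w₂) when sd w₂) when sd w₁))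
        -- The range of w₂ is changed only with w₁ fixed, because `letters` is known to contain the
        -- letters of effective words of full length.
        ≡⟨ ∑-cong-∈ (words j letters) (λ {w₁} w₁∈ → trans (∑-when cand _ (sd w₁)) (cong (_when sd w₁) (extend w₁ (∈-words-length j w₁∈)))) ⟩
      ∑ (words j letters) (λ w₁ → ∑ (words m letters) (λ w₂ → cw (w₁ ++ w₂) when sd w₂) when sd w₁) ∎
      where
      open ≡-Reasoning
      cand : List (List ℤ)
      cand = candidates n m la
      length≡ : ∀ w₁ w₂ → length w₁ ≡ j → length w₂ ≡ m → length (w₁ ++ w₂) ≡ K
      length≡ w₁ w₂ l₁ l₂ = trans (length-++ w₁) (trans (cong₂ ℕ._+_ l₁ l₂) j+m≡K)
      pick : ∀ b v → χ (applyOp (h n j) (if b then v else [])) ≡ (χ (applyOp (h n j) v) when b)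
      pick true v = refl
      pick false v = refl
      comm-when : ∀ b c {t} → ((t when b) when c) ≡ ((t when c) when b)
      comm-when true c = refl
      comm-when false true = refl
      comm-when false false = refl
      summand : ∀ w₂ → length w₂ ≡ m → χ (applyOp (h n j) (if sd w₂ then uWord n w₂ la else [])) ≡
        ∑ (words j letters) (λ w₁ → (cw (w₁ ++ w₂) when sd w₂) when sd w₁)
      summand w₂ l₂ = begin
        χ (applyOp (h n j) (if sd w₂ then uWord n w₂ la else []))
          ≡⟨ pick (sd w₂) (uWord n w₂ la) ⟩
        (χ (applyOp (h n j) (uWord n w₂ la)) when sd w₂)
          ≡⟨ cong (λ v → χ (applyOp (h n j) v) when sd w₂) (uWord-run w₂ la) ⟩
        (χ (applyOp (h n j) (run w₂ (term 0 la))) when sd w₂)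
          ≡⟨ cong (_when sd w₂) (h-sum j (monomial-run w₂ (unit 0 p)) among) ⟩
        (∑ (words j letters) (λ w₁ → χ (run w₁ (run w₂ (term 0 la))) when sd w₁) when sd w₂)
          ≡⟨ sym (∑-when (words j letters) _ (sd w₂)) ⟩
        ∑ (words j letters) (λ w₁ → (χ (run w₁ (run w₂ (term 0 la))) when sd w₁) when sd w₂)
          ≡⟨ ∑-cong (words j letters) (λ w₁ → trans (comm-when (sd w₁) (sd w₂))
               (cong (λ v → (χ v when sd w₂) when sd w₁) (sym (run-++ w₁ w₂ (term 0 la))))) ⟩
        ∑ (words j letters) (λ w₁ → (cw (w₁ ++ w₂) when sd w₂) when sd w₁) ∎
        where
        among : ∀ w₁ → length w₁ ≡ j → χ (run w₁ (run w₂ (term 0 la))) ≢ + 0 → w₁ ∈ words j letters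
        among w₁ l₁ nz = subst (λ k → w₁ ∈ words k letters) l₁ (∈-words⁺ (AllP.++⁻ˡ w₁
          (nonzero-letters (w₁ ++ w₂) (length≡ w₁ w₂ l₁ l₂) (nz ∘ trans (cong χ (sym (run-++ w₁ w₂ (term 0 la))))))))
      extend : ∀ w₁ → length w₁ ≡ j → ∑ cand (λ w₂ → cw (w₁ ++ w₂) when sd w₂) ≡ ∑ (words m letters) (λ w₂ → cw (w₁ ++ w₂) when sd w₂)
      extend w₁ l₁ = ∑-support _ (candidates-unique n m la) (words-unique m letters-unique)
        (λ {w₂} w₂∈ nz → subst (λ k → w₂ ∈ words k letters) (candidates-length n m la w₂∈) (∈-words⁺ (AllP.++⁻ʳ w₁
          (nonzero-letters (w₁ ++ w₂) (length≡ w₁ w₂ l₁ (candidates-length n m la w₂∈)) (when-nonzero (sd w₂) nz)))))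
        (λ {w₂} w₂∈ nz → subst (λ k → w₂ ∈ candidates n k la) (∈-words-length m w₂∈)
          (candidates-complete p w₂ λ zero → when-nonzero (sd w₂) nz (cong χ (trans (run-++ w₁ w₂ (term 0 la))
            (trans (cong (run w₁) (trans (sym (uWord-run w₂ la)) zero)) (run-[] w₁))))))

    g : List ℤ → ℤ
    g w = ∑ (fillingsWithReading ς w) (λ filled → cw (reading filled) when nCommutingᵇ n filled)

    g-value : ∀ v b a d c → length v ≡ s′ →
      g (v ++ b ∷ a ∷ d ∷ c ∷ []) ≡ (cw (v ++ b ∷ a ∷ d ∷ c ∷ []) when (sd (v ++ b ∷ []) ∧ commuting n a b c d))
    g-value v b a d c len = value (commutingFilling s′ v a b c d len)
      where
      w : List ℤ
      w = v ++ b ∷ a ∷ d ∷ c ∷ []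
      value : (∃[ filled ] fillingsWithReading ς w ≡ filled ∷ [] × reading filled ≡ w ×
        (∀ n → nCommutingᵇ n filled ≡ sd (v ++ b ∷ []) ∧ commuting n a b c d)) →
        g w ≡ (cw w when (sd (v ++ b ∷ []) ∧ commuting n a b c d))
      value (filled , f≡ , r≡ , c≡) = trans (cong (λ l → ∑ l (λ filled → cw (reading filled) when nCommutingᵇ n filled)) f≡)
        (trans (ℤP.+-identityʳ _) (cong₂ (λ w b → cw w when b) r≡ (c≡ n)))

    commuting-sum : χ (commutingSum n ς la) ≡ ∑ (words K letters) g
    commuting-sum = begin
      χ (concatMap (λ w → concatMap (λ T → if nCommutingᵇ n T then uWord n (reading T) la else []) (fillingsWithReading ς w)) cand)
        ≡⟨ coeff-concatMap _ cand ⟩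
      ∑ cand (λ w → χ (concatMap (λ T → if nCommutingᵇ n T then uWord n (reading T) la else []) (fillingsWithReading ς w)))
        ≡⟨ ∑-cong cand (λ w → trans (coeff-concatMap _ (fillingsWithReading ς w)) (∑-cong (fillingsWithReading ς w) λ T →
             trans (coeff-when (nCommutingᵇ n T) _) (cong (λ v → χ v when nCommutingᵇ n T) (uWord-run (reading T) la)))) ⟩
      ∑ cand g
        ≡⟨ ∑-support g (candidates-unique n K la) (words-unique K letters-unique)
             (λ {w} w∈ _ → subst (λ k → w ∈ words k letters) (candidates-length n K la w∈) (∈-words⁺ (candidate-letters w∈)))
             (λ {w} w∈ nz → candidate w (∈-words-length K {letters} w∈) nz) ⟩
      ∑ (words K letters) g ∎
      where
      open ≡-Reasoning
      cand : List (List ℤ)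
      cand = candidates n K la
      shape : ∀ w → g w ≢ + 0 → (∃[ v ] ∃[ v′ ] w ≡ v ++ v′ × length v ≡ s′ × length v′ ≡ 4) → cw w ≢ + 0
      shape _ nz (v , b ∷ a ∷ d ∷ c ∷ [] , refl , l , refl) = when-nonzero _ (nz ∘ trans (g-value v b a d c l))
      candidate : ∀ w → length w ≡ K → g w ≢ + 0 → w ∈ cand
      candidate w len nz = subst (λ k → w ∈ candidates n k la) len (nonzero-candidate p w
        (shape w nz (decompose s′ w (trans len (trans (cong (2 ℕ.+_) (ℕP.+-comm s′ 2)) (ℕP.+-comm 4 s′))))))

    f : List ℤ → ℤ → ℤ → ℤ → ℤ → ℤ
    f v b a d c = χ (run v (U b (U a (U d (U c (term 0 la))))))

    f≡cw : ∀ v b a d c {w} → w ≡ v ++ b ∷ a ∷ d ∷ c ∷ [] → cw w ≡ f v b a d c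
    f≡cw v b a d c refl = cong χ (run-++ v (b ∷ a ∷ d ∷ c ∷ []) (term 0 la))

    t₁ t₂ t₃ : List ℤ → ℤ → ℤ → ℤ → ℤ → ℤ
    t₁ v b a d c = f v b a d c when ((a <ℤ b) ∧ (c <ℤ d))
    t₂ v b a d c = f v b a d c when ((a <ℤ b) ∧ (d <ℤ a))
    t₃ v b a d c = f v b a d c when commuting n a b c d

    ∑³ : (ℤ → ℤ → ℤ → ℤ) → ℤ
    ∑³ t = ∑ letters λ a → ∑ letters λ d → ∑ letters λ c → t a d c

    triples : ∀ v b → ∑³ (t₁ v b) ≡ ∑³ (t₂ v b) ℤ.+ ∑³ (t₃ v b)
    triples v b = TripleSum.triple-sum n letters (f v b)
      (λ a c → trans (cong Z (square-zero a (monomial-U c unit₀))) Z-[])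
      (λ a c → trans (cong Z (trans (cong (U a) (square-zero c unit₀)) (U-[] a))) Z-[])
      (λ a d → trans (cong Z (return-zero a d unit₀)) Z-[])
      (λ {x} {y} far → cong Z (far-relation₁ far (monomial-U y unit₀)))
      (λ {x} {y} far → cong (Z ∘ U y) (far-relation₁ far unit₀))
      (λ x<y y<z near → cong Z (near-relation₁ x<y y<z near unit₀))
      (λ x<y y<z near → cong Z (near-relation₂ x<y y<z near unit₀))
      b
      where
      Z : FSum → ℤ
      Z w = χ (run v (U b w))
      Z-[] : Z [] ≡ + 0
      Z-[] = cong χ (trans (cong (run v) (U-[] b)) (run-[] v))
      unit₀ : Monomial (term 0 la)
      unit₀ = unit 0 p

    grouped : (List ℤ → ℤ → ℤ → ℤ → ℤ → ℤ) → ℤ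
    grouped t = ∑ (words s′ letters) λ v → ∑ letters λ b → ∑³ (t v b) when sd (v ++ b ∷ [])

    group : ∀ t (k : List ℤ → ℤ → ℤ → ℤ → ℤ → ℤ) →
      (∀ v b a d c → length v ≡ s′ → k v b a d c ≡ (t v b a d c when sd (v ++ b ∷ []))) →
      ∑ (words s′ letters) (λ v → ∑ letters λ b → ∑³ (k v b)) ≡ grouped t
    group t k k≡ = ∑-cong-∈ (words s′ letters) λ {v} v∈ → ∑-cong letters λ b → trans
      (∑-cong letters λ a → ∑-cong letters λ d → ∑-cong letters λ c → k≡ v b a d c (∈-words-length s′ v∈))
      (∑³-when letters (t v b) (sd (v ++ b ∷ [])))

    prefixed : ∀ k t → ∑ (words (k ℕ.+ s′) letters) t ≡ ∑ (words s′ letters) (λ v → ∑ (words k letters) (λ w → t (v ++ w)))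
    prefixed k t = trans (cong (λ j → ∑ (words j letters) t) (ℕP.+-comm k s′)) (∑-words-+ s′ k letters t)

    when-cong : ∀ {t t′ q q′} → t ≡ t′ → q ≡ q′ → (t when q) ≡ (t′ when q′)
    when-cong refl refl = refl

    grouped₁ : χ ((h n ς ∘Op h n 2) la) ≡ grouped t₁
    grouped₁ = trans (product-sum ς 2 refl) (trans (prefixed 2 _) (trans
      (∑-cong (words s′ letters) λ v → trans (∑-words-2 letters _) (∑-cong letters λ b → ∑-cong letters λ a →
        trans (cong (_when sd (v ++ b ∷ a ∷ [])) (∑-words-2 letters _)) (sym (∑²-when letters _ (sd (v ++ b ∷ a ∷ []))))))
      (group t₁ _ λ v b a d c _ → trans
        (when-cong {q = sd (v ++ b ∷ a ∷ [])} (when-cong {q = (c <ℤ d) ∧ true} (f≡cw v b a d c (++-assoc v (b ∷ a ∷ []) (d ∷ c ∷ []))) (∧-identityʳ (c <ℤ d)))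
          (trans (strictlyDecreasing-++ v b (a ∷ [])) (cong (sd (v ++ b ∷ []) ∧_) (∧-identityʳ (a <ℤ b)))))
        (trans (sym (when-∧ (sd (v ++ b ∷ [])) (a <ℤ b))) (cong (_when sd (v ++ b ∷ [])) (when-∧ (a <ℤ b) (c <ℤ d)))))))

    grouped₂ : χ ((h n (suc ς) ∘Op h n 1) la) ≡ grouped t₂
    grouped₂ = trans (product-sum (suc ς) 1 (sym (ℕP.+-suc ς 1))) (trans (prefixed 3 _) (trans
      (∑-cong (words s′ letters) λ v → trans (∑-words-3 letters _) (∑-cong letters λ b → ∑-cong letters λ a → ∑-cong letters λ d →
        trans (cong (_when sd (v ++ b ∷ a ∷ d ∷ [])) (∑-words-1 letters _)) (sym (∑-when letters _ (sd (v ++ b ∷ a ∷ d ∷ []))))))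
      (group t₂ _ λ v b a d c _ → trans
        (when-cong {q = sd (v ++ b ∷ a ∷ d ∷ [])} (f≡cw v b a d c (++-assoc v (b ∷ a ∷ d ∷ []) (c ∷ [])))
          (trans (strictlyDecreasing-++ v b (a ∷ d ∷ [])) (cong (λ q → sd (v ++ b ∷ []) ∧ ((a <ℤ b) ∧ q)) (∧-identityʳ (d <ℤ a)))))
        (sym (when-∧ (sd (v ++ b ∷ [])) ((a <ℤ b) ∧ (d <ℤ a)))))))

    grouped₃ : χ (commutingSum n ς la) ≡ grouped t₃
    grouped₃ = trans commuting-sum (trans (cong (λ j → ∑ (words j letters) g) (cong (2 ℕ.+_) (ℕP.+-comm s′ 2))) (trans (prefixed 4 g) (trans
      (∑-cong (words s′ letters) λ v → ∑-words-4 letters _)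
      (group t₃ _ λ v b a d c len → trans (g-value v b a d c len) (trans
        (sym (when-∧ (sd (v ++ b ∷ [])) (commuting n a b c d)))
        (cong (λ t → (t when commuting n a b c d) when sd (v ++ b ∷ [])) (f≡cw v b a d c refl)))))))

    grouped-+ : grouped t₁ ≡ grouped t₂ ℤ.+ grouped t₃
    grouped-+ = trans
      (∑-cong (words s′ letters) λ v → trans
        (∑-cong letters λ b → trans (cong (_when sd (v ++ b ∷ [])) (triples v b)) (when-+ (sd (v ++ b ∷ []))))
        (∑-+ letters _ _))
      (∑-+ (words s′ letters) _ _)

  schur-commuting : coeff (schur2 n ς la) mu e ≡ coeff (commutingSum n ς la) mu e
  schur-commuting = begin
    χ (schur2 n ς la)
      ≡⟨ coeff-++ ((h n ς ∘Op h n 2) la) (scale (-[1+ 0 ]) 0 ((h n (suc ς) ∘Op h n 1) la)) ⟩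
    χ ((h n ς ∘Op h n 2) la) ℤ.+ χ (scale (-[1+ 0 ]) 0 ((h n (suc ς) ∘Op h n 1) la))
      ≡⟨ cong₂ ℤ._+_ (trans grouped₁ grouped-+) (trans (coeff-negate ((h n (suc ς) ∘Op h n 1) la)) (cong ℤ.-_ grouped₂)) ⟩
    (grouped t₂ ℤ.+ grouped t₃) ℤ.- grouped t₂
      ≡⟨ solve 2 (λ x y → (x :+ y) :- x := y) refl (grouped t₂) (grouped t₃) ⟩
    grouped t₃
      ≡⟨ sym grouped₃ ⟩
    χ (commutingSum n ς la) ∎
    where
    open ≡-Reasoning
    open +-*-Solver

theorem7p5 : (n : ℕ) → 1 ≤ n → (s : ℕ) → 2 ≤ s →
    (la : List ℕ) → IsPartition la → (mu : List ℕ) → (e : ℕ) →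
    coeff (schur2 n s la) mu e ≡ coeff (commutingSum n s la) mu e
theorem7p5 n 1≤n (suc (suc s)) (s≤s (s≤s z≤n)) la p mu e = Assembly.schur-commuting n 1≤n s la p mu e
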